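{- There exists an algorithm that, given a $k$-shortest graph $G$ on $n$ vertices (with its $k$ partitions), a set of $l$ pairs of vertices $(s_1,t_1),\dots,(s_l,t_l)$ of $G$ and a function $c:[l]\to[k]$, decides in time $n^{O(l^{5^k})}$ whether the $k$-DSP problem defined by $G$, the pairs $(s_i,t_i)$ and $c$ has a solution.
   Context: Graphs are finite, simple and undirected; $[k]=\{1,\dots,k\}$. A graph $G$ is a $k$-shortest graph if there exist $k$ partitions $(V^i_1,\dots,V^i_{l_i})$, $i\in[k]$, of $V(G)$ such that (1) for every edge $xy$ of $G$ there are $i\in[k]$ and $j\in[l_i-1]$ such that one endpoint is in $V^i_j$ and the other in $V^i_{j+1}$; (2) if $x\in V^i_j$ and $y\in V^i_r$ for some $i\in[k]$ with $|j-r|>1$, then $xy\notin E(G)$. A $k$-shortest graph is always considered together with such partitions. An edge with one endpoint in $V^i_j$ and the other in $V^i_{j+1}$ is said to be of colour $i$ (an edge may have several colours). Write $x\le_i y$ if $x\in V^i_j$, $y\in V^i_r$ with $j\le r$. A path $x_1,\dots,x_r$ is a path of colour $i$ if for every $j\in[r-1]$, $x_jx_{j+1}$ is an edge of colour $i$ and $x_j\le_i x_{j+1}$. It is oriented from $x_1$ to $x_r$; a path of colour $i$ between $x$ and $y$ is one whose endpoints are $x$ and $y$ (in either orientation). Given a $k$-shortest graph $G$, pairs $(s_1,t_1),\dots,(s_l,t_l)$ and $c:[l]\to[k]$, the $k$-DSP problem they define is to find pairwise internally vertex-disjoint paths $P_1,\dots,P_l$ such that for every $i\in[l]$, $P_i$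 is a path of colour $c(i)$ between $s_i$ and $t_i$. Two paths are internally vertex-disjoint if no internal vertex of one is a vertex of the other (they may share endpoints). Here $k$ is regarded as fixed, and the constant hidden in $O(\cdot)$ may depend on $k$. -}

module Defs where

open import Data.Bool using (Bool; true; false; T; if_then_else_)
open import Data.Fin using (Fin; zero; suc; toℕ; fromℕ; fromℕ<; inject₁; remQuot)
open import Data.Nat using (ℕ; zero; suc; _+_; _*_; _∸_; _≤_; _<_; ∣_-_∣; _≡ᵇ_; _<?_)
open import Data.Product using (Σ; ∃; _×_; _,_; uncurry)
open import Data.Sum using (_⊎_)
open import Function using (_∘_)
open import Function.Definitions using (Injective; StrictlySurjective)
open import Relation.Binary.PropositionalEquality using (_≡_; _≢_)
open import Relation.Nullary using (¬_; Dec; does; yes; no)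

------------------------------------------------------------------------
-- Graphs and paths

record Graph (n : ℕ) : Set where
  field
    adj     : Fin n → Fin n → Bool
    symm    : ∀ x y → adj x y ≡ adj y x
    irrefl  : ∀ x → adj x x ≡ false

  Edge : Fin n → Fin n → Set
  Edge x y = T (adj x y)

-- The vertex sequence has length + 1 entries; a single vertex is a path.
record Path {n : ℕ} (G : Graph n) : Set where
  open Graph G
  field
    length    : ℕ
    vertex    : Fin (suc length) → Fin n
    distinct  : Injective _≡_ _≡_ vertex
    edges     : ∀ (j : Fin length) → Edge (vertex (inject₁ j)) (vertex (suc j))

  source target : Fin n
  source = vertex zero
  target = vertex (fromℕ length)

  VertexOf InternalVertexOf : Fin n → Set
  VertexOf v         = ∃ λ j → vertex j ≡ v
  InternalVertexOf v = VertexOf v × v ≢ source × v ≢ target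

  Joins : Fin n → Fin n → Set
  Joins x y = (source ≡ x × target ≡ y) ⊎ (source ≡ y × target ≡ x)

InternallyDisjoint : ∀ {n} {G : Graph n} → Path G → Path G → Set
InternallyDisjoint P Q =
  ∀ v → (InternalVertexOf P v → ¬ VertexOf Q v)
      × (InternalVertexOf Q v → ¬ VertexOf P v)
  where open Path

------------------------------------------------------------------------
-- k-shortest graphs

Consecutive : ℕ → ℕ → Set
Consecutive a b = suc a ≡ b ⊎ suc b ≡ a

-- The i-th ordered partition is given by the function sending a vertex to
-- the (0-based) index of its class; classes of a partition are nonempty.
record KShortest (k : ℕ) {n : ℕ} (G : Graph n) : Set where
  open Graph G
  field
    classes   : Fin k → ℕ
    class     : ∀ i → Fin n → Fin (classes i)
    nonempty  : ∀ i → StrictlySurjective _≡_ (class i)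

  level : Fin k → Fin n → ℕ
  level i x = toℕ (class i x)

  field
    covered   : ∀ x y → Edge x y → ∃ λ i → Consecutive (level i x) (level i y)
    no-jump   : ∀ i x y → 1 < ∣ level i x - level i y ∣ → ¬ Edge x y

  EdgeOfColour : Fin k → Fin n → Fin n → Set
  EdgeOfColour i x y = Edge x y × Consecutive (level i x) (level i y)

  _≤[_]_ : Fin n → Fin k → Fin n → Set
  x ≤[ i ] y = level i x ≤ level i y

  PathOfColour : Fin k → Path G → Set
  PathOfColour i P = ∀ (j : Fin length) →
    EdgeOfColour i (vertex (inject₁ j)) (vertex (suc j)) ×
    (vertex (inject₁ j) ≤[ i ] vertex (suc j))
    where open Path P

------------------------------------------------------------------------
-- The k-DSP problem

record Instance (k n l : ℕ) : Set where
  field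
    graph    : Graph n
    shortest : KShortest k graph
    s t      : Fin l → Fin n
    c        : Fin l → Fin k

HasSolution : ∀ {k n l} → Instance k n l → Set
HasSolution {l = l} I =
  Σ (Fin l → Path graph) λ P →
    (∀ i → PathOfColour (c i) (P i) × Path.Joins (P i) (s i) (t i)) ×
    (∀ i j → i ≢ j → InternallyDisjoint (P i) (P j))
  where
  open Instance I
  open KShortest shortest

------------------------------------------------------------------------
-- Algorithms: structured programs for a unit-cost random access machine.
-- The memory has registers (x ≔ e) and unbounded arrays (a [ d ]≔ e) of
-- natural numbers, of which a program names finitely many.  The only
-- arithmetic is addition and truncated subtraction, so that word lengths
-- after T steps exceed the initial ones by O(T) bits and unit cost is
-- polynomially related to Turing machine time.

infixl 6 _⊕_ _⊖_
infix  4 _≔_ _[_]≔_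
infixr 2 _⨾_
infix  3 ifnz_then_else_ whilenz_loop_

data Exp : Set where
  lit      : ℕ → Exp
  reg      : ℕ → Exp
  arr      : ℕ → Exp → Exp
  _⊕_ _⊖_  : Exp → Exp → Exp

data Program : Set where
  skip            : Program
  _≔_             : ℕ → Exp → Program
  _[_]≔_          : ℕ → Exp → Exp → Program
  _⨾_             : Program → Program → Program
  ifnz_then_else_ : Exp → Program → Program → Program
  whilenz_loop_   : Exp → Program → Program

record Memory : Set where
  constructor ⟪_,_⟫
  field
    regs : ℕ → ℕ
    arrs : ℕ → ℕ → ℕ
open Memory public

_[_↦_] : {A : Set} → (ℕ → A) → ℕ → A → (ℕ → A)
(f [ a ↦ v ]) b = if b ≡ᵇ a then v else f b

eval : Exp → Memory → ℕ
eval (lit m)   σ = m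
eval (reg x)   σ = regs σ x
eval (arr a e) σ = arrs σ a (eval e σ)
eval (e ⊕ f)   σ = eval e σ + eval f σ
eval (e ⊖ f)   σ = eval e σ ∸ eval f σ

-- Number of steps needed to evaluate an expression.
cost : Exp → ℕ
cost (lit m)   = 1
cost (reg x)   = 1
cost (arr a e) = suc (cost e)
cost (e ⊕ f)   = suc (cost e + cost f)
cost (e ⊖ f)   = suc (cost e + cost f)

-- ⟨ p , σ ⟩⇓[ T ] τ : started in memory σ, the program p halts after exactly
-- T steps in memory τ.
data ⟨_,_⟩⇓[_]_ : Program → Memory → ℕ → Memory → Set where
  ⇓skip  : ∀ {σ} → ⟨ skip , σ ⟩⇓[ 1 ] σ
  ⇓reg   : ∀ {x e σ} →
           ⟨ x ≔ e , σ ⟩⇓[ suc (cost e) ]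
           ⟪ regs σ [ x ↦ eval e σ ] , arrs σ ⟫
  ⇓arr   : ∀ {a d e σ} →
           ⟨ a [ d ]≔ e , σ ⟩⇓[ suc (cost d + cost e) ]
           ⟪ regs σ , arrs σ [ a ↦ arrs σ a [ eval d σ ↦ eval e σ ] ] ⟫
  ⇓seq   : ∀ {p q σ τ υ S T} →
           ⟨ p , σ ⟩⇓[ S ] τ → ⟨ q , τ ⟩⇓[ T ] υ →
           ⟨ p ⨾ q , σ ⟩⇓[ suc (S + T) ] υ
  ⇓then  : ∀ {e p q σ τ T} → eval e σ ≢ 0 → ⟨ p , σ ⟩⇓[ T ] τ →
           ⟨ ifnz e then p else q , σ ⟩⇓[ suc (cost e + T) ] τ
  ⇓else  : ∀ {e p q σ τ T} → eval e σ ≡ 0 → ⟨ q , σ ⟩⇓[ T ] τ →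
           ⟨ ifnz e then p else q , σ ⟩⇓[ suc (cost e + T) ] τ
  ⇓exit  : ∀ {e p σ} → eval e σ ≡ 0 →
           ⟨ whilenz e loop p , σ ⟩⇓[ suc (cost e) ] σ
  ⇓iter  : ∀ {e p σ τ υ S T} → eval e σ ≢ 0 →
           ⟨ p , σ ⟩⇓[ S ] τ → ⟨ whilenz e loop p , τ ⟩⇓[ T ] υ →
           ⟨ whilenz e loop p , σ ⟩⇓[ suc (cost e + S + T) ] υ

bit : Bool → ℕ
bit b = if b then 1 else 0

-- The answer is read from register 0: 1 for "yes" and 0 for "no".
DecidesWithin : Program → Memory → Set → ℕ → Set
DecidesWithin p σ A B =
  ∃ λ T → ∃ λ τ →
    ⟨ p , σ ⟩⇓[ T ] τ × T ≤ B × Σ (Dec A) λ d → regs τ 0 ≡ bit (does d)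

------------------------------------------------------------------------
-- Input encoding

array : ∀ {m} → (Fin m → ℕ) → ℕ → ℕ
array {m} f p with p <? m
... | yes p<m = f (fromℕ< p<m)
... | no  _   = 0

-- Row-major: the entry (x , y) is at address n * x + y.
matrix : ∀ {m n} → (Fin m → Fin n → ℕ) → ℕ → ℕ
matrix {m} {n} f = array (uncurry f ∘ remQuot {m} n)

encode : ∀ {k n l} → Instance k n l → Memory
encode {k} {n} {l} I = ⟪ registers , arrays ⟫
  where
  open Instance I
  open Graph graph
  open KShortest shortest

  registers : ℕ → ℕ
  registers 0 = n
  registers 1 = l
  registers _ = 0

  arrays : ℕ → ℕ → ℕ
  arrays 0 = matrix λ x y → bit (adj x y)
  arrays 1 = matrix level
  arrays 2 = array (toℕ ∘ s)
  arrays 3 = array (toℕ ∘ t)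
  arrays 4 = array (toℕ ∘ c)
  arrays _ = λ _ → 0

{-# OPTIONS --safe #-}

-- Write z i v for the level of v for colour i. Along a path of colour i every form z i ± z j is monotone, since z i
-- grows by 1 and z j changes by at most 1 in each step. For two paths of colours i and j there are constants γ and δ
-- such that, in the coordinates z i - z j and z i + z j, the paths lie in opposite pairs of closed quadrants around
-- (γ , δ); at a vertex that is on the same side of these lines as both paths, one of the relations z i = z j + γ and
-- z i = δ - z j must hold. Close the set of these relations under composition: the result has O(l²)^(2^k) elements.
-- Cut each path, of colour i say, where one of the forms z i - g (z j), with g in the closure, changes its sign. Give
-- each piece as new colour the least one linked to i by relations that hold on the piece; the piece also has this
-- colour (possibly against its direction). If the hulls of pieces of two different paths meet in a vertex, its links
-- are those of both pieces, so that both have the same new colour.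
--
-- So there is a solution if and only if one can guess the ends and new colours of the pieces such that hulls of
-- different new colours are disjoint, and sweep all pieces simultaneously, each at time r being at its vertex of level
-- r for its new colour: disjointness then needs to be checked only between vertices of the same time. The program
-- explores the n^O(l M) configurations, M being the number of pieces of a path, in a table. With M = O(l^(2^(k+1)))
-- the exponent is within l^(5^k), as 1 + 2^(k+1) ≤ 5^k for k ≥ 1.

module Submission where

open import Defs
open import Data.Bool using (Bool; true; false; T; if_then_else_)
open import Data.Empty using (⊥-elim)
open import Data.Fin using (Fin; zero; suc; toℕ; fromℕ; fromℕ<; inject₁; combine; remQuot)
open import Data.Fin.Properties using (injective⇒≤; toℕ<n; toℕ-injective; toℕ-fromℕ<; fromℕ<-toℕ; toℕ-inject₁; toℕ-fromℕ; toℕ-combine; remQuot-combine) renaming (_≟_ to _≟ᶠ_)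
open import Data.Integer using (ℤ; 0ℤ)
import Data.Integer as ℤ
import Data.Integer.Properties as ℤ
open import Data.Integer.Tactic.RingSolver using (solve-∀)
open import Data.List using (List; []; _∷_; _++_; length; upTo; allFin; map; cartesianProduct; cartesianProductWith)
open import Data.List.Membership.Propositional using (_∈_; find; lose)
open import Data.List.Membership.Propositional.Properties using (∈-upTo⁺; ∈-upTo⁻; ∈-cartesianProduct⁺; ∈-cartesianProduct⁻; ∈-map⁺; ∈-++⁺ˡ; ∈-++⁺ʳ; ∈-allFin; ∈-cartesianProductWith⁺)
open import Data.List.Properties using (length-map; length-++; length-upTo; length-tabulate)
open import Data.List.Relation.Unary.Any using (Any; here; there; any?)
open import Data.Nat using (ℕ; zero; suc; _+_; _*_; _∸_; _^_; _≤_; _<_; _⊔_; _⊓_; z≤n; s≤s; _≡ᵇ_; _≟_; _<?_; _≤?_; ∣_-_∣; NonZero; >-nonZero)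
open import Data.Nat.Properties
open import Data.Nat.Solver using (module +-*-Solver)
open import Data.Product using (Σ; ∃; _×_; _,_; proj₁; proj₂; uncurry)
open import Data.Sum using (_⊎_; inj₁; inj₂; [_,_]′)
import Data.Vec
open import Data.Vec using (Vec; []; _∷_; lookup) renaming (_[_]≔_ to _[_]←_)
open import Data.Vec.Properties using (lookup∘update; lookup∘update′; []≔-idempotent)
open import Function using (_∘_)
open import Relation.Nullary using (Dec; does; yes; no; ¬_)
open import Relation.Nullary.Decidable using (_×-dec_; _⊎-dec_)
open import Relation.Binary.PropositionalEquality using (_≡_; _≢_; refl; sym; trans; cong; cong₂; subst; subst₂)

-- Two paths of different colours have no common clock, so a sweep by levels cannot see where they
-- meet; the recolouring gives one clock to all pieces that might meet. Hulls matter because the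
-- search guesses only the ends of a piece: every vertex that a path of its colour between these
-- ends could use is in the hull. All forms are monotone there, so a sign shared by both ends is the
-- sign at each vertex of the hull, on the path or not. The point (γ , δ) exists for any two paths,
-- disjoint or not: in the plane of the two coordinates one path is a rising chain and the other a
-- falling one. Composites are needed because the new colour is chosen at the start of a piece but
-- compared at another vertex of the hull: a chain of relations carries over link by link only if
-- the relation between the original colour and each colour on the chain keeps its sign. The program
-- text may depend on k only, so M, the base of the codes and the cap are computed at run time.

infixl 6 _∔_ _∸′_

-- A term language and its compiler.

-- A loop runs exactly cap times, where the cap is the value of global 2; its body sees the accumulator as
-- variable 0 and the counter as variable 1. Hence the running time is polynomial in the cap, whatever is computed.
data Term (v : ℕ) : Set where
  var      : Fin v → Term v
  lit      : ℕ → Term v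
  glob     : Fin 10 → Term v
  arr      : ℕ → Term v → Term v
  _∔_ _∸′_ : Term v → Term v → Term v
  ite      : Term v → Term v → Term v → Term v
  loop     : Term v → Term (2 + v) → Term v
  call     : ∀ {m} → Term m → Vec (Term v) m → Term v

fold : (ℕ → ℕ → ℕ) → ℕ → ℕ → ℕ
fold f a zero    = a
fold f a (suc j) = f (fold f a j) j

choose : ℕ → ℕ → ℕ → ℕ
choose zero    a b = b
choose (suc _) a b = a

pattern gcap = suc (suc zero)

module _ (G : Fin 10 → ℕ) (A : ℕ → ℕ → ℕ) where
  mutual
    ⟦_⟧ : ∀ {v} → Term v → Vec ℕ v → ℕ
    ⟦ var i ⟧     ρ = lookup ρ i
    ⟦ lit m ⟧     ρ = m
    ⟦ glob g ⟧    ρ = G g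
    ⟦ arr a t ⟧   ρ = A a (⟦ t ⟧ ρ)
    ⟦ t ∔ u ⟧     ρ = ⟦ t ⟧ ρ + ⟦ u ⟧ ρ
    ⟦ t ∸′ u ⟧    ρ = ⟦ t ⟧ ρ ∸ ⟦ u ⟧ ρ
    ⟦ ite c t u ⟧ ρ = choose (⟦ c ⟧ ρ) (⟦ t ⟧ ρ) (⟦ u ⟧ ρ)
    ⟦ loop t u ⟧  ρ = fold (λ a j → ⟦ u ⟧ (a ∷ j ∷ ρ)) (⟦ t ⟧ ρ) (G gcap)
    ⟦ call f ts ⟧ ρ = ⟦ f ⟧ (⟦ ts ⟧* ρ)

    ⟦_⟧* : ∀ {v m} → Vec (Term v) m → Vec ℕ v → Vec ℕ m
    ⟦ [] ⟧*     ρ = []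
    ⟦ t ∷ ts ⟧* ρ = ⟦ t ⟧ ρ ∷ ⟦ ts ⟧* ρ

-- The registers where `compile*` leaves the arguments of a call; the body of the call then works
-- above them.
from : ℕ → (m : ℕ) → Vec ℕ m
from d zero    = []
from d (suc m) = d ∷ from (suc d) m

-- The value goes to register d; registers below d are preserved.
mutual
  compile : ∀ {v} → Term v → ℕ → Vec ℕ v → Program
  compile (var i)     d R = d ≔ reg (lookup R i)
  compile (lit m)     d R = d ≔ lit m
  compile (glob g)    d R = d ≔ reg (toℕ g)
  compile (arr a t)   d R = compile t d R ⨾ d ≔ arr a (reg d)
  compile (t ∔ u)     d R = compile t d R ⨾ compile u (suc d) R ⨾ d ≔ reg d ⊕ reg (suc d)
  compile (t ∸′ u)    d R = compile t d R ⨾ compile u (suc d) R ⨾ d ≔ reg d ⊖ reg (suc d)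
  compile (ite c t u) d R = compile c d R ⨾ (ifnz (reg d) then compile t d R else compile u d R)
  compile (loop t u)  d R = compile t d R ⨾ suc d ≔ lit 0 ⨾
    (whilenz (reg 2 ⊖ reg (suc d)) loop
      (compile u (2 + d) (d ∷ suc d ∷ R) ⨾ d ≔ reg (2 + d) ⨾ suc d ≔ reg (suc d) ⊕ lit 1))
  compile (call {m} f ts) d R =
    compile* ts d R ⨾ compile f (m + d) (from d m) ⨾ d ≔ reg (m + d)

  compile* : ∀ {v m} → Vec (Term v) m → ℕ → Vec ℕ v → Program
  compile* []       d R = skip
  compile* (t ∷ ts) d R = compile t d R ⨾ compile* ts (suc d) R

mutual
  -- A bound that depends on the data only through the cap N: each loop is charged N rounds and a
  -- conditional both of its branches.
  time : ∀ {v} → Term v → ℕ → ℕ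
  time (var i)     N = 2
  time (lit m)     N = 2
  time (glob g)    N = 2
  time (arr a t)   N = time t N + 4
  time (t ∔ u)     N = time t N + (time u N + 6)
  time (t ∸′ u)    N = time t N + (time u N + 6)
  time (ite c t u) N = time c N + (time t N + time u N + 3)
  time (loop t u)  N = time t N + (N * (time u N + 12) + 8)
  time (call f ts) N = time* ts N + (time f N + 4)

  time* : ∀ {v m} → Vec (Term v) m → ℕ → ℕ
  time* []       N = 1
  time* (t ∷ ts) N = time t N + (time* ts N + 1)

upd-same : ∀ {A : Set} (f : ℕ → A) a v → (f [ a ↦ v ]) a ≡ v
upd-same f a v with a ≡ᵇ a in eq
... | true = refl
... | false with () ← subst (λ b → T b) eq (≡⇒≡ᵇ a a refl)

upd-other : ∀ {A : Set} (f : ℕ → A) a v {b} → b ≢ a → (f [ a ↦ v ]) b ≡ f b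
upd-other f a v {b} b≢a with b ≡ᵇ a in eq
... | false = refl
... | true = ⊥-elim (b≢a (≡ᵇ⇒≡ b a (subst T (sym eq) _)))

-- Registers 0 to 9 hold the globals. A compiled term writes only to registers from d ≥ 10 on, so
-- neither the globals, among them the cap, nor the variables can change under it.
record Env {v} (G : Fin 10 → ℕ) (A : ℕ → ℕ → ℕ) (ρ : Vec ℕ v) (R : Vec ℕ v) (d : ℕ) (σ : Memory) : Set where
  field
    base  : 10 ≤ d
    globs : ∀ g → regs σ (toℕ g) ≡ G g
    arrays : arrs σ ≡ A
    below : ∀ i → lookup R i < d
    vals  : ∀ i → regs σ (lookup R i) ≡ lookup ρ i

record Outcome (p : Program) (σ : Memory) (N d x : ℕ) : Set where
  constructor outcome
  field
    {steps} : ℕ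
    {end}   : Memory
    run     : ⟨ p , σ ⟩⇓[ steps ] end
    bounded : steps ≤ N
    result  : regs end d ≡ x
    frame   : ∀ r → r < d → regs end r ≡ regs σ r
    frameᵃ  : arrs end ≡ arrs σ

module _ {G : Fin 10 → ℕ} {A : ℕ → ℕ → ℕ} where

  open Env

  env-step : ∀ {v} {ρ R : Vec ℕ v} {d d′ σ τ} → Env G A ρ R d σ → d ≤ d′ →
             (∀ r → r < d → regs τ r ≡ regs σ r) → arrs τ ≡ arrs σ → Env G A ρ R d′ τ
  env-step e d≤ fr fra = record
    { base = ≤-trans (base e) d≤
    ; globs = λ g → trans (fr _ (≤-trans (toℕ<n g) (base e))) (globs e g)
    ; arrays = trans fra (arrays e)
    ; below = λ i → ≤-trans (below e i) d≤
    ; vals = λ i → trans (fr _ (below e i)) (vals e i) }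

  env-cons : ∀ {v} {ρ R : Vec ℕ v} {d σ x r} → Env G A ρ R d σ → r < d → regs σ r ≡ x →
             Env G A (x ∷ ρ) (r ∷ R) d σ
  env-cons e r<d eq = record
    { base = base e ; globs = globs e ; arrays = arrays e
    ; below = λ { zero → r<d ; (suc i) → below e i }
    ; vals = λ { zero → eq ; (suc i) → vals e i } }

  Outcome* : ∀ {m} → Program → Memory → ℕ → ℕ → Vec ℕ m → Set
  Outcome* {m} p σ N d xs = ∃ λ T → ∃ λ τ → ⟨ p , σ ⟩⇓[ T ] τ × T ≤ N ×
    (∀ i → lookup (from d m) i < m + d) × (∀ i → regs τ (lookup (from d m) i) ≡ lookup xs i) ×
    (∀ r → r < d → regs τ r ≡ regs σ r) × arrs τ ≡ arrs σ

  assign : ∀ {σ τ : Memory} d e → (∀ r → r < d → regs τ r ≡ regs σ r) →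
           (∀ r → r < d → (regs τ [ d ↦ eval e τ ]) r ≡ regs σ r)
  assign {σ} {τ} d e fr r r<d = trans (upd-other (regs τ) d _ (<⇒≢ r<d)) (fr r r<d)

  choose-≡0 : ∀ {c} a b → c ≡ 0 → choose c a b ≡ b
  choose-≡0 a b refl = refl

  choose-≢0 : ∀ {c} a b → c ≢ 0 → choose c a b ≡ a
  choose-≢0 {zero}  a b c≢0 = ⊥-elim (c≢0 refl)
  choose-≢0 {suc c} a b c≢0 = refl

  mutual
    compile-correct : ∀ {v} (t : Term v) {ρ R d σ} → Env G A ρ R d σ →
                      Outcome (compile t d R) σ (time t (G gcap)) d (⟦ G ⟧ A t ρ)
    compile-correct (var i) {d = d} {σ} e =
      outcome ⇓reg ≤-refl (trans (upd-same (regs σ) d _) (vals e i)) (assign {σ} {σ} d (reg _) λ _ _ → refl) refl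
    compile-correct (lit m) {d = d} {σ} e =
      outcome ⇓reg ≤-refl (upd-same (regs σ) d _) (assign {σ} {σ} d (lit m) λ _ _ → refl) refl
    compile-correct (glob g) {d = d} {σ} e =
      outcome ⇓reg ≤-refl (trans (upd-same (regs σ) d _) (globs e g)) (assign {σ} {σ} d (reg _) λ _ _ → refl) refl
    compile-correct (arr a t) {d = d} {σ} e with compile-correct t e
    ... | outcome {S} {τ} run bd res fr fra =
      outcome (⇓seq run ⇓reg) (≤-trans (≤-reflexive (sym (+-suc S 3))) (+-monoˡ-≤ 4 bd))
        (trans (upd-same (regs τ) d _) (cong₂ (λ B x → B a x) (trans fra (arrays e)) res))
        (assign {σ} {τ} d (arr a (reg d)) fr) fra
    compile-correct (t ∔ u) e = binary t u _⊕_ _+_ (λ _ _ _ → refl) (λ _ _ → refl) e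
    compile-correct (t ∸′ u) e = binary t u _⊖_ _∸_ (λ _ _ _ → refl) (λ _ _ → refl) e
    compile-correct (ite c t u) {ρ} {d = d} {σ} e with compile-correct c e
    ... | outcome {S} {τ} run bd res fr fra with regs τ d ≟ 0
    ... | yes z with compile-correct u (env-step e ≤-refl fr fra)
    ... | outcome {S′} {τ′} run′ bd′ res′ fr′ fra′ =
      outcome (⇓seq run (⇓else z run′))
        (≤-trans (≤-reflexive (sym (solve 2 (λ a b → a :+ (b :+ con 3) := con 1 :+ (a :+ (con 2 :+ b))) refl S S′)))
               (+-mono-≤ bd (+-monoˡ-≤ 3 (≤-trans bd′ (m≤n+m _ _)))))
        (trans res′ (sym (choose-≡0 _ _ (trans (sym res) z))))
        (λ r r<d → trans (fr′ r r<d) (fr r r<d)) (trans fra′ fra)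
      where open +-*-Solver
    compile-correct (ite c t u) {ρ} {d = d} {σ} e | outcome {S} {τ} run bd res fr fra | no nz
      with compile-correct t (env-step e ≤-refl fr fra)
    ... | outcome {S′} {τ′} run′ bd′ res′ fr′ fra′ =
      outcome (⇓seq run (⇓then nz run′))
        (≤-trans (≤-reflexive (sym (solve 2 (λ a b → a :+ (b :+ con 3) := con 1 :+ (a :+ (con 2 :+ b))) refl S S′)))
               (+-mono-≤ bd (+-monoˡ-≤ 3 (≤-trans bd′ (m≤m+n _ _)))))
        (trans res′ (sym (choose-≢0 _ _ (λ z → nz (trans res z)))))
        (λ r r<d → trans (fr′ r r<d) (fr r r<d)) (trans fra′ fra)
      where open +-*-Solver
    compile-correct (loop t u) {ρ} {R} {d} {σ} e with compile-correct t e
    ... | outcome {S} {τ} run bd res fr fra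
      with loop-correct u (G gcap) 0 (⟦ G ⟧ A t ρ)
             {σ = ⟪ regs τ [ suc d ↦ 0 ] , arrs τ ⟫} (+-identityʳ _)
             (env-step e ≤-refl (λ r r<d → trans (upd-other (regs τ) (suc d) _ (<⇒≢ (m<n⇒m<1+n r<d))) (fr r r<d)) fra)
             (trans (upd-other (regs τ) (suc d) _ (<⇒≢ (n<1+n d))) res) (upd-same (regs τ) (suc d) 0)
    ... | outcome {S′} {τ′} run′ bd′ res′ fr′ fra′ =
      outcome (⇓seq run (⇓seq ⇓reg run′))
        (≤-trans (≤-reflexive (sym (solve 2 (λ a b → a :+ (b :+ con 4) := con 1 :+ (a :+ (con 1 :+ (con 2 :+ b)))) refl S S′)))
          (+-mono-≤ bd (≤-trans (+-monoˡ-≤ 4 bd′) (≤-reflexive (+-assoc (G gcap * (time u (G gcap) + 12)) 4 4)))))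
        res′
        (λ r r<d → trans (fr′ r r<d) (trans (upd-other (regs τ) (suc d) _ (<⇒≢ (m<n⇒m<1+n r<d))) (fr r r<d)))
        (trans fra′ fra)
      where open +-*-Solver
    compile-correct (call {m} f ts) {ρ} {R} {d} {σ} e with compile*-correct ts e
    ... | T , τ , run , bd , lt , vs , fr , fra
      with compile-correct f {⟦ G ⟧* A ts ρ} {from d m} {m + d} {τ}
             (record { base = ≤-trans (base e) (m≤n+m d m)
                     ; globs = λ g → trans (fr _ (≤-trans (toℕ<n g) (base e))) (globs e g)
                     ; arrays = trans fra (arrays e) ; below = lt ; vals = vs })
    ... | outcome {S′} {τ′} run′ bd′ res′ fr′ fra′ =
      outcome (⇓seq run (⇓seq run′ ⇓reg))
        (≤-trans (≤-reflexive (sym (solve 2 (λ a b → a :+ (b :+ con 4) := con 1 :+ (a :+ (con 1 :+ (b :+ con 2)))) refl T S′)))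
          (+-mono-≤ bd (+-monoˡ-≤ 4 bd′)))
        (trans (upd-same (regs τ′) d _) res′)
        (assign {σ} {τ′} d (reg (m + d)) λ r r<d → trans (fr′ r (≤-trans r<d (m≤n+m d m))) (fr r r<d))
        (trans fra′ fra)
      where open +-*-Solver

    binary : ∀ {v} (t u : Term v) (⊛ : Exp → Exp → Exp) (f : ℕ → ℕ → ℕ) →
      (∀ a b τ → eval (⊛ a b) τ ≡ f (eval a τ) (eval b τ)) → (∀ a b → cost (⊛ a b) ≡ suc (cost a + cost b)) →
      ∀ {ρ R d σ} → Env G A ρ R d σ →
      Outcome (compile t d R ⨾ compile u (suc d) R ⨾ d ≔ ⊛ (reg d) (reg (suc d))) σ
        (time t (G gcap) + (time u (G gcap) + 6)) d (f (⟦ G ⟧ A t ρ) (⟦ G ⟧ A u ρ))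
    binary t u ⊛ f ev co {ρ} {R} {d} {σ} e with compile-correct t e
    ... | outcome {S} {τ} run bd res fr fra with compile-correct u (env-step e (n≤1+n d) fr fra)
    ... | outcome {S′} {τ′} run′ bd′ res′ fr′ fra′ =
      outcome (⇓seq run (⇓seq run′ ⇓reg))
        (≤-trans (≤-reflexive (sym (trans (solve 2 (λ a b → a :+ (b :+ con 6) := con 1 :+ (a :+ (con 1 :+ (b :+ con 4)))) refl S S′)
                             (cong (λ c → suc (S + suc (S′ + suc c))) (sym (co (reg d) (reg (suc d))))))))
          (+-mono-≤ bd (+-monoˡ-≤ 6 bd′)))
        (trans (upd-same (regs τ′) d _)
          (trans (ev _ _ τ′) (cong₂ f (trans (fr′ d (n<1+n d)) res) res′)))
        (assign {σ} {τ′} d (⊛ (reg d) (reg (suc d))) λ r r<d → trans (fr′ r (m<n⇒m<1+n r<d)) (fr r r<d))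
        (trans fra′ fra)
      where open +-*-Solver

    -- Induction on the number n of rounds left: n + j is the cap, fixed in register 2, while the
    -- counter j rises.
    loop-correct : ∀ {v} (u : Term (2 + v)) n j a {ρ R d σ} → n + j ≡ G gcap →
      Env G A ρ R d σ →
      regs σ d ≡ fold (λ a j → ⟦ G ⟧ A u (a ∷ j ∷ ρ)) a j → regs σ (suc d) ≡ j →
      Outcome (whilenz (reg 2 ⊖ reg (suc d)) loop
                (compile u (2 + d) (d ∷ suc d ∷ R) ⨾ d ≔ reg (2 + d) ⨾ suc d ≔ reg (suc d) ⊕ lit 1))
              σ (n * (time u (G gcap) + 12) + 4) d (fold (λ a j → ⟦ G ⟧ A u (a ∷ j ∷ ρ)) a (G gcap))
    loop-correct u zero j a {σ = σ} eq e acc cnt =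
      outcome (⇓exit (trans (cong₂ _∸_ (trans (globs e gcap) (sym eq)) cnt) (n∸n≡0 j))) ≤-refl
        (trans acc (cong (fold _ a) eq)) (λ _ _ → refl) refl
    loop-correct u (suc n) j a {ρ} {R} {d} {σ} eq e acc cnt
      with compile-correct u {fold (λ a j → ⟦ G ⟧ A u (a ∷ j ∷ ρ)) a j ∷ j ∷ ρ} {d ∷ suc d ∷ R} {2 + d} {σ}
             (env-cons (env-cons (env-step e (m≤n+m d 2) (λ _ _ → refl) refl) (n<1+n (suc d)) cnt) (m<n⇒m<1+n (n<1+n d)) acc)
    ... | outcome {S} {τ} run bd res fr fra
      with loop-correct u n (suc j) a {d = d}
             {σ = ⟪ (regs τ [ d ↦ regs τ (2 + d) ]) [ suc d ↦ (regs τ [ d ↦ regs τ (2 + d) ]) (suc d) + 1 ] , arrs τ ⟫}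
             (trans (+-suc n j) eq)
             (env-step e ≤-refl
                (λ r r<d → trans (upd-other (regs τ [ d ↦ regs τ (2 + d) ]) (suc d) _ (<⇒≢ (m<n⇒m<1+n r<d)))
                  (trans (upd-other (regs τ) d _ (<⇒≢ r<d)) (fr r (m<n⇒m<1+n (m<n⇒m<1+n r<d))))) fra)
             (trans (upd-other (regs τ [ d ↦ regs τ (2 + d) ]) (suc d) _ (<⇒≢ (n<1+n d))) (trans (upd-same (regs τ) d _) res))
             (trans (upd-same (regs τ [ d ↦ regs τ (2 + d) ]) (suc d) _)
               (trans (cong (_+ 1) (trans (upd-other (regs τ) d _ (λ p → <⇒≢ (n<1+n d) (sym p)))
                                          (trans (fr (suc d) (n<1+n (suc d))) cnt)))
                      (+-comm j 1)))
    ... | outcome {S′} {τ′} run′ bd′ res′ fr′ fra′ =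
      outcome (⇓iter ne (⇓seq run (⇓seq ⇓reg ⇓reg)) run′)
        (≤-trans (≤-reflexive (sym (solve 2 (λ a b → a :+ con 12 :+ b := con 1 :+ ((con 3 :+ (con 1 :+ (a :+ con 7))) :+ b)) refl S S′)))
          (≤-trans (+-mono-≤ (+-monoˡ-≤ 12 bd) bd′)
             (≤-reflexive (sym (+-assoc (time u (G gcap) + 12) _ 4)))))
        res′
        (λ r r<d → trans (fr′ r r<d) (trans (upd-other (regs τ [ d ↦ regs τ (2 + d) ]) (suc d) _ (<⇒≢ (m<n⇒m<1+n r<d)))
                  (trans (upd-other (regs τ) d _ (<⇒≢ r<d)) (fr r (m<n⇒m<1+n (m<n⇒m<1+n r<d))))))
        (trans fra′ fra)
      where
      open +-*-Solver
      ne : regs σ 2 ∸ regs σ (suc d) ≢ 0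
      ne z = <⇒≢ {0} {suc n} (s≤s z≤n) (sym (trans (sym (trans (cong₂ _∸_ (trans (globs e gcap) (sym eq)) cnt) (m+n∸n≡m (suc n) j))) z))

    compile*-correct : ∀ {v m} (ts : Vec (Term v) m) {ρ R d σ} → Env G A ρ R d σ →
      Outcome* (compile* ts d R) σ (time* ts (G gcap)) d (⟦ G ⟧* A ts ρ)
    compile*-correct [] e = _ , _ , ⇓skip , ≤-refl , (λ ()) , (λ ()) , (λ _ _ → refl) , refl
    compile*-correct {m = suc m} (t ∷ ts) {d = d} {σ} e with compile-correct t e
    ... | outcome {S} {τ} run bd res fr fra with compile*-correct ts (env-step e (n≤1+n d) fr fra)
    ... | T , τ′ , run′ , bd′ , lt , vs , fr′ , fra′ =
      _ , _ , ⇓seq run run′ ,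
      ≤-trans (≤-reflexive (sym (solve 2 (λ a b → a :+ (b :+ con 1) := con 1 :+ (a :+ b)) refl S T))) (+-mono-≤ bd (+-monoˡ-≤ 1 bd′)) ,
      (λ { zero → m<n+m d (s≤s z≤n) ; (suc i) → subst (lookup (from (suc d) m) i <_) (+-suc m d) (lt i) }) ,
      (λ { zero → trans (fr′ d (n<1+n d)) res ; (suc i) → vs i }) ,
      (λ r r<d → trans (fr′ r (m<n⇒m<1+n r<d)) (fr r r<d)) , trans fra′ fra
      where open +-*-Solver

-- Polynomial bounds

-- One number serves as coefficient and exponent, and the base `suc N` is positive, so that powers
-- grow with the exponent; this makes closure under sums and products easy.
Polynomial : (ℕ → ℕ) → Set
Polynomial f = ∃ λ e → ∀ N → f N ≤ e * suc N ^ e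

polynomial-const : ∀ c → Polynomial (λ _ → c)
polynomial-const c = c , λ N → m≤m*n c (suc N ^ c) {{m^n≢0 (suc N) c}}

polynomial-id : Polynomial (λ N → N)
polynomial-id = 1 , λ N → ≤-trans (n≤1+n N) (≤-reflexive (sym (trans (+-identityʳ _) (*-identityʳ (suc N)))))

polynomial-+ : ∀ {f g} → Polynomial f → Polynomial g → Polynomial (λ N → f N + g N)
polynomial-+ (d , f≤) (e , g≤) = d + e , λ N → ≤-trans
  (+-mono-≤ (≤-trans (f≤ N) (*-monoʳ-≤ d (^-monoʳ-≤ (suc N) (m≤m+n d e))))
            (≤-trans (g≤ N) (*-monoʳ-≤ e (^-monoʳ-≤ (suc N) (m≤n+m e d)))))
  (≤-reflexive (sym (*-distribʳ-+ (suc N ^ (d + e)) d e)))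

polynomial-* : ∀ {f g} → Polynomial f → Polynomial g → Polynomial (λ N → f N * g N)
polynomial-* (d , f≤) (e , g≤) = d * e + (d + e) , λ N → ≤-trans (*-mono-≤ (f≤ N) (g≤ N)) (≤-trans
  (≤-reflexive (trans ([m*n]*[o*p]≡[m*o]*[n*p] d (suc N ^ d) e (suc N ^ e))
                      (cong (d * e *_) (sym (^-distribˡ-+-* (suc N) d e)))))
  (*-mono-≤ (m≤m+n (d * e) (d + e)) (^-monoʳ-≤ (suc N) (m≤n+m (d + e) (d * e)))))

-- Abstract because the exponents are huge numerals.
abstract
  mutual
    polynomial-time : ∀ {v} (t : Term v) → Polynomial (time t)
    polynomial-time (var i)     = polynomial-const 2
    polynomial-time (lit m)     = polynomial-const 2
    polynomial-time (glob g)    = polynomial-const 2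
    polynomial-time (arr a t)   = polynomial-+ (polynomial-time t) (polynomial-const 4)
    polynomial-time (t ∔ u)     = polynomial-+ (polynomial-time t) (polynomial-+ (polynomial-time u) (polynomial-const 6))
    polynomial-time (t ∸′ u)    = polynomial-+ (polynomial-time t) (polynomial-+ (polynomial-time u) (polynomial-const 6))
    polynomial-time (ite c t u) = polynomial-+ (polynomial-time c)
      (polynomial-+ (polynomial-+ (polynomial-time t) (polynomial-time u)) (polynomial-const 3))
    polynomial-time (loop t u)  = polynomial-+ (polynomial-time t)
      (polynomial-+ (polynomial-* polynomial-id (polynomial-+ (polynomial-time u) (polynomial-const 12))) (polynomial-const 8))
    polynomial-time (call f ts) = polynomial-+ (polynomial-time* ts) (polynomial-+ (polynomial-time f) (polynomial-const 4))

    polynomial-time* : ∀ {v m} (ts : Vec (Term v) m) → Polynomial (time* ts)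
    polynomial-time* []       = polynomial-const 1
    polynomial-time* (t ∷ ts) = polynomial-+ (polynomial-time t) (polynomial-+ (polynomial-time* ts) (polynomial-const 1))

-- Programs on global registers

record State (V : Vec ℕ 10) (A : ℕ → ℕ → ℕ) (σ : Memory) : Set where
  constructor state
  field
    globals : ∀ g → regs σ (toℕ g) ≡ lookup V g
    memory  : arrs σ ≡ A

record Reaches (p : Program) (σ : Memory) (N : ℕ) (P : Memory → Set) : Set where
  constructor reaches
  field
    {steps} : ℕ
    {end}   : Memory
    run     : ⟨ p , σ ⟩⇓[ steps ] end
    bounded : steps ≤ N
    post    : P end

seq : ∀ {p q σ M N P Q} → Reaches p σ M P → (∀ τ → P τ → Reaches q τ N Q) → Reaches (p ⨾ q) σ (suc (M + N)) Q
seq (reaches {end = τ} r b P) f with f τ P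
... | reaches r′ b′ Q = reaches (⇓seq r r′) (s≤s (+-mono-≤ b b′)) Q

weaken : ∀ {p σ M N P} → M ≤ N → Reaches p σ M P → Reaches p σ N P
weaken M≤N (reaches r b P) = reaches r (≤-trans b M≤N) P

set : Fin 10 → Term 0 → Program
set g t = compile t 10 [] ⨾ toℕ g ≔ reg 10

env₀ : ∀ {V A σ} → State V A σ → Env (lookup V) A [] [] 10 σ
env₀ (state gl me) = record { base = ≤-refl ; globs = gl ; arrays = me ; below = λ () ; vals = λ () }

update-globals : ∀ {V : Vec ℕ 10} {f : ℕ → ℕ} i x → (∀ g → f (toℕ g) ≡ lookup V g) →
                 ∀ g → (f [ toℕ i ↦ x ]) (toℕ g) ≡ lookup (V [ i ]← x) g
update-globals {V} {f} i x eq g with g ≟ᶠ i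
... | yes refl = trans (upd-same f (toℕ i) x) (sym (lookup∘update i V x))
... | no g≢i = trans (upd-other f (toℕ i) x (g≢i ∘ toℕ-injective)) (trans (eq g) (sym (lookup∘update′ g≢i V x)))

set-correct : ∀ g t {V A σ} → State V A σ →
  Reaches (set g t) σ (time t (lookup V gcap) + 3) (State (V [ g ]← ⟦ lookup V ⟧ A t []) A)
set-correct g t {V} {A} {σ} s with compile-correct t (env₀ s)
... | outcome {S} {τ} run bd res fr fra = reaches (⇓seq run ⇓reg)
  (≤-trans (≤-reflexive (sym (+-suc S 2))) (+-monoˡ-≤ 3 bd))
  (state (λ h → trans (update-globals {V} {regs τ} g (regs τ 10) (λ i → trans (fr _ (toℕ<n i)) (State.globals s i)) h)
                   (cong (λ x → lookup (V [ g ]← x) h) res))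
         (trans fra (State.memory s)))

if-correct : ∀ t {p q V A σ N P} → State V A σ →
  (⟦ lookup V ⟧ A t [] ≢ 0 → ∀ τ → State V A τ → Reaches p τ N P) →
  (⟦ lookup V ⟧ A t [] ≡ 0 → ∀ τ → State V A τ → Reaches q τ N P) →
  Reaches (compile t 10 [] ⨾ (Defs.ifnz reg 10 then p else q)) σ (time t (lookup V gcap) + (3 + N)) P
if-correct t {N = N} s f g with compile-correct t (env₀ s)
... | outcome {S} {τ} run bd res fr fra with regs τ 10 ≟ 0
... | yes z with g (trans (sym res) z) τ (state (λ i → trans (fr _ (toℕ<n i)) (State.globals s i)) (trans fra (State.memory s)))
... | reaches r b P = reaches (⇓seq run (⇓else z r))
        (≤-trans (≤-reflexive (sym (+-suc S _))) (+-mono-≤ bd (s≤s (s≤s (s≤s b))))) P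
if-correct t {N = N} s f g | outcome {S} {τ} run bd res fr fra | no nz
  with f (λ z → nz (trans res z)) τ (state (λ i → trans (fr _ (toℕ<n i)) (State.globals s i)) (trans fra (State.memory s)))
... | reaches r b P = reaches (⇓seq run (⇓then nz r))
        (≤-trans (≤-reflexive (sym (+-suc S _))) (+-mono-≤ bd (s≤s (s≤s (s≤s b))))) P

pattern gz = suc (suc (suc (suc (suc (suc zero)))))

-- Fills array 5: entry z is the value of t when global 6 is z.
fill : Term 0 → Program
fill t = 6 ≔ lit 0 ⨾ (whilenz (reg 2 ⊖ reg 6) loop
  (compile t 10 [] ⨾ 5 [ reg 6 ]≔ reg 10 ⨾ 6 ≔ reg 6 ⊕ lit 1))

-- The term t may read array 5 while it is being filled, so the specification is an invariant of the
-- whole memory instead of a formula for each entry.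
module _ (t : Term 0) (Inv : ℕ → (ℕ → ℕ → ℕ) → Set) (V : Vec ℕ 10)
  (step : ∀ z A → z < lookup V gcap → Inv z A →
          Inv (suc z) (A [ 5 ↦ A 5 [ z ↦ ⟦ lookup (V [ gz ]← z) ⟧ A t [] ] ])) where

  Filled : Memory → Set
  Filled τ = ∃ λ A → Inv (lookup V gcap) A × State (V [ gz ]← lookup V gcap) A τ

  fill-loop : ∀ m z {A σ} → m + z ≡ lookup V gcap → Inv z A → State (V [ gz ]← z) A σ →
    Reaches (whilenz (reg 2 ⊖ reg 6) loop
      (compile t 10 [] ⨾ 5 [ reg 6 ]≔ reg 10 ⨾ 6 ≔ reg 6 ⊕ lit 1)) σ
      (m * (time t (lookup V gcap) + 13) + 4) Filled
  fill-loop zero z eq inv s = reaches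
    (⇓exit (trans (cong₂ _∸_ (trans (State.globals s gcap) (trans (lookup∘update′ {i = gcap} (λ ()) V z) (sym eq)))
                             (trans (State.globals s gz) (lookup∘update gz V z))) (n∸n≡0 z))) ≤-refl
    (_ , subst (λ z → Inv z _) eq inv , subst (λ z → State (V [ gz ]← z) _ _) eq s)
  fill-loop (suc m) z {A} {σ} eq inv s with compile-correct t (env₀ s)
  ... | outcome {S} {τ} run bd res fr refl
    with fill-loop m (suc z)
           {σ = ⟪ regs τ [ 6 ↦ regs τ 6 + 1 ] , arrs τ [ 5 ↦ arrs τ 5 [ regs τ 6 ↦ regs τ 10 ] ] ⟫}
           (trans (+-suc m z) eq)
           (step z A (≤-trans (≤-reflexive refl) (subst (suc z ≤_) eq (s≤s (m≤n+m z m)))) inv)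
           (state (λ h → trans (update-globals {V [ gz ]← z} {regs τ} gz (regs τ 6 + 1)
                                   (λ i → trans (fr _ (toℕ<n i)) (State.globals s i)) h)
                           (trans (cong (λ x → lookup ((V [ gz ]← z) [ gz ]← x) h) (trans (cong (_+ 1) z≡) (+-comm z 1)))
                                  (cong (λ W → lookup W h) ([]≔-idempotent V gz))))
                  (cong₂ (λ B f → B [ 5 ↦ f ]) (State.memory s)
                    (cong₂ (λ B g → g B) (cong (λ B → B 5) (State.memory s))
                       (cong₂ (λ a b f → f [ a ↦ b ]) z≡ res))))
    where
    z≡ : regs τ 6 ≡ z
    z≡ = trans (fr 6 (s≤s (s≤s (s≤s (s≤s (s≤s (s≤s (s≤s z≤n)))))))) (trans (State.globals s gz) (lookup∘update gz V z))
  ... | reaches {S′} run′ bd′ P = reaches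
    (⇓iter ne (⇓seq run (⇓seq ⇓arr ⇓reg)) run′)
    (≤-trans (≤-reflexive (solve 2 (λ a b → con 1 :+ ((con 3 :+ (con 1 :+ (a :+ con 8))) :+ b) := a :+ con 13 :+ b) refl S S′))
      (≤-trans (+-mono-≤ (+-monoˡ-≤ 13 (≤-trans bd (≤-reflexive (cong (time t) (lookup∘update′ {i = gcap} (λ ()) V z))))) bd′)
        (≤-reflexive (sym (+-assoc (time t (lookup V gcap) + 13) _ 4)))))
    P
    where
    open import Data.Nat.Solver
    open +-*-Solver
    ne : regs σ 2 ∸ regs σ 6 ≢ 0
    ne e = 1+n≢0 (trans (sym (trans (cong₂ _∸_ (trans (State.globals s gcap) (trans (lookup∘update′ {i = gcap} (λ ()) V z) (sym eq)))
                             (trans (State.globals s gz) (lookup∘update gz V z))) (m+n∸n≡m (suc m) z))) e)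

  fill-correct : ∀ {A σ} → Inv 0 A → State V A σ →
    Reaches (fill t) σ (lookup V gcap * (time t (lookup V gcap) + 13) + 7) Filled
  fill-correct {σ = σ} inv s with fill-loop (lookup V gcap) 0 {σ = ⟪ regs σ [ 6 ↦ 0 ] , arrs σ ⟫} (+-identityʳ _) inv
    (state (update-globals {V} {regs σ} gz 0 (State.globals s)) (State.memory s))
  ... | reaches r b P = reaches (⇓seq ⇓reg r)
    (≤-trans (s≤s (s≤s (s≤s b))) (≤-reflexive (trans (cong suc (trans (cong suc (sym (+-suc _ 4))) (sym (+-suc _ 5)))) (sym (+-suc _ 6))))) P

-- Logic of terms

-- Matching on it turns the number into 0 or 1, so that `choose` computes, and decides P at the same
-- time.
data Truth : ℕ → Set → Set₁ where
  holds : ∀ {P} → P → Truth 1 P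
  fails : ∀ {P} → ¬ P → Truth 0 P

infixr 4 _∧′_ _∨′_ _⇒′_
infix 5 _≤′_ _<′_ _≡′_

not′ : ∀ {v} → Term v → Term v
not′ t = ite t (lit 0) (lit 1)

_∧′_ _∨′_ _⇒′_ _≤′_ _<′_ _≡′_ : ∀ {v} → Term v → Term v → Term v
t ∧′ u = ite t u (lit 0)
t ∨′ u = ite t (lit 1) u
t ⇒′ u = ite t u (lit 1)
t ≤′ u = not′ (t ∸′ u)
t <′ u = lit 1 ∔ t ≤′ u
t ≡′ u = t ≤′ u ∧′ u ≤′ t

-- In the body of a quantifier, variable 1 is the bound variable and variable 0 is meaningless.
ex all : ∀ {v} → Term (2 + v) → Term (2 + v) → Term v
ex u φ  = loop (lit 0) (ite (var zero) (lit 1) (var (suc zero) <′ u ∧′ φ))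
all u φ = loop (lit 1) (ite (var zero) (var (suc zero) <′ u ⇒′ φ) (lit 0))

module _ {P Q : Set} where
  truth-∧ : ∀ {x y} → Truth x P → Truth y Q → Truth (choose x y 0) (P × Q)
  truth-∧ (holds p) (holds q)  = holds (p , q)
  truth-∧ (holds p) (fails ¬q) = fails (¬q ∘ proj₂)
  truth-∧ (fails ¬p) _         = fails (¬p ∘ proj₁)

  truth-∨ : ∀ {x y} → Truth x P → Truth y Q → Truth (choose x 1 y) (P ⊎ Q)
  truth-∨ (holds p)  _          = holds (inj₁ p)
  truth-∨ (fails ¬p) (holds q)  = holds (inj₂ q)
  truth-∨ (fails ¬p) (fails ¬q) = fails λ { (inj₁ p) → ¬p p ; (inj₂ q) → ¬q q }

  truth-⇒ : ∀ {x y} → Truth x P → Truth y Q → Truth (choose x y 1) (P → Q)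
  truth-⇒ (holds p)  (holds q)  = holds λ _ → q
  truth-⇒ (holds p)  (fails ¬q) = fails λ f → ¬q (f p)
  truth-⇒ (fails ¬p) _          = holds (⊥-elim ∘ ¬p)

  truth-map : ∀ {x} → (P → Q) → (Q → P) → Truth x P → Truth x Q
  truth-map f g (holds p)  = holds (f p)
  truth-map f g (fails ¬p) = fails (¬p ∘ g)

truth-¬ : ∀ {P x} → Truth x P → Truth (choose x 0 1) (¬ P)
truth-¬ (holds p)  = fails λ ¬p → ¬p p
truth-¬ (fails ¬p) = holds ¬p

truth-nz : ∀ x → Truth (choose x 0 1) (x ≡ 0)
truth-nz zero    = holds refl
truth-nz (suc x) = fails λ ()

truth-≤ : ∀ {x y x′ y′} → x ≡ x′ → y ≡ y′ → Truth (choose (x ∸ y) 0 1) (x′ ≤ y′)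
truth-≤ {x} {y} refl refl = truth-map (m∸n≡0⇒m≤n {x} {y}) m≤n⇒m∸n≡0 (truth-nz (x ∸ y))

truth-< : ∀ x y → Truth (choose (suc x ∸ y) 0 1) (x < y)
truth-< x y = truth-≤ refl refl

truth-≡ : ∀ {x y x′ y′} → x ≡ x′ → y ≡ y′ → Truth (choose (choose (x ∸ y) 0 1) (choose (y ∸ x) 0 1) 0) (x′ ≡ y′)
truth-≡ p q = truth-map (λ { (p , q) → ≤-antisym p q }) (λ { refl → ≤-refl , ≤-refl }) (truth-∧ (truth-≤ p q) (truth-≤ q p))

module _ {N cap : ℕ} {F : ℕ → ℕ → ℕ} {P : ℕ → Set} (N≤ : N ≤ cap)
  (body : ∀ a j → j < N → Truth (F a j) (P j)) where

  private
    -- The body is known to be correct only for j < N. Once the value of the guard is matched, a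
    -- body out of range is never consulted.
    guarded∃ : ∀ a j → Truth (choose (choose (suc j ∸ N) 0 1) (F a j) 0) (j < N × P j)
    guarded∃ a j with suc j ∸ N | truth-< j N
    ... | zero  | holds p  = truth-∧ (holds p) (body a j p)
    ... | suc _ | fails ¬p = fails (¬p ∘ proj₁)

    guarded∀ : ∀ a j → Truth (choose (choose (suc j ∸ N) 0 1) (F a j) 1) (j < N → P j)
    guarded∀ a j with suc j ∸ N | truth-< j N
    ... | zero  | holds p  = truth-⇒ (holds p) (body a j p)
    ... | suc _ | fails ¬p = holds (⊥-elim ∘ ¬p)

    iterate∃ : ∀ m → Truth (fold (λ a j → choose a 1 (choose (choose (suc j ∸ N) 0 1) (F a j) 0)) 0 m)
                           (∃ λ j → j < m × j < N × P j)
    iterate∃ zero = fails λ ()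
    iterate∃ (suc m) with fold (λ a j → choose a 1 (choose (choose (suc j ∸ N) 0 1) (F a j) 0)) 0 m | iterate∃ m
    ... | _ | holds (j , j<m , r) = holds (j , m<n⇒m<1+n j<m , r)
    ... | _ | fails ¬p = truth-map (λ r → m , ≤-refl , r)
      (λ { (j , j<m , r) → subst (λ j → j < N × P j) (≤-antisym (≤-pred j<m) (≮⇒≥ λ j<m → ¬p (j , j<m , r))) r })
      (guarded∃ 0 m)

    iterate∀ : ∀ m → Truth (fold (λ a j → choose a (choose (choose (suc j ∸ N) 0 1) (F a j) 1) 0) 1 m)
                           (∀ j → j < m → j < N → P j)
    iterate∀ zero = holds λ j ()
    iterate∀ (suc m) with fold (λ a j → choose a (choose (choose (suc j ∸ N) 0 1) (F a j) 1) 0) 1 m | iterate∀ m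
    ... | _ | fails ¬p = fails λ f → ¬p λ j j<m → f j (m<n⇒m<1+n j<m)
    ... | _ | holds p = truth-map
      (λ { q j j<1+m → case j j<1+m q (m≤n⇒m<n∨m≡n (≤-pred j<1+m)) })
      (λ f → f m ≤-refl) (guarded∀ 1 m)
      where
      case : ∀ j → j < suc m → (m < N → P m) → j < m ⊎ j ≡ m → j < N → P j
      case j _ q (inj₁ j<m)  = p j j<m
      case j _ q (inj₂ refl) = q

  truth-∃ : Truth (fold (λ a j → choose a 1 (choose (choose (suc j ∸ N) 0 1) (F a j) 0)) 0 cap) (∃ λ j → j < N × P j)
  truth-∃ = truth-map (λ { (j , _ , r) → j , r }) (λ { (j , j<N , p) → j , ≤-trans j<N N≤ , j<N , p }) (iterate∃ cap)

  truth-∀ : Truth (fold (λ a j → choose a (choose (choose (suc j ∸ N) 0 1) (F a j) 1) 0) 1 cap) (∀ j → j < N → P j)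
  truth-∀ = truth-map (λ f j j<N → f j (≤-trans j<N N≤) j<N) (λ f j _ → f j) (iterate∀ cap)

-- Certificates

-- The absolute difference, in the form that terms can express.
dist : ℕ → ℕ → ℕ
dist a r = (r ∸ a) + (a ∸ r)

Between : ℕ → ℕ → ℕ → Set
Between a b r = (a ≤ r × r ≤ b) ⊎ (b ≤ r × r ≤ a)

-- Vertices, colours, paths and pieces are natural numbers here. Path p is cut into M pieces; piece m
-- of path p leads from X p m to Y p m and is also a path of colour K p m, along which level or against
-- it; at time r the piece is at its vertex V r p m of level r for the colour K p m.
module Certificates (n k l M : ℕ) (E : ℕ → ℕ → Set) (lev : ℕ → ℕ → ℕ) (s t c : ℕ → ℕ) where

  -- Says that abs (z m v - z m u) ≤ z o v - z o u for every colour m, without subtraction. A path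
  -- of colour o from u to v requires this.
  Cone : ℕ → ℕ → ℕ → Set
  Cone o u v = ∀ m → m < k → (lev m v + lev o u ≤ lev o v + lev m u) × (lev m u + lev o u ≤ lev m v + lev o v)

  -- An interval of the cone order. It contains all vertices of all paths of colour o from x to y,
  -- so disjoint hulls keep two pieces apart whatever vertices they use.
  Hull : ℕ → ℕ → ℕ → ℕ → Set
  Hull o x y v = Cone o x v × Cone o v y

  Common : ℕ → ℕ → ℕ → Set
  Common p q v = (v ≡ s p ⊎ v ≡ t p) × (v ≡ s q ⊎ v ≡ t q)

  ForwardEdge : ℕ → ℕ → ℕ → Set
  ForwardEdge o u v = E u v × lev o v ≡ suc (lev o u)

  module _ (X Y K : ℕ → ℕ → ℕ) where

    Ends : ℕ → Set
    Ends p = (X p 0 ≡ s p × Y p (M ∸ 1) ≡ t p) ⊎ (X p 0 ≡ t p × Y p (M ∸ 1) ≡ s p)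

    -- The first case is for values that do not occur when a path is cut: their piece is a single
    -- vertex, repeating the end of the piece before.
    Junction : ℕ → ℕ → Set
    Junction p m = Y p m ≡ X p (suc m) ⊎ ForwardEdge (c p) (Y p m) (X p (suc m))

    Separated : ℕ → ℕ → Set
    Separated p q = ∀ m → m < M → ∀ m′ → m′ < M → ¬ K p m ≡ K q m′ → ∀ v → v < n →
      Hull (c p) (X p m) (Y p m) v → Hull (c q) (X q m′) (Y q m′) v → Common p q v

    Static : Set
    Static = (∀ p → p < l → Ends p) ×
      (∀ p → p < l → ∀ m → m < M ∸ 1 → Junction p m) ×
      (∀ p → p < l → ∀ q → q < l → ¬ p ≡ q → Separated p q)

    Active : ℕ → ℕ → ℕ → Set
    Active r p m = Between (lev (K p m) (X p m)) (lev (K p m) (Y p m)) r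

    -- The level for the colour `c p` grows with the distance in time from X, in whichever direction
    -- the sweep passes. This makes the moves edges of the original colour, rising from X to Y.
    OnPiece : ℕ → ℕ → ℕ → ℕ → Set
    OnPiece r p m v = lev (K p m) v ≡ r × lev (c p) v ≡ lev (c p) (X p m) + dist (lev (K p m) (X p m)) r ×
      Hull (c p) (X p m) (Y p m) v ×
      (r ≡ lev (K p m) (X p m) → v ≡ X p m) × (r ≡ lev (K p m) (Y p m) → v ≡ Y p m)

    module _ (r : ℕ) (V : ℕ → ℕ → ℕ) where

      InRange : ℕ → ℕ → Set
      InRange p m = X p m < n × Y p m < n × V p m < n × K p m < k

      Located : ℕ → ℕ → Set
      Located p m = InRange p m × (Active r p m → OnPiece r p m (V p m))

      NoClash : ℕ → ℕ → Set
      NoClash p q = ∀ m → m < M → ∀ m′ → m′ < M → K p m ≡ K q m′ → Active r p m → Active r q m′ →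
        V p m ≡ V q m′ → Common p q (V p m)

      Valid : Set
      Valid = (∀ p → p < l → ∀ m → m < M → Located p m) ×
        (∀ p → p < l → ∀ q → q < l → ¬ p ≡ q → NoClash p q)

      Move : (ℕ → ℕ → ℕ) → Set
      Move V′ = ∀ p → p < l → ∀ m → m < M → Active r p m → Active (suc r) p m → E (V p m) (V′ p m)

  record Certificate : Set where
    field
      X Y K  : ℕ → ℕ → ℕ
      V      : ℕ → ℕ → ℕ → ℕ
      static : Static X Y K
      valid  : ∀ r → r < n → Valid X Y K r (V r)
      move   : ∀ r → suc r < n → Move X Y K r (V r) (V (suc r))

-- Reading the encoded instance.

array-< : ∀ {m} (f : Fin m → ℕ) {p} (p<m : p < m) → array f p ≡ f (fromℕ< p<m)
array-< {m} f {p} p<m with p <? m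
... | yes q = cong (λ q → f (fromℕ< q)) (<-irrelevant q p<m)
... | no ¬q = ⊥-elim (¬q p<m)

array-toℕ : ∀ {m} (f : Fin m → ℕ) i → array f (toℕ i) ≡ f i
array-toℕ f i = trans (array-< f (toℕ<n i)) (cong f (fromℕ<-toℕ i _))

matrix-toℕ : ∀ {m n} (f : Fin m → Fin n → ℕ) i x → matrix f (n * toℕ i + toℕ x) ≡ f i x
matrix-toℕ {n = n} f i x = trans (cong (matrix f) (sym (toℕ-combine i x)))
  (trans (array-toℕ _ (combine i x)) (cong (uncurry f) (remQuot-combine {k = n} i x)))

matrix-fromℕ< : ∀ {m n} (f : Fin m → Fin n → ℕ) {i x} (i<m : i < m) (x<n : x < n) →
                matrix f (n * i + x) ≡ f (fromℕ< i<m) (fromℕ< x<n)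
matrix-fromℕ< {n = n} f i<m x<n = trans
  (cong₂ (λ i x → matrix f (n * i + x)) (sym (toℕ-fromℕ< i<m)) (sym (toℕ-fromℕ< x<n))) (matrix-toℕ f _ _)

bit-1 : ∀ {b} → bit b ≡ 1 → T b
bit-1 {true} _ = _

T-bit : ∀ {b} → T b → bit b ≡ 1
T-bit {true} _ = refl

module CodedInstance {k n l : ℕ} (I : Instance k n l) where
  open Instance I public
  open Graph graph public
  open KShortest shortest public

  Eᶜ : ℕ → ℕ → Set
  Eᶜ u v = arrs (encode I) 0 (n * u + v) ≡ 1

  levᶜ : ℕ → ℕ → ℕ
  levᶜ i v = arrs (encode I) 1 (n * i + v)

  sᶜ tᶜ cᶜ : ℕ → ℕ
  sᶜ = arrs (encode I) 2
  tᶜ = arrs (encode I) 3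
  cᶜ = arrs (encode I) 4

  edge-from : ∀ {u v} (u<n : u < n) (v<n : v < n) → Eᶜ u v → Edge (fromℕ< u<n) (fromℕ< v<n)
  edge-from u<n v<n e = bit-1 (trans (sym (matrix-fromℕ< (λ x y → bit (adj x y)) u<n v<n)) e)

  level-from : ∀ {v} i (v<n : v < n) → levᶜ (toℕ i) v ≡ level i (fromℕ< v<n)
  level-from i v<n = trans (cong (λ v → levᶜ (toℕ i) v) (sym (toℕ-fromℕ< v<n))) (matrix-toℕ level i _)

  edge-sym : ∀ {u v} → u < n → v < n → Eᶜ u v → Eᶜ v u
  edge-sym u<n v<n e = trans (matrix-fromℕ< (λ x y → bit (adj x y)) v<n u<n)
    (trans (cong bit (symm _ _)) (trans (sym (matrix-fromℕ< (λ x y → bit (adj x y)) u<n v<n)) e))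

  -- Nonempty classes have distinct members, so there are at most n of them. Hence the times below n
  -- reach every level.
  level<n : ∀ i x → level i x < n
  level<n i x = ≤-trans (toℕ<n (class i x)) (injective⇒≤ {f = λ j → proj₁ (nonempty i j)} inj)
    where
    inj : ∀ {a b} → proj₁ (nonempty i a) ≡ proj₁ (nonempty i b) → a ≡ b
    inj {a} {b} eq = trans (sym (proj₂ (nonempty i a))) (trans (cong (class i) eq) (proj₂ (nonempty i b)))

  levᶜ<n : ∀ {i v} → i < k → v < n → levᶜ i v < n
  levᶜ<n i<k v<n = subst (_< n) (sym (matrix-fromℕ< level i<k v<n)) (level<n _ _)

  cᶜ≡ : ∀ p → cᶜ (toℕ p) ≡ toℕ (c p)
  cᶜ≡ p = array-toℕ (toℕ ∘ c) p

-- Certificates yield solutions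

module Soundness {k n l : ℕ} (I : Instance k n l) (M : ℕ) (0<M : 0 < M) where
  open CodedInstance I
  open Certificates n k l M Eᶜ levᶜ sᶜ tᶜ cᶜ

  data Walk (o : ℕ) (Q : ℕ → Set) : ℕ → ℕ → Set where
    stop : ∀ {u} → Q u → Walk o Q u u
    go   : ∀ {u v w} → Q u → ForwardEdge o u v → Walk o Q v w → Walk o Q u w

  module _ {o : ℕ} {Q : ℕ → Set} where

    join : ∀ {u v w} → Walk o Q u v → Walk o Q v w → Walk o Q u w
    join (stop _)    y = y
    join (go q e x)  y = go q e (join x y)

    start : ∀ {u v} → Walk o Q u v → Q u
    start (stop q)   = q
    start (go q _ _) = q

    trace : ∀ d (f : ℕ → ℕ) → (∀ i → i < d → ForwardEdge o (f i) (f (suc i))) → (∀ i → i ≤ d → Q (f i)) →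
            Walk o Q (f 0) (f d)
    trace zero    f e q = stop (q 0 z≤n)
    trace (suc d) f e q = go (q 0 z≤n) (e 0 (s≤s z≤n)) (trace d (f ∘ suc) (λ i → e (suc i) ∘ s≤s) (λ i → q (suc i) ∘ s≤s))

    walkLength : ∀ {u v} → Walk o Q u v → ℕ
    walkLength (stop _)   = 0
    walkLength (go _ _ w) = suc (walkLength w)

    at : ∀ {u v} (w : Walk o Q u v) → Fin (suc (walkLength w)) → ∃ Q
    at (stop q)   _       = _ , q
    at (go q _ _) zero    = _ , q
    at (go _ _ w) (suc j) = at w j

    at-zero : ∀ {u v} (w : Walk o Q u v) → proj₁ (at w zero) ≡ u
    at-zero (stop _)   = refl
    at-zero (go _ _ _) = refl

    at-last : ∀ {u v} (w : Walk o Q u v) → proj₁ (at w (fromℕ (walkLength w))) ≡ v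
    at-last (stop _)   = refl
    at-last (go _ _ w) = at-last w

    at-edge : ∀ {u v} (w : Walk o Q u v) j → ForwardEdge o (proj₁ (at w (inject₁ j))) (proj₁ (at w (suc j)))
    at-edge (go _ e w) zero    = subst (ForwardEdge o _) (sym (at-zero w)) e
    at-edge (go _ _ w) (suc j) = at-edge w j

    at-level : ∀ {u v} (w : Walk o Q u v) j → levᶜ o (proj₁ (at w j)) ≡ levᶜ o u + toℕ j
    at-level (stop _)   zero    = sym (+-identityʳ _)
    at-level (go _ _ _) zero    = sym (+-identityʳ _)
    at-level (go _ (_ , e) w) (suc j) = trans (at-level w j) (trans (cong (_+ toℕ j) e) (sym (+-suc _ _)))

  -- Along a walk the level for o rises by one in each step, so no vertex repeats.
  walk-path : ∀ (o : Fin k) {Q u v} → (∀ {x} → Q x → x < n) → Walk (toℕ o) Q u v →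
    Σ (Path graph) λ P → PathOfColour o P × toℕ (Path.source P) ≡ u × toℕ (Path.target P) ≡ v ×
      (∀ {x} → Path.VertexOf P x → Q (toℕ x))
  walk-path o {Q} Q<n w = P , colour , trans (toℕ-fromℕ< _) (at-zero w) , trans (toℕ-fromℕ< _) (at-last w) ,
    λ { (j , refl) → subst Q (sym (toℕ-fromℕ< _)) (proj₂ (at w j)) }
    where
    vert : Fin (suc (walkLength w)) → Fin n
    vert j = fromℕ< {proj₁ (at w j)} (Q<n (proj₂ (at w j)))
    vert-level : ∀ j → level o (vert j) ≡ levᶜ (toℕ o) (proj₁ (at w j))
    vert-level j = sym (level-from o (Q<n (proj₂ (at w j))))
    P : Path graph
    P = record
      { length = walkLength w ; vertex = vert
      ; distinct = λ {i} {j} eq → toℕ-injective (+-cancelˡ-≡ _ _ _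
          (trans (sym (at-level w i)) (trans (sym (vert-level i)) (trans (cong (level o) eq) (trans (vert-level j) (at-level w j))))))
      ; edges = λ j → edge-from (Q<n (proj₂ (at w (inject₁ j)))) (Q<n (proj₂ (at w (suc j)))) (proj₁ (at-edge w j)) }
    rise : ∀ j → suc (level o (vert (inject₁ j))) ≡ level o (vert (suc j))
    rise j = trans (cong suc (vert-level (inject₁ j))) (trans (sym (proj₂ (at-edge w j))) (sym (vert-level (suc j))))
    colour : PathOfColour o P
    colour j = (Path.edges P j , inj₁ (rise j)) , ≤-trans (n≤1+n _) (≤-reflexive (rise j))

  module _ (cert : Certificate) where
    open Certificate cert

    On : ℕ → ℕ → Set
    On p v = ∃ λ m → ∃ λ r → m < M × r < n × Active X Y K r p m × V r p m ≡ v

    On⇒< : ∀ {p v} → p < l → On p v → v < n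
    On⇒< p<l (m , r , m<M , r<n , _ , refl) =
      let ((_ , _ , v<n , _) , _) = proj₁ (valid r r<n) _ p<l m m<M in v<n

    module _ {p m} (p<l : p < l) (m<M : m < M) where
      private
        κ = K p m
        a = levᶜ κ (X p m)
        b = levᶜ κ (Y p m)

        0<n : 0 < n
        0<n = ≤-trans (s≤s z≤n) (toℕ<n (s (fromℕ< p<l)))
        range = proj₁ (proj₁ (valid 0 0<n) p p<l m m<M)
        κ<k = proj₂ (proj₂ (proj₂ range))
        a<n : a < n
        a<n = levᶜ<n κ<k (proj₁ range)
        b<n : b < n
        b<n = levᶜ<n κ<k (proj₁ (proj₂ range))
        located : ∀ r → r < n → Active X Y K r p m → OnPiece X Y K r p m (V r p m)
        located r r<n = proj₂ (proj₁ (valid r r<n) p p<l m m<M)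
        V<n : ∀ r → r < n → V r p m < n
        V<n r r<n = let ((_ , _ , v<n , _) , _) = proj₁ (valid r r<n) _ p<l m m<M in v<n

      up : a ≤ b → Walk (cᶜ p) (On p) (X p m) (Y p m)
      up a≤b with m≤n⇒∃[o]m+o≡n a≤b
      ... | d , a+d≡b = subst₂ (Walk (cᶜ p) (On p)) first last
        (trace d (λ i → V (a + i) p m) step (λ i i≤d → m , a + i , m<M , r<n i≤d , act i≤d , refl))
        where
        le : ∀ {i} → i ≤ d → a + i ≤ b
        le i≤d = ≤-trans (+-monoʳ-≤ a i≤d) (≤-reflexive a+d≡b)
        r<n : ∀ {i} → i ≤ d → a + i < n
        r<n i≤d = ≤-trans (s≤s (le i≤d)) b<n
        act : ∀ {i} → i ≤ d → Active X Y K (a + i) p m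
        act {i} i≤d = inj₁ (m≤m+n a i , le i≤d)
        on : ∀ {i} → i ≤ d → OnPiece X Y K (a + i) p m (V (a + i) p m)
        on i≤d = located _ (r<n i≤d) (act i≤d)
        dist-up : ∀ i → dist a (a + i) ≡ i
        dist-up i = trans (cong₂ _+_ (m+n∸m≡n a i) (m≤n⇒m∸n≡0 (m≤m+n a i))) (+-identityʳ i)
        lv : ∀ {i} → i ≤ d → levᶜ (cᶜ p) (V (a + i) p m) ≡ levᶜ (cᶜ p) (X p m) + i
        lv {i} i≤d = trans (proj₁ (proj₂ (on i≤d))) (cong (_ +_) (dist-up i))
        step : ∀ i → i < d → ForwardEdge (cᶜ p) (V (a + i) p m) (V (a + suc i) p m)
        step i i<d =
          subst (λ r → Eᶜ (V (a + i) p m) (V r p m)) (sym (+-suc a i))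
            (move (a + i) (subst (_< n) (+-suc a i) (r<n i<d)) p p<l m m<M (act (<⇒≤ i<d))
              (subst (λ r → Active X Y K r p m) (+-suc a i) (act i<d))) ,
          trans (lv i<d) (trans (+-suc _ i) (cong suc (sym (lv (<⇒≤ i<d)))))
        first : V (a + 0) p m ≡ X p m
        first = proj₁ (proj₂ (proj₂ (proj₂ (on z≤n)))) (+-identityʳ a)
        last : V (a + d) p m ≡ Y p m
        last = proj₂ (proj₂ (proj₂ (proj₂ (on ≤-refl)))) a+d≡b

      -- Here time runs from Y to X. The walk still leads from X to Y, so it uses each move
      -- backwards.
      down : b ≤ a → Walk (cᶜ p) (On p) (X p m) (Y p m)
      down b≤a with m≤n⇒∃[o]m+o≡n b≤a
      ... | d , b+d≡a = subst₂ (Walk (cᶜ p) (On p)) first last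
        (trace d (λ i → V (a ∸ i) p m) step (λ i i≤d → m , a ∸ i , m<M , r<n i , act i≤d , refl))
        where
        d≤a : d ≤ a
        d≤a = subst (d ≤_) b+d≡a (m≤n+m d b)
        a∸d≡b : a ∸ d ≡ b
        a∸d≡b = trans (cong (_∸ d) (sym b+d≡a)) (m+n∸n≡m b d)
        r<n : ∀ i → a ∸ i < n
        r<n i = ≤-trans (s≤s (m∸n≤m a i)) a<n
        act : ∀ {i} → i ≤ d → Active X Y K (a ∸ i) p m
        act {i} i≤d = inj₂ (≤-trans (≤-reflexive (sym a∸d≡b)) (∸-monoʳ-≤ a i≤d) , m∸n≤m a i)
        on : ∀ {i} → i ≤ d → OnPiece X Y K (a ∸ i) p m (V (a ∸ i) p m)
        on {i} i≤d = located _ (r<n i) (act i≤d)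
        dist-down : ∀ {i} → i ≤ d → dist a (a ∸ i) ≡ i
        dist-down {i} i≤d = trans (cong (_+ (a ∸ (a ∸ i))) (m≤n⇒m∸n≡0 (m∸n≤m a i))) (m∸[m∸n]≡n (≤-trans i≤d d≤a))
        lv : ∀ {i} → i ≤ d → levᶜ (cᶜ p) (V (a ∸ i) p m) ≡ levᶜ (cᶜ p) (X p m) + i
        lv {i} i≤d = trans (proj₁ (proj₂ (on i≤d))) (cong (_ +_) (dist-down i≤d))
        step : ∀ i → i < d → ForwardEdge (cᶜ p) (V (a ∸ i) p m) (V (a ∸ suc i) p m)
        step i i<d = edge-sym (V<n _ (r<n (suc i))) (V<n _ (r<n i))
          (subst (λ r → Eᶜ (V (a ∸ suc i) p m) (V r p m)) pred
            (move (a ∸ suc i) (subst (_< n) (sym pred) (r<n i)) p p<l m m<M (act i<d)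
              (subst (λ r → Active X Y K r p m) (sym pred) (act (<⇒≤ i<d))))) ,
          trans (lv i<d) (trans (+-suc _ i) (cong suc (sym (lv (<⇒≤ i<d)))))
          where
          pred : suc (a ∸ suc i) ≡ a ∸ i
          pred = sym (+-∸-assoc 1 (≤-trans i<d d≤a))
        first : V a p m ≡ X p m
        first = proj₁ (proj₂ (proj₂ (proj₂ (on z≤n)))) refl
        last : V (a ∸ d) p m ≡ Y p m
        last = proj₂ (proj₂ (proj₂ (proj₂ (on ≤-refl)))) a∸d≡b

      piece : Walk (cᶜ p) (On p) (X p m) (Y p m)
      piece with ≤-total a b
      ... | inj₁ a≤b = up a≤b
      ... | inj₂ b≤a = down b≤a

    pieces : ∀ {p} → p < l → ∀ m → m < M → Walk (cᶜ p) (On p) (X p 0) (Y p m)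
    pieces p<l zero    m<M = piece p<l m<M
    pieces {p} p<l (suc m) m<M with proj₁ (proj₂ static) p p<l m (∸-monoˡ-≤ 1 m<M)
    ... | inj₁ eq = join (subst (Walk _ _ _) eq (pieces p<l m (<⇒≤ m<M))) (piece p<l m<M)
    ... | inj₂ e  = join (pieces p<l m (<⇒≤ m<M)) (go (end (pieces p<l m (<⇒≤ m<M))) e (piece p<l m<M))
      where
      end : ∀ {o Q u v} → Walk o Q u v → Q v
      end (stop q)   = q
      end (go _ _ w) = end w

    whole : ∀ p → Walk (toℕ (c p)) (On (toℕ p)) (X (toℕ p) 0) (Y (toℕ p) (M ∸ 1))
    whole p = subst (λ o → Walk o (On (toℕ p)) (X (toℕ p) 0) (Y (toℕ p) (M ∸ 1))) (cᶜ≡ p) (pieces (toℕ<n p) (M ∸ 1) (≤-reflexive (suc-pred M {{>-nonZero 0<M}})))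

    path : ∀ p → Σ (Path graph) λ P → PathOfColour (c p) P × toℕ (Path.source P) ≡ X (toℕ p) 0 ×
             toℕ (Path.target P) ≡ Y (toℕ p) (M ∸ 1) × (∀ {x} → Path.VertexOf P x → On (toℕ p) (toℕ x))
    path p = walk-path (c p) (On⇒< (toℕ<n p)) (whole p)

    -- At equal colours K the time of a vertex is its level, so a shared vertex is a clash at that time.
    shared : ∀ {p q} → p < l → q < l → ¬ p ≡ q → ∀ {v} → On p v → On q v → Common p q v
    shared {p} {q} p<l q<l p≢q (m , r , m<M , r<n , act , refl) (m′ , r′ , m′<M , r′<n , act′ , eq)
      with K p m ≟ K q m′
    ... | no κ≢ = proj₂ (proj₂ static) p p<l q q<l p≢q m m<M m′ m′<M κ≢ (V r p m)
        (On⇒< p<l (m , r , m<M , r<n , act , refl))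
        (proj₁ (proj₂ (proj₂ (proj₂ (proj₁ (valid r r<n) p p<l m m<M) act))))
        (subst (Hull _ _ _) eq (proj₁ (proj₂ (proj₂ (proj₂ (proj₁ (valid r′ r′<n) q q<l m′ m′<M) act′)))))
    ... | yes κ≡ = proj₂ (valid r r<n) p p<l q q<l p≢q m m<M m′ m′<M κ≡ act
        (subst (λ r → Active X Y K r q m′) r′≡r act′) (sym (subst (λ r → V r q m′ ≡ V _ p m) r′≡r eq))
      where
      r′≡r : r′ ≡ r
      r′≡r = trans (sym (proj₁ (proj₂ (proj₁ (valid r′ r′<n) q q<l m′ m′<M) act′)))
               (trans (cong₂ levᶜ (sym κ≡) eq) (proj₁ (proj₂ (proj₁ (valid r r<n) p p<l m m<M) act)))

    private
      P : Fin l → Path graph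
      P p = proj₁ (path p)

      source : ∀ p → toℕ (Path.source (P p)) ≡ X (toℕ p) 0
      source p = proj₁ (proj₂ (proj₂ (path p)))

      target : ∀ p → toℕ (Path.target (P p)) ≡ Y (toℕ p) (M ∸ 1)
      target p = proj₁ (proj₂ (proj₂ (proj₂ (path p))))

    joins : ∀ p → Path.Joins (P p) (s p) (t p)
    joins p with proj₁ static (toℕ p) (toℕ<n p)
    ... | inj₁ (x , y) =
      inj₁ (toℕ-injective (trans (source p) (trans x (array-toℕ (toℕ ∘ s) p))) ,
            toℕ-injective (trans (target p) (trans y (array-toℕ (toℕ ∘ t) p))))
    ... | inj₂ (x , y) =
      inj₂ (toℕ-injective (trans (source p) (trans x (array-toℕ (toℕ ∘ t) p))) ,
            toℕ-injective (trans (target p) (trans y (array-toℕ (toℕ ∘ s) p))))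

    not-internal : ∀ p {v} → toℕ v ≡ sᶜ (toℕ p) ⊎ toℕ v ≡ tᶜ (toℕ p) → ¬ Path.InternalVertexOf (P p) v
    not-internal p {v} eq (_ , ≢src , ≢tgt) with joins p
    ... | inj₁ (src , tgt) = [ (λ e → ≢src (trans (is-s e) (sym src))) , (λ e → ≢tgt (trans (is-t e) (sym tgt))) ]′ eq
      where
      is-s : toℕ v ≡ sᶜ (toℕ p) → v ≡ s p
      is-s e = toℕ-injective (trans e (array-toℕ (toℕ ∘ s) p))
      is-t : toℕ v ≡ tᶜ (toℕ p) → v ≡ t p
      is-t e = toℕ-injective (trans e (array-toℕ (toℕ ∘ t) p))
    ... | inj₂ (src , tgt) = [ (λ e → ≢tgt (trans (toℕ-injective (trans e (array-toℕ (toℕ ∘ s) p))) (sym tgt))) ,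
                               (λ e → ≢src (trans (toℕ-injective (trans e (array-toℕ (toℕ ∘ t) p))) (sym src))) ]′ eq

    solution : HasSolution I
    solution = P , (λ p → proj₁ (proj₂ (path p)) , joins p) , λ p q p≢q v →
      let common = λ a b → shared (toℕ<n p) (toℕ<n q) (p≢q ∘ toℕ-injective)
                     (proj₂ (proj₂ (proj₂ (proj₂ (path p)))) a) (proj₂ (proj₂ (proj₂ (proj₂ (path q)))) b)
      in (λ i a → not-internal p (proj₁ (common (proj₁ i) a)) i) ,
         (λ i a → not-internal q (proj₂ (common a (proj₁ i))) i)

-- Separating an increasing from a decreasing chain of points

sup : ℕ → (ℕ → ℕ) → ℕ
sup zero    f = f 0
sup (suc L) f = sup L f ⊔ f (suc L)

≤-sup : ∀ L f t → t ≤ L → f t ≤ sup L f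
≤-sup zero    f zero z≤n = ≤-refl
≤-sup (suc L) f t t≤ with m≤n⇒m<n∨m≡n t≤
... | inj₁ (s≤s t≤L) = ≤-trans (≤-sup L f t t≤L) (m≤m⊔n _ _)
... | inj₂ refl      = m≤n⊔m (sup L f) _

sup-≤ : ∀ L f x → (∀ t → t ≤ L → f t ≤ x) → sup L f ≤ x
sup-≤ zero    f x b = b 0 z≤n
sup-≤ (suc L) f x b = ⊔-lub (sup-≤ L f x (λ t t≤ → b t (m≤n⇒m≤1+n t≤))) (b (suc L) ≤-refl)

all-or-some : ∀ L {A B : ℕ → Set} → (∀ t → t ≤ L → A t ⊎ B t) → (∀ t → t ≤ L → A t) ⊎ (∃ λ t → t ≤ L × B t)
all-or-some zero d with d 0 z≤n
... | inj₁ a = inj₁ λ { zero z≤n → a }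
... | inj₂ b = inj₂ (0 , z≤n , b)
all-or-some (suc L) d with all-or-some L (λ t t≤ → d t (m≤n⇒m≤1+n t≤)) | d (suc L) ≤-refl
... | inj₂ (t , t≤ , b) | _ = inj₂ (t , m≤n⇒m≤1+n t≤ , b)
... | inj₁ f | inj₂ b = inj₂ (suc L , ≤-refl , b)
... | inj₁ f | inj₁ a = inj₁ λ t t≤ → [ (λ { (s≤s t≤L) → f t t≤L }) , (λ { refl → a }) ]′ (m≤n⇒m<n∨m≡n t≤)

-- A discrete intermediate value theorem; it stands in for the choice of a maximal m with A m.
holds-or-drops : {A B : ℕ → Set} → (∀ m → A m ⊎ B m) → A 0 → ∀ N → A N ⊎ (∃ λ m → A m × B (suc m))
holds-or-drops d a₀ zero = inj₁ a₀
holds-or-drops d a₀ (suc N) with holds-or-drops d a₀ N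
... | inj₂ r = inj₂ r
... | inj₁ a with d (suc N)
... | inj₁ a′ = inj₁ a′
... | inj₂ b  = inj₂ (N , a , b)

module Thresholds (Lp Lq : ℕ) (ap bp aq bq : ℕ → ℕ)
  (ap↑ : ∀ {i j} → i ≤ j → j ≤ Lp → ap i ≤ ap j) (bp↑ : ∀ {i j} → i ≤ j → j ≤ Lp → bp i ≤ bp j)
  (aq↓ : ∀ {i j} → i ≤ j → j ≤ Lq → aq j ≤ aq i) (bq↑ : ∀ {i j} → i ≤ j → j ≤ Lq → bq i ≤ bq j) where

  -- In a separation at abscissa c the points strictly to the left lie low for p and high for q, and
  -- strictly to the right it is the other way round. The first two conditions are what this demands
  -- of pairs of points.
  Left Right Bad : ℕ → Set
  Left c  = ∀ t → t ≤ Lp → ∀ u → u ≤ Lq → ap t < c → aq u < c → bp t ≤ bq u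
  Right c = ∀ t → t ≤ Lp → ∀ u → u ≤ Lq → c < ap t → c < aq u → bq u ≤ bp t
  Bad c   = ∃ λ t → t ≤ Lp × (∃ λ u → u ≤ Lq × ap t < c × aq u < c × bq u < bp t)

  left? : ∀ c → Left c ⊎ Bad c
  left? c = all-or-some Lp λ t _ → all-or-some Lq λ u _ → decide t u
    where
    decide : ∀ t u → (ap t < c → aq u < c → bp t ≤ bq u) ⊎ (ap t < c × aq u < c × bq u < bp t)
    decide t u with ap t <? c | aq u <? c | bp t ≤? bq u
    ... | no a  | _     | _     = inj₁ λ a′ → ⊥-elim (a a′)
    ... | yes _ | no a  | _     = inj₁ λ _ a′ → ⊥-elim (a a′)
    ... | yes _ | yes _ | yes b = inj₁ λ _ _ → b
    ... | yes a | yes b | no d  = inj₂ (a , b , ≰⇒> d)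

  p-order : ∀ {t t′ c} → t ≤ Lp → ap t < c → c ≤ ap t′ → t ≤ t′
  p-order {t} {t′} t≤ a b with ≤-total t t′
  ... | inj₁ t≤t′ = t≤t′
  ... | inj₂ t′≤t = ⊥-elim (<⇒≱ a (≤-trans b (ap↑ t′≤t t≤)))

  q-order : ∀ {u u′ c} → u ≤ Lq → c < aq u → aq u′ ≤ c → u ≤ u′
  q-order {u} {u′} u≤ a b with ≤-total u u′
  ... | inj₁ u≤u′ = u≤u′
  ... | inj₂ u′≤u = ⊥-elim (<⇒≱ a (≤-trans (aq↓ u′≤u u≤) b))

  abstract
    -- The largest c with Left c also satisfies Right c.
    abscissa : ∃ λ c → Left c × Right c
    abscissa with holds-or-drops left? (λ _ _ _ _ ()) (sup Lp ap)
    -- No point of p lies to the right of this abscissa.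
    ... | inj₁ left = sup Lp ap , left , λ t t≤ _ _ c<a _ → ⊥-elim (<⇒≱ c<a (≤-sup Lp ap t t≤))
    -- The failure at c + 1 is a pair of points with abscissa at most c where q is below p. Points
    -- to the right of c come no later on q and no earlier on p, so q is below p there too.
    ... | inj₂ (c , left , t₀ , t₀≤ , u₀ , u₀≤ , a , a′ , b) = c , left , λ t t≤ u u≤ c<a c<a′ →
      ≤-trans (bq↑ (q-order u≤ c<a′ (≤-pred a′)) u₀≤) (≤-trans (<⇒≤ b) (bp↑ (p-order t₀≤ a c<a) t≤))

    -- The height c′ is the greatest among the points that must lie low, p left and q right of c;
    -- the default 0 is neutral for this maximum. The points that must lie high are above them by
    -- `left`, `right` or monotonicity, and a point with abscissa c fits whatever its height.
    ordinate : ∀ {c} → Left c → Right c → ∃ λ c′ →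
      (∀ t → t ≤ Lp → (ap t ≤ c × bp t ≤ c′) ⊎ (c ≤ ap t × c′ ≤ bp t)) ×
      (∀ u → u ≤ Lq → (c ≤ aq u × bq u ≤ c′) ⊎ (aq u ≤ c × c′ ≤ bq u))
    ordinate {c} left right = c′ , onp , onq
      where
      lowp lowq : ℕ → ℕ
      lowp t with ap t <? c
      ... | yes _ = bp t
      ... | no _  = 0
      lowq u with c <? aq u
      ... | yes _ = bq u
      ... | no _  = 0

      lowp≡ : ∀ {t} → ap t < c → lowp t ≡ bp t
      lowp≡ {t} a with ap t <? c
      ... | yes _ = refl
      ... | no ¬a = ⊥-elim (¬a a)
      lowq≡ : ∀ {u} → c < aq u → lowq u ≡ bq u
      lowq≡ {u} a with c <? aq u
      ... | yes _ = refl
      ... | no ¬a = ⊥-elim (¬a a)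

      lowp≤ : ∀ {t x} → (ap t < c → bp t ≤ x) → lowp t ≤ x
      lowp≤ {t} f with ap t <? c
      ... | yes a = f a
      ... | no _  = z≤n
      lowq≤ : ∀ {u x} → (c < aq u → bq u ≤ x) → lowq u ≤ x
      lowq≤ {u} f with c <? aq u
      ... | yes a = f a
      ... | no _  = z≤n

      c′ : ℕ
      c′ = sup Lp lowp ⊔ sup Lq lowq

      onp : ∀ t → t ≤ Lp → (ap t ≤ c × bp t ≤ c′) ⊎ (c ≤ ap t × c′ ≤ bp t)
      onp t t≤ with ap t <? c | c <? ap t | ≤-total (bp t) c′
      ... | yes a | _ | _ = inj₁ (<⇒≤ a , ≤-trans (≤-reflexive (sym (lowp≡ a))) (≤-trans (≤-sup Lp lowp t t≤) (m≤m⊔n _ _)))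
      ... | no _  | yes a | _ = inj₂ (<⇒≤ a , ⊔-lub
              (sup-≤ Lp lowp _ λ t′ t′≤ → lowp≤ λ a′ → bp↑ (p-order t′≤ a′ (<⇒≤ a)) t≤)
              (sup-≤ Lq lowq _ λ u u≤ → lowq≤ λ a′ → right t t≤ u u≤ a a′))
      ... | no _ | no a | inj₁ b = inj₁ (≮⇒≥ a , b)
      ... | no a | no _ | inj₂ b = inj₂ (≮⇒≥ a , b)

      onq : ∀ u → u ≤ Lq → (c ≤ aq u × bq u ≤ c′) ⊎ (aq u ≤ c × c′ ≤ bq u)
      onq u u≤ with c <? aq u | aq u <? c | ≤-total (bq u) c′
      ... | yes a | _ | _ = inj₁ (<⇒≤ a , ≤-trans (≤-reflexive (sym (lowq≡ a))) (≤-trans (≤-sup Lq lowq u u≤) (m≤n⊔m (sup Lp lowp) _)))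
      ... | no _  | yes a | _ = inj₂ (<⇒≤ a , ⊔-lub
              (sup-≤ Lp lowp _ λ t t≤ → lowp≤ λ a′ → left t t≤ u u≤ a′ a)
              (sup-≤ Lq lowq _ λ u′ u′≤ → lowq≤ λ a′ → bq↑ (q-order u′≤ a′ (<⇒≤ a)) u≤))
      ... | no _ | no a | inj₁ b = inj₁ (≮⇒≥ a , b)
      ... | no a | no _ | inj₂ b = inj₂ (≮⇒≥ a , b)

-- Cutting a monotone sequence into constant pieces

module Pieces (f : ℕ → ℕ) (L : ℕ) where

  -- The last index with value at most a (0 if there is none).
  lastIndex : ℕ → ℕ → ℕ
  lastIndex a zero = zero
  lastIndex a (suc j) with f (suc j) ≤? a
  ... | yes _ = suc j
  ... | no _  = lastIndex a j

  -- Piece a ends at the last index of value at most a and starts right after piece a - 1. If no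
  -- index is left for it, the minimum in `lo` makes it the single index where piece a - 1 ends.
  hi lo : ℕ → ℕ
  hi a = lastIndex a L
  lo zero    = 0
  lo (suc a) = suc (hi a) ⊓ hi (suc a)

  lastIndex-≤ : ∀ a j → lastIndex a j ≤ j
  lastIndex-≤ a zero = z≤n
  lastIndex-≤ a (suc j) with f (suc j) ≤? a
  ... | yes _ = ≤-refl
  ... | no _  = m≤n⇒m≤1+n (lastIndex-≤ a j)

  lastIndex-mono : ∀ a j → lastIndex a j ≤ lastIndex (suc a) j
  lastIndex-mono a zero = z≤n
  lastIndex-mono a (suc j) with f (suc j) ≤? a | f (suc j) ≤? suc a
  ... | yes _ | yes _ = ≤-refl
  ... | yes p | no ¬p = ⊥-elim (¬p (m≤n⇒m≤1+n p))
  ... | no _  | yes _ = m≤n⇒m≤1+n (lastIndex-≤ a j)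
  ... | no _  | no _  = lastIndex-mono a j

  lastIndex-value : ∀ a j → 0 < lastIndex a j → f (lastIndex a j) ≤ a
  lastIndex-value a (suc j) 0< with f (suc j) ≤? a
  ... | yes p = p
  ... | no _  = lastIndex-value a j 0<

  lastIndex-beyond : ∀ a j {t} → lastIndex a j < t → t ≤ j → a < f t
  lastIndex-beyond a zero    l<t z≤n = ⊥-elim (n≮0 l<t)
  lastIndex-beyond a (suc j) l<t t≤ with f (suc j) ≤? a
  ... | yes _ = ⊥-elim (<⇒≱ l<t t≤)
  ... | no ¬p with m≤n⇒m<n∨m≡n t≤
  ... | inj₁ (s≤s t≤j) = lastIndex-beyond a j l<t t≤j
  ... | inj₂ refl      = ≰⇒> ¬p

  hi≤L : ∀ a → hi a ≤ L
  hi≤L a = lastIndex-≤ a L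

  lo≤hi : ∀ a → lo a ≤ hi a
  lo≤hi zero    = z≤n
  lo≤hi (suc a) = m⊓n≤n (suc (hi a)) _

  hi-final : ∀ {a} → f L ≤ a → hi a ≡ L
  hi-final {a} fL≤ with m≤n⇒m<n∨m≡n (hi≤L a)
  ... | inj₁ hi< = ⊥-elim (<⇒≱ (lastIndex-beyond a L hi< ≤-refl) fL≤)
  ... | inj₂ eq  = eq

  lo-suc : ∀ a → hi a ≡ lo (suc a) ⊎ lo (suc a) ≡ suc (hi a)
  lo-suc a with ≤-total (suc (hi a)) (hi (suc a))
  ... | inj₁ le = inj₂ (m≤n⇒m⊓n≡m le)
  ... | inj₂ ge with m≤n⇒m<n∨m≡n (lastIndex-mono a L)
  ... | inj₁ le = inj₂ (m≤n⇒m⊓n≡m le)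
  ... | inj₂ eq = inj₁ (trans eq (sym (m≥n⇒m⊓n≡n ge)))

  -- Past the end of piece a every value exceeds a, and up to the end of the next piece a monotone f
  -- does not exceed `suc a`.
  constant : (∀ {i j} → i ≤ j → j ≤ L → f i ≤ f j) → ∀ a → f (lo a) ≡ f (hi a)
  constant f↑ zero with hi 0 | lastIndex-value 0 L | hi≤L 0
  ... | zero  | _ | _ = refl
  ... | suc h | v | h≤L = ≤-antisym (f↑ z≤n h≤L) (≤-trans (v (s≤s z≤n)) z≤n)
  constant f↑ (suc a) with ≤-total (suc (hi a)) (hi (suc a))
  ... | inj₂ ge with m≤n⇒m<n∨m≡n (lastIndex-mono a L)
  ... | inj₂ eq = cong f (m≥n⇒m⊓n≡n ge)
  ... | inj₁ le = cong f (trans (m≤n⇒m⊓n≡m le) (≤-antisym le ge))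
  constant f↑ (suc a) | inj₁ le = trans (cong f (m≤n⇒m⊓n≡m le)) (≤-antisym (f↑ le (hi≤L (suc a)))
    (≤-trans (lastIndex-value (suc a) L (≤-trans (s≤s z≤n) le)) (lastIndex-beyond a L ≤-refl (≤-trans le (hi≤L (suc a))))))

-- Affine relations between levels

-- The isometries of the integers, a group under composition. Under a `shift` two levels run in
-- parallel, under a `flip` against each other.
data Affine : Set where
  shift flip : ℤ → Affine

infixr 7 _·_ _⊙_

_·_ : Affine → ℤ → ℤ
shift c · x = x ℤ.+ c
flip c  · x = c ℤ.- x

_⊙_ : Affine → Affine → Affine
shift c ⊙ shift d = shift (d ℤ.+ c)
shift c ⊙ flip d  = flip (d ℤ.+ c)
flip c  ⊙ shift d = flip (c ℤ.- d)
flip c  ⊙ flip d  = shift (c ℤ.- d)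

⊙-· : ∀ g h x → (g ⊙ h) · x ≡ g · h · x
⊙-· (shift c) (shift d) x = eq x c d
  where
  eq : ∀ x c d → x ℤ.+ (d ℤ.+ c) ≡ x ℤ.+ d ℤ.+ c
  eq = solve-∀
⊙-· (shift c) (flip d)  x = eq x c d
  where
  eq : ∀ x c d → d ℤ.+ c ℤ.- x ≡ d ℤ.- x ℤ.+ c
  eq = solve-∀
⊙-· (flip c)  (shift d) x = eq x c d
  where
  eq : ∀ x c d → c ℤ.- d ℤ.- x ≡ c ℤ.- (x ℤ.+ d)
  eq = solve-∀
⊙-· (flip c)  (flip d)  x = eq x c d
  where
  eq : ∀ x c d → x ℤ.+ (c ℤ.- d) ≡ c ℤ.- (d ℤ.- x)
  eq = solve-∀

inverse : Affine → Affine
inverse (shift c) = shift (ℤ.- c)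
inverse (flip c)  = flip c

inverse-· : ∀ g x → inverse g · g · x ≡ x
inverse-· (shift c) x = eq x c
  where
  eq : ∀ x c → x ℤ.+ c ℤ.+ ℤ.- c ≡ x
  eq = solve-∀
inverse-· (flip c) x = eq x c
  where
  eq : ∀ x c → c ℤ.- (c ℤ.- x) ≡ x
  eq = solve-∀

·-injective : ∀ g {x y} → g · x ≡ g · y → x ≡ y
·-injective g {x} {y} eq = trans (sym (inverse-· g x)) (trans (cong (inverse g ·_) eq) (inverse-· g y))

identity : Affine
identity = shift 0ℤ

identity-· : ∀ x → identity · x ≡ x
identity-· = ℤ.+-identityʳ

identity-⊙ : ∀ g → identity ⊙ g ≡ g
identity-⊙ (shift c) = cong shift (ℤ.+-identityʳ c)
identity-⊙ (flip c)  = cong flip (ℤ.+-identityʳ c)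

-- Signs of forms and their totals.

Same : ℤ → ℤ → Set
Same x y = (x ℤ.≤ 0ℤ → y ℤ.≤ 0ℤ) × (y ℤ.≤ 0ℤ → x ℤ.≤ 0ℤ) × (0ℤ ℤ.≤ x → 0ℤ ℤ.≤ y) × (0ℤ ℤ.≤ y → 0ℤ ℤ.≤ x)

same-sym : ∀ {x y} → Same x y → Same y x
same-sym (a , b , c , d) = b , a , d , c

same-zero : ∀ {x y} → Same x y → x ≡ 0ℤ → y ≡ 0ℤ
same-zero (a , _ , c , _) refl = ℤ.≤-antisym (a ℤ.≤-refl) (c ℤ.≤-refl)

indicator : ∀ {P : Set} → Dec P → ℕ
indicator (yes _) = 1
indicator (no _)  = 0

-- Equals 0, 1 or 2 for a negative, zero or positive number. Zero has a value of its own so that a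
-- relation valid at one vertex of a piece is valid at all of them.
sign : ℤ → ℕ
sign x = indicator (0ℤ ℤ.≤? x) + indicator (0ℤ ℤ.<? x)

indicator-mono : ∀ {P Q : Set} (p : Dec P) (q : Dec Q) → (P → Q) → indicator p ≤ indicator q
indicator-mono (no _)  q       f = z≤n
indicator-mono (yes p) (yes _) f = ≤-refl
indicator-mono (yes p) (no ¬q) f = ⊥-elim (¬q (f p))

indicator-reflect : ∀ {P Q : Set} (p : Dec P) (q : Dec Q) → indicator q ≤ indicator p → Q → P
indicator-reflect (yes p) q       _  _ = p
indicator-reflect (no _)  (yes _) () _
indicator-reflect (no _)  (no ¬q) _  q = ⊥-elim (¬q q)

indicator≤1 : ∀ {P : Set} (p : Dec P) → indicator p ≤ 1
indicator≤1 (yes _) = ≤-refl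
indicator≤1 (no _)  = z≤n

sign-mono : ∀ {x y} → x ℤ.≤ y → sign x ≤ sign y
sign-mono {x} {y} x≤y = +-mono-≤ (indicator-mono (0ℤ ℤ.≤? x) (0ℤ ℤ.≤? y) (λ p → ℤ.≤-trans p x≤y))
                                 (indicator-mono (0ℤ ℤ.<? x) (0ℤ ℤ.<? y) (λ p → ℤ.<-≤-trans p x≤y))

sign≤2 : ∀ x → sign x ≤ 2
sign≤2 x = +-mono-≤ (indicator≤1 (0ℤ ℤ.≤? x)) (indicator≤1 (0ℤ ℤ.<? x))

squeeze : ∀ {a b c d} → a ≤ c → b ≤ d → c + d ≤ a + b → c ≤ a × d ≤ b
squeeze {a} {b} {c} {d} a≤c b≤d le =
  +-cancelʳ-≤ b c a (≤-trans (+-monoʳ-≤ c b≤d) le) , +-cancelˡ-≤ a d b (≤-trans (+-monoˡ-≤ d a≤c) le)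

sign-same : ∀ {x y} → x ℤ.≤ y → sign y ≤ sign x → Same x y
sign-same {x} {y} x≤y le with squeeze
    (indicator-mono (0ℤ ℤ.≤? x) (0ℤ ℤ.≤? y) (λ p → ℤ.≤-trans p x≤y))
    (indicator-mono (0ℤ ℤ.<? x) (0ℤ ℤ.<? y) (λ p → ℤ.<-≤-trans p x≤y)) le
... | a , b =
  (λ x≤0 → ℤ.≮⇒≥ λ 0<y → ℤ.<⇒≱ (indicator-reflect (0ℤ ℤ.<? x) (0ℤ ℤ.<? y) b 0<y) x≤0) ,
  (λ y≤0 → ℤ.≤-trans x≤y y≤0) ,
  (λ 0≤x → ℤ.≤-trans 0≤x x≤y) ,
  indicator-reflect (0ℤ ℤ.≤? x) (0ℤ ℤ.≤? y) a

total : {A : Set} → (A → ℕ) → List A → ℕ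
total f []       = 0
total f (x ∷ xs) = f x + total f xs

module _ {A : Set} where
  total-mono : ∀ {f g : A → ℕ} xs → (∀ {x} → x ∈ xs → f x ≤ g x) → total f xs ≤ total g xs
  total-mono []       le = z≤n
  total-mono (x ∷ xs) le = +-mono-≤ (le (here refl)) (total-mono xs (le ∘ there))

  -- If a sum of weakly growing terms does not grow, none of its terms does; thus a single number
  -- controls all forms at once.
  total-squeeze : ∀ {f g : A → ℕ} xs → (∀ {x} → x ∈ xs → f x ≤ g x) → total g xs ≤ total f xs →
                  ∀ {x} → x ∈ xs → g x ≤ f x
  total-squeeze (y ∷ ys) le tot with squeeze (le (here refl)) (total-mono ys (le ∘ there)) tot
  ... | a , b = λ { (here refl) → a ; (there x∈) → total-squeeze ys (le ∘ there) b x∈ }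

  total-bound : ∀ {f : A → ℕ} b xs → (∀ x → f x ≤ b) → total f xs ≤ length xs * b
  total-bound b []       le = z≤n
  total-bound b (x ∷ xs) le = +-mono-≤ (le x) (total-bound b xs le)

firstIndex : (ℕ → Bool) → ℕ → ℕ
firstIndex f zero    = 0
firstIndex f (suc k) = if f 0 then 0 else suc (firstIndex (f ∘ suc) k)

firstIndex-cong : ∀ {f g : ℕ → Bool} k → (∀ b → b < k → f b ≡ g b) → firstIndex f k ≡ firstIndex g k
firstIndex-cong zero    eq = refl
firstIndex-cong (suc k) eq = cong₂ (if_then 0 else_) (eq 0 (s≤s z≤n)) (cong suc (firstIndex-cong k λ b → eq (suc b) ∘ s≤s))

firstIndex-sound : ∀ f k b → b < k → T (f b) → firstIndex f k < k × T (f (firstIndex f k))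
firstIndex-sound f (suc k) b b<k fb with f 0 in eq
... | true = s≤s z≤n , subst T (sym eq) _
firstIndex-sound f (suc k) zero    b<k fb | false = ⊥-elim (subst T eq fb)
firstIndex-sound f (suc k) (suc b) b<k fb | false with firstIndex-sound (f ∘ suc) k b (≤-pred b<k) fb
... | lt , q = s≤s lt , q

T-does : ∀ {P : Set} (d : Dec P) → P → T (does d)
T-does (yes _) _ = _
T-does (no ¬p) p = ⊥-elim (¬p p)

does-T : ∀ {P : Set} (d : Dec P) → T (does d) → P
does-T (yes p) _ = p

does-cong : ∀ {P Q : Set} (p : Dec P) (q : Dec Q) → (P → Q) → (Q → P) → does p ≡ does q
does-cong (yes _) (yes _) f g = refl
does-cong (no _)  (no _)  f g = refl
does-cong (yes p) (no ¬q) f g = ⊥-elim (¬q (f p))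
does-cong (no ¬p) (yes q) f g = ⊥-elim (¬p (g q))

length-product : {A B C : Set} (f : A → B → C) (xs : List A) (ys : List B) →
                 length (cartesianProductWith f xs ys) ≡ length xs * length ys
length-product f []       ys = refl
length-product f (x ∷ xs) ys = trans (length-++ (map (f x) ys))
  (cong₂ _+_ (length-map (f x) ys) (length-product f xs ys))

-- Links between colours and the closure of the relations.

module Relations (k : ℕ) (lev : ℕ → ℕ → ℕ) (Θ : List Affine) where

  z : ℕ → ℕ → ℤ
  z m v = ℤ.+ lev m v

  defect : ℕ → ℕ → Affine → ℕ → ℤ
  defect o m g v = z o v ℤ.- g · z m v

  defect-zero : ∀ {o m g v} → z o v ≡ g · z m v → defect o m g v ≡ 0ℤ
  defect-zero = ℤ.i≡j⇒i-j≡0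

  zero-defect : ∀ {o m g v} → defect o m g v ≡ 0ℤ → z o v ≡ g · z m v
  zero-defect = ℤ.i-j≡0⇒i≡j _ _

  Adjacent : ℕ → ℕ → ℕ → Set
  Adjacent v i j = Any (λ g → z i v ≡ g · z j v) Θ

  -- Warshall's algorithm; cs lists the colours that may occur as intermediate ones.
  Linked : List ℕ → ℕ → ℕ → ℕ → Set
  Linked []       v i j = Adjacent v i j
  Linked (c ∷ cs) v i j = Linked cs v i j ⊎ (Linked cs v i c × Linked cs v c j)

  linked? : ∀ cs v i j → Dec (Linked cs v i j)
  linked? []       v i j = any? (λ g → z i v ℤ.≟ g · z j v) Θ
  linked? (c ∷ cs) v i j = linked? cs v i j ⊎-dec (linked? cs v i c ×-dec linked? cs v c j)

  linked-trans : ∀ cs {v i c j} → c ∈ cs → Linked cs v i c → Linked cs v c j → Linked cs v i j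
  -- A link to c or from c can be cut short so that it avoids c in between.
  linked-trans (c ∷ cs) (here refl) a b = inj₂ (to-c a , from-c b)
    where
    to-c : ∀ {v i} → Linked (c ∷ cs) v i c → Linked cs v i c
    to-c (inj₁ x)       = x
    to-c (inj₂ (x , _)) = x
    from-c : ∀ {v j} → Linked (c ∷ cs) v c j → Linked cs v c j
    from-c (inj₁ x)       = x
    from-c (inj₂ (_ , x)) = x
  linked-trans (d ∷ cs) (there c∈) (inj₁ a) (inj₁ b) = inj₁ (linked-trans cs c∈ a b)
  linked-trans (d ∷ cs) (there c∈) (inj₁ a) (inj₂ (b , b′)) = inj₂ (linked-trans cs c∈ a b , b′)
  linked-trans (d ∷ cs) (there c∈) (inj₂ (a , a′)) (inj₁ b) = inj₂ (a , linked-trans cs c∈ a′ b)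
  linked-trans (d ∷ cs) (there c∈) (inj₂ (a , _)) (inj₂ (_ , b)) = inj₂ (a , b)

  adjacent-linked : ∀ cs {v i j} → Adjacent v i j → Linked cs v i j
  adjacent-linked []       a = a
  adjacent-linked (c ∷ cs) a = inj₁ (adjacent-linked cs a)

  closure : List ℕ → List Affine
  closure []       = Θ
  closure (c ∷ cs) = cartesianProductWith _⊙_ (closure cs) (closure cs)

  length-closure : ∀ cs → length (closure cs) ≡ length Θ ^ (2 ^ length cs)
  length-closure []       = sym (*-identityʳ _)
  length-closure (c ∷ cs) = trans (length-product _⊙_ (closure cs) (closure cs))
    (trans (cong₂ _*_ (length-closure cs) (trans (length-closure cs) (cong (length Θ ^_) (sym (+-identityʳ (2 ^ length cs))))))
      (sym (^-distribˡ-+-* (length Θ) (2 ^ length cs) (2 ^ length cs + 0))))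

  forms : List (ℕ × Affine)
  forms = cartesianProduct (upTo k) (closure (upTo k))

  length-forms : length forms ≡ k * length Θ ^ (2 ^ k)
  length-forms = trans (length-product _,_ (upTo k) (closure (upTo k)))
    (cong₂ _*_ (length-upTo k) (trans (length-closure (upTo k)) (cong (λ m → length Θ ^ (2 ^ m)) (length-upTo k))))

  module _ (id∈ : identity ∈ Θ) where

    identity∈closure : ∀ cs → identity ∈ closure cs
    identity∈closure []       = id∈
    identity∈closure (c ∷ cs) = ∈-cartesianProductWith⁺ _⊙_ (identity∈closure cs) (identity∈closure cs)

    -- Padding with `identity`, which is put into Θ for this purpose and to link every colour to
    -- itself.
    closure-weaken : ∀ c cs {g} → g ∈ closure cs → g ∈ closure (c ∷ cs)
    closure-weaken c cs {g} g∈ = subst (_∈ closure (c ∷ cs)) (identity-⊙ g)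
      (∈-cartesianProductWith⁺ _⊙_ (identity∈closure cs) g∈)

    Θ⊆closure : ∀ cs {g} → g ∈ Θ → g ∈ closure cs
    Θ⊆closure []       g∈ = g∈
    Θ⊆closure (c ∷ cs) g∈ = closure-weaken c cs (Θ⊆closure cs g∈)

    linked-refl : ∀ cs v i → Linked cs v i i
    linked-refl cs v i = adjacent-linked cs (lose id∈ (sym (identity-· _)))

    -- If x and v satisfy the same relations with colour o then they have the same links to o. The
    -- relation z o = h · z a records the part of a chain from o that has already been transferred.
    module _ {o x v : ℕ} where

      transfer : ∀ cs → (∀ {c} → c ∈ cs → c < k) → ∀ h {a b} → b < k →
        z o x ≡ h · z a x → z o v ≡ h · z a v →
        (∀ {g} → g ∈ closure cs → ∀ {j} → j < k → z o x ≡ h · g · z j x → z o v ≡ h · g · z j v) →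
        Linked cs x a b →
        ∃ λ g → g ∈ closure cs × z a x ≡ g · z b x × z a v ≡ g · z b v × Linked cs v a b
      transfer [] cs<k h {a} {b} b<k ox ov same link with find link
      ... | g , g∈ , eq = g , g∈ , eq , eqv , lose g∈ eqv
        where
        eqv : z a v ≡ g · z b v
        -- As `same` gives z o v = h · g · z b v, the common h cancels.
        eqv = ·-injective h (trans (sym ov) (same g∈ b<k (trans ox (cong (h ·_) eq))))
      transfer (c ∷ cs) cs<k h {a} {b} b<k ox ov same link = step link
        where
        same₁ : ∀ {g} → g ∈ closure cs → ∀ {j} → j < k → z o x ≡ h · g · z j x → z o v ≡ h · g · z j v
        same₁ g∈ = same (closure-weaken c cs g∈)
        step : Linked (c ∷ cs) x a b →
          ∃ λ g → g ∈ closure (c ∷ cs) × z a x ≡ g · z b x × z a v ≡ g · z b v × Linked (c ∷ cs) v a b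
        step (inj₁ l) with transfer cs (cs<k ∘ there) h b<k ox ov same₁ l
        ... | g , g∈ , eqx , eqv , l′ = g , closure-weaken c cs g∈ , eqx , eqv , inj₁ l′
        step (inj₂ (l , m)) with transfer cs (cs<k ∘ there) h (cs<k (here refl)) ox ov same₁ l
        ... | g , g∈ , eqx , eqv , l′
          -- The second half starts at c, which is related to o by the longer prefix h ⊙ g.
          with transfer cs (cs<k ∘ there) (h ⊙ g) b<k
                 (trans ox (trans (cong (h ·_) eqx) (sym (⊙-· h g _)))) (trans ov (trans (cong (h ·_) eqv) (sym (⊙-· h g _))))
                 (λ {g′} g′∈ j<k eq → trans (same (∈-cartesianProductWith⁺ _⊙_ g∈ g′∈) j<k
                    (trans eq (trans (⊙-· h g _) (cong (h ·_) (sym (⊙-· g g′ _))))))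
                    (trans (cong (h ·_) (⊙-· g g′ _)) (sym (⊙-· h g _)))) m
        ... | g′ , g′∈ , eqx′ , eqv′ , m′ = g ⊙ g′ , ∈-cartesianProductWith⁺ _⊙_ g∈ g′∈ ,
          trans eqx (trans (cong (g ·_) eqx′) (sym (⊙-· g g′ _))) ,
          trans eqv (trans (cong (g ·_) eqv′) (sym (⊙-· g g′ _))) , inj₂ (l′ , m′)

    SamePattern : ℕ → ℕ → ℕ → Set
    SamePattern o x v = ∀ {m g} → m < k → g ∈ closure (upTo k) → Same (defect o m g x) (defect o m g v)

    pattern-sym : ∀ {o x v} → SamePattern o x v → SamePattern o v x
    pattern-sym same m<k g∈ = same-sym (same m<k g∈)

    transfer-linked : ∀ {o x v b} → SamePattern o x v → b < k → Linked (upTo k) x o b →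
      ∃ λ g → g ∈ closure (upTo k) × z o x ≡ g · z b x × z o v ≡ g · z b v × Linked (upTo k) v o b
    transfer-linked {o} {x} {v} same b<k = transfer (upTo k) ∈-upTo⁻ identity b<k (sym (identity-· _)) (sym (identity-· _))
      (λ {g} g∈ {j} j<k eq → trans (zero-defect {o} {j} {g} {v} (same-zero (same j<k g∈)
         (defect-zero {o} {j} {g} {x} (trans eq (identity-· _))))) (sym (identity-· _)))

    representative : ℕ → ℕ → ℕ
    representative v o = firstIndex (λ b → does (linked? (upTo k) v o b)) k

    representative-spec : ∀ v {o} → o < k → representative v o < k × Linked (upTo k) v o (representative v o)
    representative-spec v {o} o<k with firstIndex-sound (λ b → does (linked? (upTo k) v o b)) k o o<k
      (T-does (linked? (upTo k) v o o) (linked-refl (upTo k) v o))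
    ... | lt , l = lt , does-T (linked? (upTo k) v o _) l

    representative-pattern : ∀ {o x v} → SamePattern o x v → representative x o ≡ representative v o
    representative-pattern {o} {x} {v} same = firstIndex-cong k λ b b<k →
      does-cong (linked? (upTo k) x o b) (linked? (upTo k) v o b)
        (λ l → proj₂ (proj₂ (proj₂ (proj₂ (transfer-linked same b<k l)))))
        (λ l → proj₂ (proj₂ (proj₂ (proj₂ (transfer-linked (pattern-sym same) b<k l)))))

    -- Each of i and j reaches through the other whatever that one reaches. Both adjacencies are
    -- assumed because Θ is arbitrary here.
    representative-adjacent : ∀ {v i j} → i < k → j < k → Adjacent v i j → Adjacent v j i →
                              representative v i ≡ representative v j
    representative-adjacent {v} {i} {j} i<k j<k ij ji = firstIndex-cong k λ b b<k →
      does-cong (linked? (upTo k) v i b) (linked? (upTo k) v j b)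
        (linked-trans (upTo k) (∈-upTo⁺ i<k) (adjacent-linked (upTo k) ji))
        (linked-trans (upTo k) (∈-upTo⁺ j<k) (adjacent-linked (upTo k) ij))

-- Pieces swept at unit speed.

dist-+ʳ : ∀ a i → dist a (a + i) ≡ i
dist-+ʳ a i = trans (cong₂ _+_ (m+n∸m≡n a i) (m≤n⇒m∸n≡0 (m≤m+n a i))) (+-identityʳ i)

dist-+ˡ : ∀ r i → dist (r + i) r ≡ i
dist-+ˡ r i = cong₂ _+_ (m≤n⇒m∸n≡0 (m≤m+n r i)) (m+n∸m≡n r i)

module Sweep (ℓ : ℕ → ℕ) (d : ℕ) where

  UnitSpeed : Set
  UnitSpeed = (∀ i → i ≤ d → ℓ i ≡ ℓ 0 + i) ⊎ (∀ i → i ≤ d → ℓ i + i ≡ ℓ 0)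

  index : ℕ → ℕ
  index r = dist (ℓ 0) r

  -- At unit speed, up or down, the index at which level r is attained is the distance of r from the
  -- initial level.
  locate : UnitSpeed → ∀ {r} → Between (ℓ 0) (ℓ d) r → index r ≤ d × ℓ (index r) ≡ r
  locate (inj₁ up) {r} b with m≤n⇒∃[o]m+o≡n (lower b)
    where
    0≤d : ℓ 0 ≤ ℓ d
    0≤d = subst (ℓ 0 ≤_) (sym (up d ≤-refl)) (m≤m+n (ℓ 0) d)
    lower : Between (ℓ 0) (ℓ d) r → ℓ 0 ≤ r
    lower (inj₁ (a , _)) = a
    lower (inj₂ (a , _)) = ≤-trans 0≤d a
  ... | i , refl = ≤-trans (≤-reflexive (dist-+ʳ (ℓ 0) i)) i≤d ,
    trans (cong ℓ (dist-+ʳ (ℓ 0) i)) (up i i≤d)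
    where
    upper : Between (ℓ 0) (ℓ d) (ℓ 0 + i) → ℓ 0 + i ≤ ℓ 0 + d
    upper (inj₁ (_ , a)) = ≤-trans a (≤-reflexive (up d ≤-refl))
    upper (inj₂ (_ , a)) = ≤-trans a (m≤m+n (ℓ 0) d)
    i≤d : i ≤ d
    i≤d = +-cancelˡ-≤ (ℓ 0) i d (upper b)
  locate (inj₂ down) {r} b with m≤n⇒∃[o]m+o≡n (upper b)
    where
    d≤0 : ℓ d ≤ ℓ 0
    d≤0 = subst (ℓ d ≤_) (down d ≤-refl) (m≤m+n (ℓ d) d)
    upper : Between (ℓ 0) (ℓ d) r → r ≤ ℓ 0
    upper (inj₁ (_ , a)) = ≤-trans a d≤0
    upper (inj₂ (_ , a)) = a
  ... | i , eq = ≤-trans (≤-reflexive index≡) i≤d ,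
    +-cancelʳ-≡ i _ r (trans (cong (λ j → ℓ j + i) index≡) (trans (down i i≤d) (sym eq)))
    where
    index≡ : index r ≡ i
    index≡ = trans (cong (λ a → dist a r) (sym eq)) (dist-+ˡ r i)
    lower : Between (ℓ 0) (ℓ d) r → ℓ d ≤ r
    lower (inj₁ (a , _)) = ≤-trans (≤-trans (m≤m+n (ℓ d) d) (≤-reflexive (down d ≤-refl))) a
    lower (inj₂ (a , _)) = a
    i≤d : i ≤ d
    i≤d = +-cancelˡ-≤ (ℓ d) i d (≤-trans (+-monoˡ-≤ i (lower b)) (≤-reflexive (trans eq (sym (down d ≤-refl)))))

  index-start : index (ℓ 0) ≡ 0
  index-start = trans (cong (dist (ℓ 0)) (sym (+-identityʳ (ℓ 0)))) (dist-+ʳ (ℓ 0) 0)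

  index-end : UnitSpeed → index (ℓ d) ≡ d
  index-end (inj₁ up)   = trans (cong (dist (ℓ 0)) (up d ≤-refl)) (dist-+ʳ (ℓ 0) d)
  index-end (inj₂ down) = trans (cong (λ a → dist a (ℓ d)) (sym (down d ≤-refl))) (dist-+ˡ (ℓ d) d)

  index-suc : UnitSpeed → ∀ {r} → Between (ℓ 0) (ℓ d) r → Between (ℓ 0) (ℓ d) (suc r) →
              index (suc r) ≡ suc (index r) ⊎ index r ≡ suc (index (suc r))
  index-suc unit {r} b b′ with unit | locate unit b | locate unit b′
  ... | inj₁ up | i≤ , eq | j≤ , eq′ = inj₁ (+-cancelˡ-≡ (ℓ 0) _ _ (trans (sym (up _ j≤))
    (trans eq′ (trans (cong suc (trans (sym eq) (up _ i≤))) (sym (+-suc (ℓ 0) _))))))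
  ... | inj₂ down | i≤ , eq | j≤ , eq′ = inj₂ (+-cancelˡ-≡ r _ _ (trans (cong (_+ index r) (sym eq)) (trans (down _ i≤)
    (trans (sym (down _ j≤)) (trans (cong (_+ index (suc r)) eq′) (sym (+-suc r _)))))))

-- Solutions yield certificates

module Construct (n k l M : ℕ) (E : ℕ → ℕ → Set) (lev : ℕ → ℕ → ℕ) (s t c : ℕ → ℕ)
  (E-sym : ∀ {u v} → u < n → v < n → E u v → E v u)
  (jump : ∀ {u v m} → m < k → u < n → v < n → E u v → lev m v ≤ suc (lev m u) × lev m u ≤ suc (lev m v))
  (lev<n : ∀ {m v} → m < k → v < n → lev m v < n)
  (c<k : ∀ {p} → p < l → c p < k)
  -- Here 1 + 3 l² is the size of Θ. Each of the k forms per element of the closure has sign 0, 1 or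
  -- 2, so the total of the signs takes at most this many values.
  (M-large : suc (k * (suc (3 * (l * l)) ^ (2 ^ k)) * 2) ≤ M)
  (L : ℕ → ℕ) (w : ℕ → ℕ → ℕ)
  (w<n : ∀ {p i} → p < l → i ≤ L p → w p i < n)
  (forward : ∀ {p i} → p < l → i < L p → E (w p i) (w p (suc i)) × lev (c p) (w p (suc i)) ≡ suc (lev (c p) (w p i)))
  (ends : ∀ {p} → p < l → (w p 0 ≡ s p × w p (L p) ≡ t p) ⊎ (w p 0 ≡ t p × w p (L p) ≡ s p))
  (shared : ∀ {p q i j} → p < l → q < l → ¬ p ≡ q → i ≤ L p → j ≤ L q → w p i ≡ w q j →
            (w p i ≡ s p ⊎ w p i ≡ t p) × (w p i ≡ s q ⊎ w p i ≡ t q))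
  where

  open Certificates n k l M E lev s t c

  cone-refl : ∀ {o u} → Cone o u u
  cone-refl {o} {u} m _ = ≤-reflexive (+-comm (lev m u) (lev o u)) , ≤-refl

  cone-trans : ∀ {o u v w} → Cone o u v → Cone o v w → Cone o u w
  cone-trans {o} {u} {v} {w} a b m m<k =
    cancel (lev m v) (lev o v) (lev m w) (lev o u) (lev o w) (lev m u) (proj₁ (a m m<k)) (proj₁ (b m m<k)) ,
    ≤-trans (proj₂ (a m m<k)) (proj₂ (b m m<k))
    where
    cancel : ∀ v v′ w u w′ u′ → v + u ≤ v′ + u′ → w + v′ ≤ w′ + v → w + u ≤ w′ + u′
    cancel v v′ w u w′ u′ x y = +-cancelʳ-≤ (v + v′) _ _ (≤-trans
      (≤-reflexive (solve 4 (λ v v′ w u → w :+ u :+ (v :+ v′) := v :+ u :+ (w :+ v′)) refl v v′ w u))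
      (≤-trans (+-mono-≤ x y)
        (≤-reflexive (solve 4 (λ v v′ w′ u′ → v′ :+ u′ :+ (w′ :+ v) := w′ :+ u′ :+ (v :+ v′)) refl v v′ w′ u′))))
      where open +-*-Solver

  cone-path : ∀ {p i j} → p < l → i ≤ j → j ≤ L p → Cone (c p) (w p i) (w p j)
  cone-path {p} {i} {j} p<l i≤j j≤L with m≤n⇒∃[o]m+o≡n i≤j
  ... | d , refl = steps d j≤L
    where
    steps : ∀ d → i + d ≤ L p → Cone (c p) (w p i) (w p (i + d))
    steps zero    le = subst (λ j → Cone (c p) (w p i) (w p j)) (sym (+-identityʳ i)) cone-refl
    steps (suc d) le = subst (λ j → Cone (c p) (w p i) (w p j)) (sym (+-suc i d))
      (cone-trans (steps d (<⇒≤ le′)) λ m m<k →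
        let e , up = forward p<l le′ ; j₁ , j₂ = jump m<k (w<n p<l (<⇒≤ le′)) (w<n p<l le′) e in
        ≤-trans (+-monoˡ-≤ _ j₁) (≤-trans (≤-reflexive (cong suc (+-comm (lev m (w p (i + d))) _))) (≤-reflexive (cong (_+ lev m (w p (i + d))) (sym up)))) ,
        ≤-trans (+-monoˡ-≤ _ j₂) (≤-reflexive (trans (sym (+-suc (lev m (w p (suc (i + d)))) _)) (cong (lev m (w p (suc (i + d))) +_) (sym up)))))
      where
      le′ : i + d < L p
      le′ = subst (_≤ L p) (+-suc i d) le

  level-path : ∀ {p} → p < l → ∀ i j → i + j ≤ L p → lev (c p) (w p (i + j)) ≡ lev (c p) (w p i) + j
  level-path {p} p<l i zero    le = trans (cong (λ j → lev (c p) (w p j)) (+-identityʳ i)) (sym (+-identityʳ _))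
  level-path {p} p<l i (suc j) le = trans (cong (λ j → lev (c p) (w p j)) (+-suc i j))
    (trans (proj₂ (forward p<l le′)) (trans (cong suc (level-path p<l i j (<⇒≤ le′))) (sym (+-suc _ j))))
    where
    le′ : i + j < L p
    le′ = subst (_≤ L p) (+-suc i j) le

  -- Thresholds of the paths p and q in the coordinates z i - z j (offset by n) and z i + z j, where i = c p and j = c q.
  module Pair (p q : Fin l) where
    i j : ℕ
    i = c (toℕ p)
    j = c (toℕ q)
    wp wq : ℕ → ℕ
    wp = w (toℕ p)
    wq = w (toℕ q)

    a b : ℕ → ℕ
    a v = lev i v + (n ∸ lev j v)
    b v = lev i v + lev j v

    a-mono : ∀ {u v} → lev j u ≤ n → lev j v ≤ n → lev j v + lev i u ≤ lev i v + lev j u → a u ≤ a v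
    a-mono {u} {v} u≤n v≤n le = +-cancelʳ-≤ (lev j v + lev j u) _ _ (≤-trans
      (≤-reflexive (trans (arrange (lev i u) (n ∸ lev j u) (lev j v) (lev j u)) (cong (λ x → lev j v + lev i u + x) (m∸n+n≡m u≤n))))
      (≤-trans (+-monoˡ-≤ n le)
        (≤-reflexive (trans (cong (λ x → lev i v + lev j u + x) (sym (m∸n+n≡m v≤n)))
          (arrange′ (lev i v) (lev j u) (n ∸ lev j v) (lev j v))))))
      where
      open +-*-Solver
      arrange : ∀ x y z t → x + y + (z + t) ≡ z + x + (y + t)
      arrange = solve 4 (λ x y z t → x :+ y :+ (z :+ t) := z :+ x :+ (y :+ t)) refl
      arrange′ : ∀ x y z t → x + y + (z + t) ≡ x + z + (t + y)
      arrange′ = solve 4 (λ x y z t → x :+ y :+ (z :+ t) := x :+ z :+ (t :+ y)) refl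

    private
      p<l = toℕ<n p
      q<l = toℕ<n q
      levp : ∀ {x} → x ≤ L (toℕ p) → lev j (wp x) ≤ n
      levp x≤ = <⇒≤ (lev<n (c<k q<l) (w<n p<l x≤))
      levq : ∀ {x} → x ≤ L (toℕ q) → lev j (wq x) ≤ n
      levq x≤ = <⇒≤ (lev<n (c<k q<l) (w<n q<l x≤))

    module Chains = Thresholds (L (toℕ p)) (L (toℕ q)) (a ∘ wp) (b ∘ wp) (a ∘ wq) (b ∘ wq)
      (λ {x} {y} x≤y y≤ → a-mono (levp (≤-trans x≤y y≤)) (levp y≤) (proj₁ (cone-path p<l x≤y y≤ j (c<k q<l))))
      (λ {x} {y} x≤y y≤ → subst₂ _≤_ (+-comm (lev j (wp x)) _) (+-comm (lev j (wp y)) _) (proj₂ (cone-path p<l x≤y y≤ j (c<k q<l))))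
      -- The path q has colour j, so z j - z i grows along it and `a` falls.
      (λ {x} {y} x≤y y≤ → a-mono (levq y≤) (levq (≤-trans x≤y y≤))
        (subst₂ _≤_ (+-comm (lev i (wq y)) _) (+-comm (lev j (wq y)) _) (proj₁ (cone-path q<l x≤y y≤ i (c<k p<l)))  ))
      (λ x≤y y≤ → proj₂ (cone-path q<l x≤y y≤ i (c<k p<l)))

    abstract
      thresholds : ∃ λ c₁ → ∃ λ c₂ →
        (∀ x → x ≤ L (toℕ p) → (a (wp x) ≤ c₁ × b (wp x) ≤ c₂) ⊎ (c₁ ≤ a (wp x) × c₂ ≤ b (wp x))) ×
        (∀ x → x ≤ L (toℕ q) → (c₁ ≤ a (wq x) × b (wq x) ≤ c₂) ⊎ (a (wq x) ≤ c₁ × c₂ ≤ b (wq x)))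
      thresholds = let c₁ , left , right = Chains.abscissa ; c₂ , r = Chains.ordinate left right in c₁ , c₂ , r

    c₁ c₂ : ℕ
    c₁ = proj₁ thresholds
    c₂ = proj₁ (proj₂ thresholds)

    abstract
      γ δ : ℤ
      -- Takes back the offset n of `a`.
      γ = ℤ.+ c₁ ℤ.- ℤ.+ n
      δ = ℤ.+ c₂

      γ≡ : γ ≡ ℤ.+ c₁ ℤ.- ℤ.+ n
      γ≡ = refl

      δ≡ : δ ≡ ℤ.+ c₂
      δ≡ = refl

  pairs : List (Fin l × Fin l)
  pairs = cartesianProduct (allFin l) (allFin l)

  shift-γ shift-γ⁻ flip-δ : Fin l × Fin l → Affine
  shift-γ (p , q)  = shift (Pair.γ p q)
  shift-γ⁻ (p , q) = shift (ℤ.- Pair.γ p q)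
  flip-δ (p , q)   = flip (Pair.δ p q)

  -- For every pair of paths the two possible relations and their inverses; a `flip` is its own
  -- inverse, so three families are enough.
  Θ : List Affine
  Θ = identity ∷ map shift-γ pairs ++ map shift-γ⁻ pairs ++ map flip-δ pairs

  length-Θ : length Θ ≡ suc (3 * (l * l))
  length-Θ = cong suc (trans (length-++ (map shift-γ pairs)) (cong₂ _+_ (one shift-γ)
    (trans (length-++ (map shift-γ⁻ pairs)) (cong₂ _+_ (one shift-γ⁻) (trans (one flip-δ) (sym (+-identityʳ (l * l))))))))
    where
    one : (f : Fin l × Fin l → Affine) → length (map f pairs) ≡ l * l
    one f = trans (length-map f pairs) (trans (length-product _,_ (allFin l) (allFin l))
      (cong₂ _*_ (length-tabulate {n = l} (λ x → x)) (length-tabulate {n = l} (λ x → x))))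

  open Relations k lev Θ

  id∈Θ : identity ∈ Θ
  id∈Θ = here refl

  module _ (p q : Fin l) where
    private
      pair∈ : (p , q) ∈ pairs
      pair∈ = ∈-cartesianProduct⁺ (∈-allFin p) (∈-allFin q)

    γ∈Θ : shift (Pair.γ p q) ∈ Θ
    γ∈Θ = there (∈-++⁺ˡ (∈-map⁺ shift-γ pair∈))

    -γ∈Θ : shift (ℤ.- Pair.γ p q) ∈ Θ
    -γ∈Θ = there (∈-++⁺ʳ (map shift-γ pairs) (∈-++⁺ˡ (∈-map⁺ shift-γ⁻ pair∈)))

    δ∈Θ : flip (Pair.δ p q) ∈ Θ
    δ∈Θ = there (∈-++⁺ʳ (map shift-γ pairs) (∈-++⁺ʳ (map shift-γ⁻ pairs) (∈-map⁺ flip-δ pair∈)))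

  diff≤0 : ∀ {a b} → a ≤ b → ℤ.+ a ℤ.- ℤ.+ b ℤ.≤ 0ℤ
  diff≤0 = ℤ.i≤j⇒i-j≤0 ∘ ℤ.+≤+

  0≤diff : ∀ {a b} → b ≤ a → 0ℤ ℤ.≤ ℤ.+ a ℤ.- ℤ.+ b
  0≤diff = ℤ.i≤j⇒0≤j-i ∘ ℤ.+≤+

  module _ (p q : Fin l) (v : ℕ) where
    open Pair p q using (i; j; a; b; γ; δ; c₁; c₂; γ≡; δ≡)
    private
      zi = ℤ.+ lev i v
      zj = ℤ.+ lev j v

      γ-form : defect i j (shift γ) v ≡ ℤ.+ (lev i v + n) ℤ.- ℤ.+ (c₁ + lev j v)
      γ-form = trans (cong (λ g → zi ℤ.- (zj ℤ.+ g)) γ≡) (eq zi zj (ℤ.+ c₁) (ℤ.+ n))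
        where
        eq : ∀ x y c n → x ℤ.- (y ℤ.+ (c ℤ.- n)) ≡ x ℤ.+ n ℤ.- (c ℤ.+ y)
        eq = solve-∀

      -γ-form : defect j i (shift (ℤ.- γ)) v ≡ ℤ.+ (c₁ + lev j v) ℤ.- ℤ.+ (lev i v + n)
      -γ-form = trans (cong (λ g → zj ℤ.- (zi ℤ.+ ℤ.- g)) γ≡) (eq zi zj (ℤ.+ c₁) (ℤ.+ n))
        where
        eq : ∀ x y c n → y ℤ.- (x ℤ.+ ℤ.- (c ℤ.- n)) ≡ c ℤ.+ y ℤ.- (x ℤ.+ n)
        eq = solve-∀

      δ-form : defect i j (flip δ) v ≡ ℤ.+ b v ℤ.- ℤ.+ c₂
      δ-form = trans (cong (λ d → zi ℤ.- (d ℤ.- zj)) δ≡) (eq zi zj (ℤ.+ c₂))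
        where
        eq : ∀ x y c → x ℤ.- (c ℤ.- y) ≡ x ℤ.+ y ℤ.- c
        eq = solve-∀

    δ-sym : defect j i (flip δ) v ≡ defect i j (flip δ) v
    δ-sym = eq zi zj δ
      where
      eq : ∀ x y c → y ℤ.- (c ℤ.- x) ≡ x ℤ.- (c ℤ.- y)
      eq = solve-∀

    γ-neg : defect j i (shift (ℤ.- γ)) v ≡ ℤ.- defect i j (shift γ) v
    γ-neg = eq zi zj γ
      where
      eq : ∀ x y c → y ℤ.- (x ℤ.+ ℤ.- c) ≡ ℤ.- (x ℤ.- (y ℤ.+ c))
      eq = solve-∀

    module _ (v≤n : lev j v ≤ n) where
      private
        a+ : a v + lev j v ≡ lev i v + n
        a+ = trans (+-assoc (lev i v) _ _) (cong (lev i v +_) (m∸n+n≡m v≤n))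

      γ≤0 : a v ≤ c₁ → defect i j (shift γ) v ℤ.≤ 0ℤ
      γ≤0 le = subst (ℤ._≤ 0ℤ) (sym γ-form) (diff≤0 (≤-trans (≤-reflexive (sym a+)) (+-monoˡ-≤ _ le)))

      0≤γ : c₁ ≤ a v → 0ℤ ℤ.≤ defect i j (shift γ) v
      0≤γ le = subst (0ℤ ℤ.≤_) (sym γ-form) (0≤diff (≤-trans (+-monoˡ-≤ _ le) (≤-reflexive a+)))

      -γ≤0 : c₁ ≤ a v → defect j i (shift (ℤ.- γ)) v ℤ.≤ 0ℤ
      -γ≤0 le = subst (ℤ._≤ 0ℤ) (sym -γ-form) (diff≤0 (≤-trans (+-monoˡ-≤ _ le) (≤-reflexive a+)))

      0≤-γ : a v ≤ c₁ → 0ℤ ℤ.≤ defect j i (shift (ℤ.- γ)) v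
      0≤-γ le = subst (0ℤ ℤ.≤_) (sym -γ-form) (0≤diff (≤-trans (≤-reflexive (sym a+)) (+-monoˡ-≤ _ le)))

    δ≤0 : b v ≤ c₂ → defect i j (flip δ) v ℤ.≤ 0ℤ
    δ≤0 le = subst (ℤ._≤ 0ℤ) (sym δ-form) (diff≤0 le)

    0≤δ : c₂ ≤ b v → 0ℤ ℤ.≤ defect i j (flip δ) v
    0≤δ le = subst (0ℤ ℤ.≤_) (sym δ-form) (0≤diff le)

  -- Two opposite closed quadrants. If the colours are exchanged and γ is negated, the first form
  -- changes its sign and the second does not, so the same formula describes the quadrants of the
  -- other path.
  OneSided : ℕ → ℕ → Affine → Affine → ℕ → Set
  OneSided i j g h v = (defect i j g v ℤ.≤ 0ℤ × defect i j h v ℤ.≤ 0ℤ) ⊎ (0ℤ ℤ.≤ defect i j g v × 0ℤ ℤ.≤ defect i j h v)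

  one-sided-same : ∀ {i j g h u v} → Same (defect i j g u) (defect i j g v) → Same (defect i j h u) (defect i j h v) →
                   OneSided i j g h u → OneSided i j g h v
  one-sided-same (a , _ , _ , _) (b , _ , _ , _) (inj₁ (x , y)) = inj₁ (a x , b y)
  one-sided-same (_ , _ , a , _) (_ , _ , b , _) (inj₂ (x , y)) = inj₂ (a x , b y)

  one-sided-p : ∀ p q {x} → x ≤ L (toℕ p) →
    OneSided (c (toℕ p)) (c (toℕ q)) (shift (Pair.γ p q)) (flip (Pair.δ p q)) (w (toℕ p) x)
  one-sided-p p q {x} x≤ = [ (λ { (le , le′) → inj₁ (γ≤0 p q (w (toℕ p) x) v≤n le , δ≤0 p q (w (toℕ p) x) le′) }) ,
    (λ { (le , le′) → inj₂ (0≤γ p q (w (toℕ p) x) v≤n le , 0≤δ p q (w (toℕ p) x) le′) }) ]′ (proj₁ (proj₂ (proj₂ (Pair.thresholds p q))) x x≤)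
    where
    v≤n : lev (c (toℕ q)) (w (toℕ p) x) ≤ n
    v≤n = <⇒≤ (lev<n (c<k (toℕ<n q)) (w<n (toℕ<n p) x≤))

  one-sided-q : ∀ p q {x} → x ≤ L (toℕ q) →
    OneSided (c (toℕ q)) (c (toℕ p)) (shift (ℤ.- Pair.γ p q)) (flip (Pair.δ p q)) (w (toℕ q) x)
  one-sided-q p q {x} x≤ = [ (λ { (le , le′) → inj₁ (-γ≤0 p q (w (toℕ q) x) v≤n le , subst (ℤ._≤ 0ℤ) (sym (δ-sym p q (w (toℕ q) x))) (δ≤0 p q (w (toℕ q) x) le′)) }) ,
    (λ { (le , le′) → inj₂ (0≤-γ p q (w (toℕ q) x) v≤n le , subst (0ℤ ℤ.≤_) (sym (δ-sym p q (w (toℕ q) x))) (0≤δ p q (w (toℕ q) x) le′)) }) ]′ (proj₂ (proj₂ (proj₂ (Pair.thresholds p q))) x x≤)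
    where
    v≤n : lev (c (toℕ q)) (w (toℕ q) x) ≤ n
    v≤n = <⇒≤ (lev<n (c<k (toℕ<n q)) (w<n (toℕ<n q) x≤))

  -- The paths p and q lie in opposite pairs of quadrants around their thresholds.
  adjacent-meet : ∀ p q {v} →
    OneSided (c (toℕ p)) (c (toℕ q)) (shift (Pair.γ p q)) (flip (Pair.δ p q)) v →
    OneSided (c (toℕ q)) (c (toℕ p)) (shift (ℤ.- Pair.γ p q)) (flip (Pair.δ p q)) v →
    Adjacent v (c (toℕ p)) (c (toℕ q)) × Adjacent v (c (toℕ q)) (c (toℕ p))
  adjacent-meet p q {v} = meet
    where
    i = c (toℕ p)
    j = c (toℕ q)
    γ = Pair.γ p q
    δ = Pair.δ p q
    via-γ : defect i j (shift γ) v ≡ 0ℤ → Adjacent v i j × Adjacent v j i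
    via-γ eq = lose (γ∈Θ p q) (zero-defect {i} {j} {shift γ} {v} eq) ,
      lose (-γ∈Θ p q) (zero-defect {j} {i} {shift (ℤ.- γ)} {v} (trans (γ-neg p q v) (cong ℤ.-_ eq)))
    via-δ : defect i j (flip δ) v ≡ 0ℤ → Adjacent v i j × Adjacent v j i
    via-δ eq = lose (δ∈Θ p q) (zero-defect {i} {j} {flip δ} {v} eq) ,
      lose (δ∈Θ p q) (zero-defect {j} {i} {flip δ} {v} (trans (δ-sym p q v) eq))
    flip-≤ : defect j i (shift (ℤ.- γ)) v ℤ.≤ 0ℤ → 0ℤ ℤ.≤ defect i j (shift γ) v
    flip-≤ le = subst (0ℤ ℤ.≤_) (trans (cong ℤ.-_ (γ-neg p q v)) (ℤ.neg-involutive _)) (ℤ.neg-mono-≤ le)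
    flip-≥ : 0ℤ ℤ.≤ defect j i (shift (ℤ.- γ)) v → defect i j (shift γ) v ℤ.≤ 0ℤ
    flip-≥ le = subst (ℤ._≤ 0ℤ) (trans (cong ℤ.-_ (γ-neg p q v)) (ℤ.neg-involutive _)) (ℤ.neg-mono-≤ le)
    meet : OneSided i j (shift γ) (flip δ) v → OneSided j i (shift (ℤ.- γ)) (flip δ) v → Adjacent v i j × Adjacent v j i
    -- A quadrant of p and one of q are on the same side of one of the two lines and on opposite
    -- sides of the other, so v is on the latter.
    meet (inj₁ (x , _)) (inj₁ (x′ , _)) = via-γ (ℤ.≤-antisym x (flip-≤ x′))
    meet (inj₂ (x , _)) (inj₂ (x′ , _)) = via-γ (ℤ.≤-antisym (flip-≥ x′) x)
    meet (inj₁ (_ , y)) (inj₂ (_ , y′)) = via-δ (ℤ.≤-antisym y (subst (0ℤ ℤ.≤_) (δ-sym p q v) y′))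
    meet (inj₂ (_ , y)) (inj₁ (_ , y′)) = via-δ (ℤ.≤-antisym (subst (ℤ._≤ 0ℤ) (δ-sym p q v) y′) y)

  -- The two inequalities of a cone are exactly the monotonicity of the forms with `shift` and with
  -- `flip`.
  defect-mono : ∀ {o m u v} → m < k → Cone o u v → ∀ g → defect o m g u ℤ.≤ defect o m g v
  defect-mono {o} {m} {u} {v} m<k cone (shift e) = subst₂ ℤ._≤_ (eq (z m v) (z o u) (z m u) e) (eq′ (z o v) (z m u) (z m v) e)
    (ℤ.+-monoˡ-≤ (ℤ.- z m u ℤ.- z m v ℤ.- e) (ℤ.+≤+ (proj₁ (cone m m<k))))
    where
    eq : ∀ mv ou mu e → mv ℤ.+ ou ℤ.+ (ℤ.- mu ℤ.- mv ℤ.- e) ≡ ou ℤ.- (mu ℤ.+ e)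
    eq = solve-∀
    eq′ : ∀ ov mu mv e → ov ℤ.+ mu ℤ.+ (ℤ.- mu ℤ.- mv ℤ.- e) ≡ ov ℤ.- (mv ℤ.+ e)
    eq′ = solve-∀
  defect-mono {o} {m} {u} {v} m<k cone (flip e) = subst₂ ℤ._≤_ (eq (z m u) (z o u) e) (eq (z m v) (z o v) e)
    (ℤ.+-monoˡ-≤ (ℤ.- e) (ℤ.+≤+ (proj₂ (cone m m<k))))
    where
    eq : ∀ m o e → m ℤ.+ o ℤ.+ ℤ.- e ≡ o ℤ.- (e ℤ.- m)
    eq = solve-∀

  formSign : ℕ → ℕ → ℕ × Affine → ℕ
  formSign o v (m , g) = sign (defect o m g v)

  value : ℕ → ℕ → ℕ
  value o v = total (formSign o v) forms

  formSign-mono : ∀ {o u v} → Cone o u v → ∀ {f} → f ∈ forms → formSign o u f ≤ formSign o v f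
  formSign-mono cone {m , g} f∈ =
    sign-mono (defect-mono (∈-upTo⁻ (proj₁ (∈-cartesianProduct⁻ (upTo k) (closure (upTo k)) f∈))) cone g)

  value-mono : ∀ {o u v} → Cone o u v → value o u ≤ value o v
  value-mono cone = total-mono forms (formSign-mono cone)

  value-bound : ∀ o v → value o v ≤ M ∸ 1
  value-bound o v = ≤-trans (total-bound 2 forms (λ { (m , g) → sign≤2 (defect o m g v) }))
    (≤-trans (≤-reflexive (cong (_* 2) (trans length-forms (cong (λ x → k * x ^ (2 ^ k)) length-Θ)))) (∸-monoˡ-≤ 1 M-large))

  -- No sign falls on the way from x through v to y, and equal totals leave no room for a rise. Here
  -- v may be any vertex of the hull, on the path or not.
  same-between : ∀ {o x v y} → Cone o x v → Cone o v y → value o x ≡ value o y → SamePattern id∈Θ o x v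
  same-between xv vy eq {m} {g} m<k g∈ = sign-same (defect-mono m<k xv g)
    (total-squeeze forms (formSign-mono xv) (≤-trans (value-mono vy) (≤-reflexive (sym eq)))
      (∈-cartesianProduct⁺ (∈-upTo⁺ m<k) g∈))

  module Cut (p : ℕ) = Pieces (λ i → value (c p) (w p i)) (L p)
  open Cut using (lo; hi)

  X Y K : ℕ → ℕ → ℕ
  X p m = w p (lo p m)
  Y p m = w p (hi p m)
  K p m = representative id∈Θ (X p m) (c p)

  -- The minimum matters only at times when the piece is inactive: it then keeps the index on the
  -- path, as the range conditions apply at all times.
  V : ℕ → ℕ → ℕ → ℕ
  V r p m = w p (lo p m + (dist (lev (K p m) (X p m)) r ⊓ (hi p m ∸ lo p m)))

  module _ {p} (p<l : p < l) (m : ℕ) where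
    private
      o κ d : ℕ
      o = c p
      κ = K p m
      d = hi p m ∸ lo p m
      lo+d : lo p m + d ≡ hi p m
      lo+d = m+[n∸m]≡n (Cut.lo≤hi p m)

    within : ∀ {i} → i ≤ d → lo p m + i ≤ hi p m
    within i≤d = ≤-trans (+-monoʳ-≤ (lo p m) i≤d) (≤-reflexive lo+d)

    withinL : ∀ {i} → i ≤ d → lo p m + i ≤ L p
    withinL i≤d = ≤-trans (within i≤d) (Cut.hi≤L p m)

    X<n : X p m < n
    X<n = w<n p<l (≤-trans (Cut.lo≤hi p m) (Cut.hi≤L p m))

    Y<n : Y p m < n
    Y<n = w<n p<l (Cut.hi≤L p m)

    V<n : ∀ r → V r p m < n
    V<n r = w<n p<l (withinL (m⊓n≤n _ d))

    piece-constant : value o (X p m) ≡ value o (Y p m)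
    piece-constant = Cut.constant p (λ i≤j j≤L → value-mono (cone-path p<l i≤j j≤L)) m

    hull-pattern : ∀ {v} → Hull o (X p m) (Y p m) v → SamePattern id∈Θ o (X p m) v
    hull-pattern (xv , vy) = same-between xv vy piece-constant

    on-hull : ∀ {i} → i ≤ d → Hull o (X p m) (Y p m) (w p (lo p m + i))
    on-hull {i} i≤d = cone-path p<l (m≤m+n (lo p m) i) (withinL i≤d) , cone-path p<l (within i≤d) (Cut.hi≤L p m)

    κ<k : κ < k
    κ<k = proj₁ (representative-spec id∈Θ (X p m) (c<k p<l))

    -- The relation between the colours o and κ at X has defect 0 there, hence on the whole piece.
    -- So the level for κ rises with that for o if the relation is a `shift` and falls if it is a
    -- `flip`.
    levels : (∀ i → i ≤ d → lev κ (w p (lo p m + i)) ≡ lev κ (X p m) + i) ⊎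
             (∀ i → i ≤ d → lev κ (w p (lo p m + i)) + i ≡ lev κ (X p m))
    -- A transfer from X to X itself extracts the composite relation from the link.
    levels = speed (transfer-linked id∈Θ {o} {X p m} {X p m} (λ _ _ → (λ x → x) , (λ x → x) , (λ x → x) , (λ x → x)) κ<k
      (proj₂ (representative-spec id∈Θ (X p m) (c<k p<l))))
      where
      move-o : ∀ {i} → i ≤ d → z o (w p (lo p m + i)) ≡ z o (X p m) ℤ.+ ℤ.+ i
      move-o {i} i≤d = cong ℤ.+_ (level-path p<l (lo p m) i (withinL i≤d))

      carry : ∀ {g} → g ∈ closure (upTo k) → z o (X p m) ≡ g · z κ (X p m) → ∀ {i} → i ≤ d →
              z o (w p (lo p m + i)) ≡ g · z κ (w p (lo p m + i))
      carry {g} g∈ eq {i} i≤d = zero-defect {o} {κ} {g} {w p (lo p m + i)}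
        (same-zero (hull-pattern (on-hull i≤d) κ<k g∈) (defect-zero {o} {κ} {g} {X p m} eq))

      speed : ∃ (λ g → g ∈ closure (upTo k) × z o (X p m) ≡ g · z κ (X p m) × z o (X p m) ≡ g · z κ (X p m) × _) → _
      speed (shift e , g∈ , eqx , _) = inj₁ λ i i≤d → ℤ.+-injective
        (eq (z κ (w p (lo p m + i))) e (z κ (X p m)) (ℤ.+ i) (carry g∈ eqx i≤d) (move-o i≤d) eqx)
        where
        ring : ∀ a e → a ℤ.+ e ℤ.- e ≡ a
        ring = solve-∀
        ring′ : ∀ b e i → b ℤ.+ e ℤ.+ i ℤ.- e ≡ b ℤ.+ i
        ring′ = solve-∀
        eq : ∀ a e b i {oa ox} → oa ≡ a ℤ.+ e → oa ≡ ox ℤ.+ i → ox ≡ b ℤ.+ e → a ≡ b ℤ.+ i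
        eq a e b i refl h refl = trans (sym (ring a e)) (trans (cong (ℤ._- e) h) (ring′ b e i))
      speed (flip e , g∈ , eqx , _) = inj₂ λ i i≤d → ℤ.+-injective
        (eq (z κ (w p (lo p m + i))) e (z κ (X p m)) (ℤ.+ i) (carry g∈ eqx i≤d) (move-o i≤d) eqx)
        where
        ring : ∀ a e i → a ℤ.+ i ≡ e ℤ.- (e ℤ.- a) ℤ.+ i
        ring = solve-∀
        ring′ : ∀ b e i → e ℤ.- (e ℤ.- b ℤ.+ i) ℤ.+ i ≡ b
        ring′ = solve-∀
        eq : ∀ a e b i {oa ox} → oa ≡ e ℤ.- a → oa ≡ ox ℤ.+ i → ox ≡ e ℤ.- b → a ℤ.+ i ≡ b
        eq a e b i refl h refl = trans (ring a e i) (trans (cong (λ x → e ℤ.- x ℤ.+ i) h) (ring′ b e i))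

    private
      ℓ : ℕ → ℕ
      ℓ i = lev κ (w p (lo p m + i))
      open Sweep ℓ d
      start : ℓ 0 ≡ lev κ (X p m)
      start = cong (λ i → lev κ (w p i)) (+-identityʳ (lo p m))
      end : ℓ d ≡ lev κ (Y p m)
      end = cong (λ i → lev κ (w p i)) lo+d
      unit : UnitSpeed
      unit = [ (λ f → inj₁ λ i i≤d → trans (f i i≤d) (cong (_+ i) (sym start))) ,
               (λ f → inj₂ λ i i≤d → trans (f i i≤d) (sym start)) ]′ levels
      between : ∀ {r} → Active X Y K r p m → Between (ℓ 0) (ℓ d) r
      between {r} = subst₂ (λ a b → Between a b r) (sym start) (sym end)
      V≡ : ∀ {r} → Active X Y K r p m → V r p m ≡ w p (lo p m + index r)
      V≡ {r} act = cong (λ i → w p (lo p m + i)) (trans (cong (λ a → dist a r ⊓ d) (sym start))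
        (m≤n⇒m⊓n≡m (proj₁ (locate unit (between act)))))

    position : ∀ {r} → Active X Y K r p m → ∃ λ i → i ≤ L p × V r p m ≡ w p i
    position act = _ , withinL (proj₁ (locate unit (between act))) , V≡ act

    on-piece : ∀ {r} → Active X Y K r p m → OnPiece X Y K r p m (V r p m)
    on-piece {r} act = subst (OnPiece X Y K r p m) (sym (V≡ act))
      ( proj₂ (locate unit (between act))
      , trans (level-path p<l (lo p m) (index r) (withinL i≤d)) (cong (λ a → lev o (X p m) + dist a r) start)
      , on-hull i≤d
      , (λ eq → cong (w p) (trans (cong (lo p m +_) (trans (cong index (trans eq (sym start))) index-start)) (+-identityʳ _)))
      , (λ eq → cong (w p) (trans (cong (lo p m +_) (trans (cong index (trans eq (sym end))) (index-end unit))) lo+d)))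
      where
      i≤d : index r ≤ d
      i≤d = proj₁ (locate unit (between act))

    moves : ∀ {r} → Active X Y K r p m → Active X Y K (suc r) p m → E (V r p m) (V (suc r) p m)
    moves {r} act act′ = subst₂ E (sym (V≡ act)) (sym (V≡ act′)) (step (index-suc unit (between act) (between act′)))
      where
      i≤d : index r ≤ d
      i≤d = proj₁ (locate unit (between act))
      j≤d : index (suc r) ≤ d
      j≤d = proj₁ (locate unit (between act′))
      edge : ∀ {i j} → j ≡ suc i → j ≤ d → E (w p (lo p m + i)) (w p (lo p m + j))
      edge {i} refl j≤ = subst (λ j → E (w p (lo p m + i)) (w p j)) (sym (+-suc (lo p m) i))
        (proj₁ (forward p<l (subst (_≤ L p) (+-suc (lo p m) i) (withinL j≤))))
      step : index (suc r) ≡ suc (index r) ⊎ index r ≡ suc (index (suc r)) →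
             E (w p (lo p m + index r)) (w p (lo p m + index (suc r)))
      step (inj₁ eq) = edge eq j≤d
      step (inj₂ eq) = E-sym (w<n p<l (withinL j≤d)) (w<n p<l (withinL i≤d)) (edge eq i≤d)

    junction : Junction X Y K p m
    junction with Cut.lo-suc p m
    ... | inj₁ eq = inj₁ (cong (w p) eq)
    ... | inj₂ eq = inj₂ (subst (λ i → ForwardEdge o (Y p m) (w p i)) (sym eq)
      (forward p<l (subst (_≤ L p) eq (≤-trans (Cut.lo≤hi p (suc m)) (Cut.hi≤L p (suc m))))))

  separated : ∀ {p q} (p<l : p < l) (q<l : q < l) → ∀ m m′ {v} →
              Hull (c p) (X p m) (Y p m) v → Hull (c q) (X q m′) (Y q m′) v → K p m ≡ K q m′
  separated {p} {q} p<l q<l m m′ {v} h h′ = trans (representative-pattern id∈Θ (hull-pattern p<l m h))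
    (trans (representative-adjacent id∈Θ (c<k p<l) (c<k q<l) (proj₁ links) (proj₂ links))
      (sym (representative-pattern id∈Θ (hull-pattern q<l m′ h′))))
    where
    at : ∀ p q (p<l : toℕ p < l) (q<l : toℕ q < l) → Hull (c (toℕ p)) (X (toℕ p) m) (Y (toℕ p) m) v →
         Hull (c (toℕ q)) (X (toℕ q) m′) (Y (toℕ q) m′) v →
         Adjacent v (c (toℕ p)) (c (toℕ q)) × Adjacent v (c (toℕ q)) (c (toℕ p))
    at p q p<l q<l h h′ = adjacent-meet p q
      (one-sided-same {c (toℕ p)} {c (toℕ q)} {shift (Pair.γ p q)} {flip (Pair.δ p q)} {X (toℕ p) m} {v} (hull-pattern p<l m h (c<k q<l) (Θ⊆closure id∈Θ (upTo k) (γ∈Θ p q)))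
                      (hull-pattern p<l m h (c<k q<l) (Θ⊆closure id∈Θ (upTo k) (δ∈Θ p q)))
        (one-sided-p p q (≤-trans (Cut.lo≤hi (toℕ p) m) (Cut.hi≤L (toℕ p) m))))
      (one-sided-same {c (toℕ q)} {c (toℕ p)} {shift (ℤ.- Pair.γ p q)} {flip (Pair.δ p q)} {X (toℕ q) m′} {v} (hull-pattern q<l m′ h′ (c<k p<l) (Θ⊆closure id∈Θ (upTo k) (-γ∈Θ p q)))
                      (hull-pattern q<l m′ h′ (c<k p<l) (Θ⊆closure id∈Θ (upTo k) (δ∈Θ p q)))
        (one-sided-q p q (≤-trans (Cut.lo≤hi (toℕ q) m′) (Cut.hi≤L (toℕ q) m′))))
    links : Adjacent v (c p) (c q) × Adjacent v (c q) (c p)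
    links = subst₂ (λ p q → toℕ (fromℕ< p<l) ≡ p → toℕ (fromℕ< q<l) ≡ q → Adjacent v (c p) (c q) × Adjacent v (c q) (c p))
      (toℕ-fromℕ< p<l) (toℕ-fromℕ< q<l)
      (λ e e′ → at (fromℕ< p<l) (fromℕ< q<l) (toℕ<n _) (toℕ<n _)
        (subst (λ p → Hull (c p) (X p m) (Y p m) v) (sym (toℕ-fromℕ< p<l)) h)
        (subst (λ q → Hull (c q) (X q m′) (Y q m′) v) (sym (toℕ-fromℕ< q<l)) h′))
      (toℕ-fromℕ< p<l) (toℕ-fromℕ< q<l)

  certificate : Certificate
  certificate = record
    { X = X ; Y = Y ; K = K ; V = V
    ; static = (λ p p<l → subst (λ y → (w p 0 ≡ s p × w p y ≡ t p) ⊎ (w p 0 ≡ t p × w p y ≡ s p))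
                  (sym (Cut.hi-final p (value-bound (c p) (w p (L p))))) (ends p<l))
             , (λ p p<l m _ → junction p<l m)
             -- Holds vacuously: hulls of pieces with different new colours do not meet at all.
             , (λ p p<l q q<l _ m _ m′ _ κ≢ v _ h h′ → ⊥-elim (κ≢ (separated p<l q<l m m′ h h′)))
    ; valid = λ r _ →
        (λ p p<l m _ → (X<n p<l m , Y<n p<l m , V<n p<l m r , κ<k p<l m) , on-piece p<l m) ,
        (λ p p<l q q<l p≢q m _ m′ _ _ act act′ eq → clash p<l q<l p≢q (position p<l m act) (position q<l m′ act′) eq)
    ; move = λ r _ p p<l m _ → moves p<l m }
    where
    clash : ∀ {p q u v} → p < l → q < l → ¬ p ≡ q → (∃ λ i → i ≤ L p × u ≡ w p i) → (∃ λ j → j ≤ L q × v ≡ w q j) →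
            u ≡ v → Common p q u
    clash p<l q<l p≢q (i , i≤ , refl) (j , j≤ , refl) eq = shared p<l q<l p≢q i≤ j≤ eq

-- Solutions as sequences of vertex numbers.

extend : ∀ {A : Set} {m} → A → (Fin m → A) → ℕ → A
extend {m = m} d f p with p <? m
... | yes p<m = f (fromℕ< p<m)
... | no _    = d

extend-toℕ : ∀ {A : Set} {m} (d : A) (f : Fin m → A) i → extend d f (toℕ i) ≡ f i
extend-toℕ {m = m} d f i with toℕ i <? m
... | yes i<m = cong f (fromℕ<-toℕ i i<m)
... | no i≮m  = ⊥-elim (i≮m (toℕ<n i))

below : ∀ {m} (Q : ℕ → Set) → (∀ (i : Fin m) → Q (toℕ i)) → ∀ {i} → i < m → Q i
below Q f i<m = subst Q (toℕ-fromℕ< i<m) (f (fromℕ< i<m))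

module Completeness {k n l : ℕ} (I : Instance k n l) (M : ℕ)
  (M-large : suc (k * (suc (3 * (l * l)) ^ (2 ^ k)) * 2) ≤ M) where
  open CodedInstance I
  open Certificates n k l M Eᶜ levᶜ sᶜ tᶜ cᶜ

  level-close : ∀ i {x y} → Edge x y → level i x ≤ suc (level i y) × level i y ≤ suc (level i x)
  level-close i {x} {y} e =
    ≤-trans (m≤n+∣m-n∣ (level i x) (level i y)) (≤-trans (+-monoʳ-≤ _ small) (≤-reflexive (+-comm _ 1))) ,
    ≤-trans (m≤n+∣n-m∣ (level i y) (level i x)) (≤-trans (+-monoʳ-≤ _ small) (≤-reflexive (+-comm _ 1)))
    where
    small : ∣ level i x - level i y ∣ ≤ 1
    small = ≮⇒≥ λ big → no-jump i x y big e

  jump : ∀ {u v m} → m < k → u < n → v < n → Eᶜ u v → levᶜ m v ≤ suc (levᶜ m u) × levᶜ m u ≤ suc (levᶜ m v)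
  jump {u} {v} m<k u<n v<n e = subst₂ (λ a b → b ≤ suc a × a ≤ suc b) (lift u<n) (lift v<n)
    (let a , b = level-close _ (edge-from u<n v<n e) in b , a)
    where
    lift : ∀ {v} (v<n : v < n) → level (fromℕ< m<k) (fromℕ< v<n) ≡ levᶜ _ v
    lift v<n = sym (matrix-fromℕ< level m<k v<n)

  c<k : ∀ {p} → p < l → cᶜ p < k
  c<k = below (λ p → cᶜ p < k) λ p → subst (_< k) (sym (cᶜ≡ p)) (toℕ<n (c p))

  module _ (solution : HasSolution I) where
    private
      P : Fin l → Path graph
      P = proj₁ solution
      open module P p = Path (P p) using (vertex; source; target) renaming (length to len)

    L : ℕ → ℕ
    L = extend 0 len

    w : ℕ → ℕ → ℕ
    w = extend (λ _ → 0) λ p → array (toℕ ∘ vertex p)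

    L≡ : ∀ p → L (toℕ p) ≡ len p
    L≡ = extend-toℕ 0 len

    w≡ : ∀ p j → w (toℕ p) (toℕ j) ≡ toℕ (vertex p j)
    w≡ p j = trans (cong (λ f → f (toℕ j)) (extend-toℕ (λ _ → 0) (λ p → array (toℕ ∘ vertex p)) p)) (array-toℕ (toℕ ∘ vertex p) j)

    vertex-at : ∀ p {i} → i ≤ L (toℕ p) → ∃ λ j → toℕ j ≡ i × w (toℕ p) i ≡ toℕ (vertex p j)
    vertex-at p {i} i≤ = fromℕ< i< , toℕ-fromℕ< i< , trans (cong (w (toℕ p)) (sym (toℕ-fromℕ< i<))) (w≡ p (fromℕ< i<))
      where
      i< : i < suc (len p)
      i< = s≤s (subst (i ≤_) (L≡ p) i≤)

    w<n : ∀ {p i} → p < l → i ≤ L p → w p i < n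
    w<n p<l = below (λ p → ∀ i → i ≤ L p → w p i < n)
      (λ p i i≤ → let j , _ , eq = vertex-at p i≤ in subst (_< n) (sym eq) (toℕ<n (vertex p j))) p<l _

    forward : ∀ {p i} → p < l → i < L p → ForwardEdge (cᶜ p) (w p i) (w p (suc i))
    forward p<l = below (λ p → ∀ i → i < L p → ForwardEdge (cᶜ p) (w p i) (w p (suc i))) on-path p<l _
      where
      step : ∀ p j → ForwardEdge (toℕ (c p)) (toℕ (vertex p (inject₁ j))) (toℕ (vertex p (suc j)))
      step p j with proj₁ (proj₁ (proj₂ solution) p) j
      ... | (edge , close) , up = trans (matrix-toℕ (λ x y → bit (adj x y)) _ _) (T-bit edge) ,
        trans (matrix-toℕ level _ _) (trans (rise close up) (cong suc (sym (matrix-toℕ level _ _))))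
        where
        rise : ∀ {a b} → Consecutive a b → a ≤ b → b ≡ suc a
        rise (inj₁ eq) _ = sym eq
        rise (inj₂ eq) a≤b = ⊥-elim (<⇒≱ (≤-reflexive eq) a≤b)
      on-path : ∀ p i → i < L (toℕ p) → ForwardEdge (cᶜ (toℕ p)) (w (toℕ p) i) (w (toℕ p) (suc i))
      on-path p i i<L = subst (λ o → ForwardEdge o (w (toℕ p) i) (w (toℕ p) (suc i))) (sym (cᶜ≡ p))
        (subst₂ (ForwardEdge (toℕ (c p)))
          (trans (sym (w≡ p (inject₁ j))) (cong (w (toℕ p)) (trans (toℕ-inject₁ j) j≡)))
          (trans (sym (w≡ p (suc j))) (cong (w (toℕ p)) (cong suc j≡)))
          (step p j))
        where
        j : Fin (len p)
        j = fromℕ< (subst (i <_) (L≡ p) i<L)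
        j≡ : toℕ j ≡ i
        j≡ = toℕ-fromℕ< _

    source≡ : ∀ p → w (toℕ p) 0 ≡ toℕ (source p)
    source≡ p = w≡ p zero

    target≡ : ∀ p → w (toℕ p) (L (toℕ p)) ≡ toℕ (target p)
    target≡ p = trans (cong (w (toℕ p)) (trans (L≡ p) (sym (toℕ-fromℕ (len p))))) (w≡ p (fromℕ (len p)))

    s≡ : ∀ p → sᶜ (toℕ p) ≡ toℕ (s p)
    s≡ = array-toℕ (toℕ ∘ s)

    t≡ : ∀ p → tᶜ (toℕ p) ≡ toℕ (t p)
    t≡ = array-toℕ (toℕ ∘ t)

    joins : ∀ p → Path.Joins (P p) (s p) (t p)
    joins p = proj₂ (proj₁ (proj₂ solution) p)

    ends : ∀ {p} → p < l → (w p 0 ≡ sᶜ p × w p (L p) ≡ tᶜ p) ⊎ (w p 0 ≡ tᶜ p × w p (L p) ≡ sᶜ p)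
    ends = below _ λ p →
      [ (λ { (a , b) → inj₁ (trans (source≡ p) (trans (cong toℕ a) (sym (s≡ p))) , trans (target≡ p) (trans (cong toℕ b) (sym (t≡ p)))) }) ,
        (λ { (a , b) → inj₂ (trans (source≡ p) (trans (cong toℕ a) (sym (t≡ p))) , trans (target≡ p) (trans (cong toℕ b) (sym (s≡ p)))) }) ]′
      (joins p)

    terminal : ∀ p {v} → ¬ Path.InternalVertexOf (P p) v → Path.VertexOf (P p) v → toℕ v ≡ sᶜ (toℕ p) ⊎ toℕ v ≡ tᶜ (toℕ p)
    terminal p {v} ¬int on with v ≟ᶠ source p | v ≟ᶠ target p | joins p
    ... | no ≢src | no ≢tgt | _ = ⊥-elim (¬int (on , ≢src , ≢tgt))
    ... | yes eq | _ | inj₁ (a , _) = inj₁ (trans (cong toℕ (trans eq a)) (sym (s≡ p)))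
    ... | yes eq | _ | inj₂ (a , _) = inj₂ (trans (cong toℕ (trans eq a)) (sym (t≡ p)))
    ... | no _ | yes eq | inj₁ (_ , b) = inj₂ (trans (cong toℕ (trans eq b)) (sym (t≡ p)))
    ... | no _ | yes eq | inj₂ (_ , b) = inj₁ (trans (cong toℕ (trans eq b)) (sym (s≡ p)))

    shared : ∀ {p q i j} → p < l → q < l → ¬ p ≡ q → i ≤ L p → j ≤ L q → w p i ≡ w q j → Common p q (w p i)
    shared p<l q<l p≢q i≤ j≤ = below (λ p → ∀ {q} → q < l → ¬ p ≡ q → ∀ i j → i ≤ L p → j ≤ L q → w p i ≡ w q j → Common p q (w p i))
      (λ p → below (λ q → ¬ toℕ p ≡ q → ∀ i j → i ≤ L (toℕ p) → j ≤ L q → w (toℕ p) i ≡ w q j → Common (toℕ p) q (w (toℕ p) i))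
        λ q p≢q i j i≤ j≤ eq → meet p q p≢q (vertex-at p i≤) (vertex-at q j≤) eq) p<l q<l p≢q _ _ i≤ j≤
      where
      meet : ∀ p q → ¬ toℕ p ≡ toℕ q → ∀ {i j} → (∃ λ a → toℕ a ≡ i × w (toℕ p) i ≡ toℕ (vertex p a)) →
             (∃ λ b → toℕ b ≡ j × w (toℕ q) j ≡ toℕ (vertex q b)) → w (toℕ p) i ≡ w (toℕ q) j →
             Common (toℕ p) (toℕ q) (w (toℕ p) i)
      meet p q p≢q (a , _ , eqa) (b , _ , eqb) eq = subst (Common (toℕ p) (toℕ q)) (sym eqa)
        ( terminal p (λ int → proj₁ disjoint int onq) onp
        , terminal q (λ int → proj₂ disjoint int onp) onq)
        where
        disjoint = proj₂ (proj₂ solution) p q (λ p≡q → p≢q (cong toℕ p≡q)) (vertex p a)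
        onp : Path.VertexOf (P p) (vertex p a)
        onp = a , refl
        onq : Path.VertexOf (P q) (vertex p a)
        onq = b , toℕ-injective (trans (sym eqb) (trans (sym eq) eqa))

    certificate : Certificate
    certificate = Construct.certificate n k l M Eᶜ levᶜ sᶜ tᶜ cᶜ edge-sym
      (λ {u} {v} {m} → jump {u} {v} {m}) levᶜ<n c<k M-large L w w<n forward ends shared

-- Arithmetic of terms

pattern x0 = var zero
pattern x1 = var (suc zero)
pattern x2 = var (suc (suc zero))
pattern x3 = var (suc (suc (suc zero)))
pattern x4 = var (suc (suc (suc (suc zero))))
pattern x5 = var (suc (suc (suc (suc (suc zero)))))
pattern x6 = var (suc (suc (suc (suc (suc (suc zero))))))
pattern x7 = var (suc (suc (suc (suc (suc (suc (suc zero)))))))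
pattern x8 = var (suc (suc (suc (suc (suc (suc (suc (suc zero))))))))
-- Globals: 0 is n, 1 is l, 2 the cap, 3 the base b of the codes, 4 the number M of pieces, 5 the index of the
-- leading digit, 6 the current code.
pattern g0 = glob zero
pattern g1 = glob (suc zero)
pattern g2 = glob (suc (suc zero))
pattern g3 = glob (suc (suc (suc zero)))
pattern g4 = glob (suc (suc (suc (suc zero))))
pattern g5 = glob (suc (suc (suc (suc (suc zero)))))
pattern g6 = glob (suc (suc (suc (suc (suc (suc zero))))))
pattern gbase = suc (suc (suc zero))

-- Correct if the second factor is at most the cap.
mulT : Term 2
mulT = loop (lit 0) (x0 ∔ ite (x3 ∸′ x1) x2 (lit 0))

-- Correct if the divisor and the quotient are at most the cap.
quotT : Term 2
quotT = loop (lit 0) (ite (call mulT (x0 ∔ lit 1 ∷ x3 ∷ []) ∸′ x2) x0 (x0 ∔ lit 1))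

-- Digit x1 of x0 in base g3.
digitT : Term 2
digitT = call (x0 ∸′ call mulT (call quotT (x0 ∷ g3 ∷ []) ∷ g3 ∷ []))
  (loop x0 (ite (x3 ∸′ x1) (call quotT (x0 ∷ g3 ∷ [])) x0) ∷ [])

choose-suc : ∀ {c} a b → 0 < c → choose c a b ≡ a
choose-suc {suc c} a b _ = refl

-- A loop makes cap rounds even if the computation needs only j of them, so the body has to idle at
-- its final value h j.
fold-⊓ : ∀ f a j (h : ℕ → ℕ) → h 0 ≡ a → (∀ m → m < j → f (h m) m ≡ h (suc m)) → (∀ m → j ≤ m → f (h j) m ≡ h j) →
         ∀ m → fold f a m ≡ h (m ⊓ j)
fold-⊓ f a j h h0 grow stay zero = sym h0
fold-⊓ f a j h h0 grow stay (suc m) with ≤-total (suc m) j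
... | inj₁ m<j = trans (cong (λ x → f x m) (trans (fold-⊓ f a j h h0 grow stay m) (cong h (m≤n⇒m⊓n≡m (<⇒≤ m<j)))))
  (trans (grow m m<j) (cong h (sym (m≤n⇒m⊓n≡m m<j))))
... | inj₂ j≤1+m with m≤n⇒m<n∨m≡n j≤1+m
... | inj₂ refl = trans (cong (λ x → f x m) (trans (fold-⊓ f a j h h0 grow stay m) (cong h (m≤n⇒m⊓n≡m (n≤1+n m)))))
  (trans (grow m ≤-refl) (cong h (sym (m≤n⇒m⊓n≡m ≤-refl))))
... | inj₁ (s≤s j≤m) = trans (cong (λ x → f x m) (trans (fold-⊓ f a j h h0 grow stay m) (cong h (m≥n⇒m⊓n≡n j≤m))))
  (trans (stay m j≤m) (cong h (sym (m≥n⇒m⊓n≡n j≤1+m))))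

module _ (G : Fin 10 → ℕ) (A : ℕ → ℕ → ℕ) where

  mul-correct : ∀ x y → y ≤ G gcap → ⟦ G ⟧ A mulT (x ∷ y ∷ []) ≡ x * y
  mul-correct x y y≤ = trans
    (fold-⊓ (λ a j → a + choose (y ∸ j) x 0) 0 y (x *_) (*-zeroʳ x)
      (λ m m<y → trans (cong (x * m +_) (choose-suc x 0 (m<n⇒0<n∸m m<y))) (trans (+-comm _ x) (sym (*-suc x m))))
      (λ m y≤m → trans (cong (λ c → x * y + choose c x 0) (m≤n⇒m∸n≡0 y≤m)) (+-identityʳ _))
      (G gcap))
    (cong (x *_) (m≥n⇒m⊓n≡n y≤))

  -- The accumulator m rises while (m + 1) b ≤ r + b q, that is, while m < q.
  quot-correct : ∀ b r q → r < b → b ≤ G gcap → q ≤ G gcap → ⟦ G ⟧ A quotT (r + b * q ∷ b ∷ []) ≡ q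
  quot-correct b r q r<b b≤ q≤ = trans
    (fold-⊓ _ 0 q (λ m → m) refl
      (λ m m<q → trans (cong (λ c → choose c m (m + 1)) (trans (cong (_∸ (r + b * q)) (mul-correct (m + 1) b b≤))
        (m≤n⇒m∸n≡0 (≤-trans (≤-reflexive (trans (cong (_* b) (+-comm m 1)) (*-comm (suc m) b)))
          (≤-trans (*-monoʳ-≤ b m<q) (m≤n+m (b * q) r)))))) (+-comm m 1))
      (λ m _ → trans (cong (λ c → choose c q (q + 1)) (cong (_∸ (r + b * q)) (mul-correct (q + 1) b b≤)))
        (choose-suc q _ (m<n⇒0<n∸m (≤-trans (+-monoˡ-≤ (b * q) r<b)
          (≤-reflexive (trans (sym (*-suc b q)) (trans (*-comm b (suc q)) (cong (_* b) (+-comm 1 q)))))))))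
      (G gcap))
    (m≥n⇒m⊓n≡n q≤)

-- Numbers as sequences of digits.

code : ℕ → (ℕ → ℕ) → ℕ → ℕ
code b d zero    = 0
code b d (suc K) = d 0 + b * code b (d ∘ suc) K

code<b^K : ∀ b d K → (∀ i → i < K → d i < b) → code b d K < b ^ K
code<b^K b d zero    d<b = s≤s z≤n
code<b^K b d (suc K) d<b = ≤-trans (+-monoˡ-≤ _ (d<b 0 (s≤s z≤n)))
  (≤-trans (≤-reflexive (sym (*-suc b _))) (*-monoʳ-≤ b (code<b^K b (d ∘ suc) K (λ i → d<b (suc i) ∘ s≤s))))

code-top : ∀ b d K → code b d (suc K) ≡ code b d K + b ^ K * d K
code-top b d zero    = trans (+-comm (d 0) _) (trans (cong (_+ d 0) (*-zeroʳ b)) (sym (+-identityʳ (d 0))))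
code-top b d (suc K) = trans (cong (λ x → d 0 + b * x) (code-top b (d ∘ suc) K))
  (trans (cong (d 0 +_) (trans (*-distribˡ-+ b (code b (d ∘ suc) K) _) (cong (b * code b (d ∘ suc) K +_) (sym (*-assoc b (b ^ K) _)))))
    (sym (+-assoc (d 0) _ _)))

-- The leading digit decides. As this is the time, the codes of a sweep increase, whatever the
-- digits below it do.
code-< : ∀ b d e K → (∀ i → i < K → d i < b) → d K < e K → code b d (suc K) < code b e (suc K)
code-< b d e K d<b top = ≤-trans (s≤s (≤-reflexive (code-top b d K)))
  (≤-trans (+-monoˡ-≤ _ (code<b^K b d K d<b))
    (≤-trans (≤-reflexive (sym (*-suc (b ^ K) (d K))))
      (≤-trans (*-monoʳ-≤ (b ^ K) top) (≤-trans (m≤n+m _ (code b e K)) (≤-reflexive (sym (code-top b e K)))))))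

module _ (G : Fin 10 → ℕ) (A : ℕ → ℕ → ℕ) where

  -- After m divisions by the base, `rest m` is left, and its remainder is digit m. The bounds keep
  -- divisors, quotients and rounds within the cap.
  digit-correct : ∀ d K → (∀ i → i < K → d i < G gbase) → G gbase ≤ G gcap → G gbase ^ K ≤ G gcap → K ≤ G gcap →
                  ∀ j → j < K → ⟦ G ⟧ A digitT (code (G gbase) d K ∷ j ∷ []) ≡ d j
  digit-correct d K d<b b≤ b^K≤ K≤ j j<K = trans
    (cong (λ x → x ∸ ⟦ G ⟧ A mulT (⟦ G ⟧ A quotT (x ∷ b ∷ []) ∷ b ∷ [])) shifted)
    (trans (cong (b₀ ∸_) (trans (mul-correct G A _ b b≤) (trans (cong (_* b) (quotient j j<K)) (*-comm q b))))
      (m+n∸n≡m (d j) (b * q)))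
    where
    b : ℕ
    b = G gbase
    rest : ℕ → ℕ
    rest m = code b (λ i → d (m + i)) (K ∸ m)
    q : ℕ
    q = rest (suc j)
    rest-step : ∀ m → m < K → rest m ≡ d m + b * rest (suc m)
    rest-step m m<K = trans (cong (code b (λ i → d (m + i))) (+-∸-assoc 1 m<K))
      (cong₂ (λ x y → x + b * y) (cong d (+-identityʳ m)) (code-cong (K ∸ suc m) (λ i → cong d (+-suc m i))))
      where
      code-cong : ∀ K {d e : ℕ → ℕ} → (∀ i → d i ≡ e i) → code b d K ≡ code b e K
      code-cong zero    eq = refl
      code-cong (suc K) eq = cong₂ (λ x y → x + b * y) (eq 0) (code-cong K (eq ∘ suc))
    quotient : ∀ m → m < K → ⟦ G ⟧ A quotT (d m + b * rest (suc m) ∷ b ∷ []) ≡ rest (suc m)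
    quotient m m<K = quot-correct G A b (d m) (rest (suc m)) (d<b m m<K) b≤
      (≤-trans (<⇒≤ (code<b^K b _ (K ∸ suc m) (λ i i< → d<b (suc m + i) (≤-trans (+-monoʳ-< (suc m) i<) (≤-reflexive (m+[n∸m]≡n m<K))))))
        (≤-trans (^-monoʳ-≤ b {{>-nonZero (≤-trans (s≤s z≤n) (d<b m m<K))}} (m∸n≤m K (suc m))) b^K≤))
    b₀ : ℕ
    b₀ = d j + b * q
    shifted : fold (λ a i → choose (j ∸ i) (⟦ G ⟧ A quotT (a ∷ b ∷ [])) a) (code b d K) (G gcap) ≡ b₀
    shifted = trans (fold-⊓ (λ a i → choose (j ∸ i) (⟦ G ⟧ A quotT (a ∷ b ∷ [])) a) (code b d K) j rest refl
        (λ m m<j → trans (choose-suc _ _ (m<n⇒0<n∸m m<j))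
          (trans (cong (λ x → ⟦ G ⟧ A quotT (x ∷ b ∷ [])) (rest-step m (<-trans m<j j<K))) (quotient m (<-trans m<j j<K))))
        (λ m j≤m → cong (λ c → choose c (⟦ G ⟧ A quotT (rest j ∷ b ∷ [])) (rest j)) (m≤n⇒m∸n≡0 j≤m))
        (G gcap))
      (trans (cong rest (m≥n⇒m⊓n≡n (≤-trans (<⇒≤ j<K) K≤))) (rest-step j j<K))

-- Configurations are coded by numbers; X p m z is the start of piece m of path p in the code z, and R z is its time.
module Codes (k n l M : ℕ) (E : ℕ → ℕ → Set) (lev : ℕ → ℕ → ℕ) (s t c : ℕ → ℕ)
  (X Y K V : ℕ → ℕ → ℕ → ℕ) (R : ℕ → ℕ) where

  open Certificates n k l M E lev s t c public

  SameConstants : ℕ → ℕ → Set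
  SameConstants z′ z = ∀ p → p < l → ∀ m → m < M → X p m z′ ≡ X p m z × Y p m z′ ≡ Y p m z × K p m z′ ≡ K p m z

  ValidCode : ℕ → Set
  ValidCode z = Valid (λ p m → X p m z) (λ p m → Y p m z) (λ p m → K p m z) (R z) (λ p m → V p m z)

  MoveCode : ℕ → ℕ → Set
  MoveCode z′ z = Move (λ p m → X p m z′) (λ p m → Y p m z′) (λ p m → K p m z′) (R z′) (λ p m → V p m z′) (λ p m → V p m z)

  Init Final : ℕ → Set
  Init z  = R z ≡ 0 × ValidCode z × Static (λ p m → X p m z) (λ p m → Y p m z) (λ p m → K p m z)
  Final z = suc (R z) ≡ n

  Step : ℕ → ℕ → Set
  Step z′ z = R z ≡ suc (R z′) × ValidCode z × SameConstants z′ z × MoveCode z′ z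

  -- Because of z′ < z a single pass over the codes suffices; nothing is lost, as the time is their leading digit.
  data Reach : ℕ → Set where
    init : ∀ {z} → Init z → Reach z
    step : ∀ {z′ z} → z′ < z → Reach z′ → Step z′ z → Reach z

  subst₃ : (P : ℕ → ℕ → ℕ → Set) → ∀ {x y z x′ y′ z′} → x ≡ x′ → y ≡ y′ → z ≡ z′ → P x y z → P x′ y′ z′
  subst₃ P refl refl refl p = p

  Agree : (X Y K X′ Y′ K′ : ℕ → ℕ → ℕ) → Set
  Agree X Y K X′ Y′ K′ = ∀ p → p < l → ∀ m → m < M → X p m ≡ X′ p m × Y p m ≡ Y′ p m × K p m ≡ K′ p m

  agree-sym : ∀ {X Y K X′ Y′ K′} → Agree X Y K X′ Y′ K′ → Agree X′ Y′ K′ X Y K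
  agree-sym ag p p<l m m<M = let x , y , κ = ag p p<l m m<M in sym x , sym y , sym κ

  module _ {X Y K X′ Y′ K′ : ℕ → ℕ → ℕ} (ag : Agree X Y K X′ Y′ K′) where

    active-cong : ∀ {r p m} → p < l → m < M → Active X Y K r p m → Active X′ Y′ K′ r p m
    active-cong {r} p<l m<M = let x , y , κ = ag _ p<l _ m<M in subst₃ (λ x y κ → Between (lev κ x) (lev κ y) r) x y κ

    hull-cong : ∀ {o p m v} → p < l → m < M → Hull o (X p m) (Y p m) v → Hull o (X′ p m) (Y′ p m) v
    hull-cong {o} {v = v} p<l m<M = let x , y , κ = ag _ p<l _ m<M in subst₂ (λ x y → Hull o x y v) x y

  module _ {X Y K X′ Y′ K′ : ℕ → ℕ → ℕ} (ag : Agree X Y K X′ Y′ K′) where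

    static-cong : 0 < M → Static X Y K → Static X′ Y′ K′
    static-cong 0<M (ends , junctions , separate) =
      (λ p p<l → subst₂ (λ x y → (x ≡ s p × y ≡ t p) ⊎ (x ≡ t p × y ≡ s p))
        (proj₁ (ag p p<l 0 0<M)) (proj₁ (proj₂ (ag p p<l (M ∸ 1) (≤-reflexive (suc-pred M {{>-nonZero 0<M}}))))) (ends p p<l)) ,
      (λ p p<l m m< → subst₂ (λ y x → y ≡ x ⊎ ForwardEdge (c p) y x)
        (proj₁ (proj₂ (ag p p<l m (≤-trans m< (m∸n≤m M 1))))) (proj₁ (ag p p<l (suc m) (suc< m<))) (junctions p p<l m m<)) ,
      (λ p p<l q q<l p≢q m m<M m′ m′<M κ≢ v v<n h h′ → separate p p<l q q<l p≢q m m<M m′ m′<M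
        (λ eq → κ≢ (trans (sym (proj₂ (proj₂ (ag p p<l m m<M)))) (trans eq (proj₂ (proj₂ (ag q q<l m′ m′<M))))))
        v v<n (hull-cong (agree-sym ag) p<l m<M h) (hull-cong (agree-sym ag) q<l m′<M h′))
      where
      suc< : ∀ {m} → m < M ∸ 1 → suc m < M
      suc< m< = ≤-trans (s≤s m<) (≤-reflexive (suc-pred M {{>-nonZero 0<M}}))

    valid-cong : ∀ {r r′ V V′} → r ≡ r′ → (∀ p → p < l → ∀ m → m < M → V p m ≡ V′ p m) → Valid X Y K r V → Valid X′ Y′ K′ r′ V′
    valid-cong {r} {V = V} {V′} refl V≡ (loc , clash) =
      (λ p p<l m m<M → let x , y , κ = ag p p<l m m<M in
        subst (λ v → Located X′ Y′ K′ r (λ _ _ → v) p m) (V≡ p p<l m m<M)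
          (subst₃ (λ x y κ → Located (λ _ _ → x) (λ _ _ → y) (λ _ _ → κ) r V p m) x y κ (loc p p<l m m<M))) ,
      (λ p p<l q q<l p≢q m m<M m′ m′<M κ≡ act act′ eq → subst (Common p q) (V≡ p p<l m m<M)
        (clash p p<l q q<l p≢q m m<M m′ m′<M
          (trans (proj₂ (proj₂ (ag p p<l m m<M))) (trans κ≡ (sym (proj₂ (proj₂ (ag q q<l m′ m′<M))))))
          (active-cong (agree-sym ag) p<l m<M act) (active-cong (agree-sym ag) q<l m′<M act′)
          (trans (V≡ p p<l m m<M) (trans eq (sym (V≡ q q<l m′ m′<M))))))

    move-cong : ∀ {r r′ V V′ W W′} → r ≡ r′ → (∀ p → p < l → ∀ m → m < M → V p m ≡ V′ p m) →
                (∀ p → p < l → ∀ m → m < M → W p m ≡ W′ p m) → Move X Y K r V W → Move X′ Y′ K′ r′ V′ W′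
    move-cong refl V≡ W≡ move p p<l m m<M act act′ = subst₂ E (V≡ p p<l m m<M) (W≡ p p<l m m<M)
      (move p p<l m m<M (active-cong (agree-sym ag) p<l m<M act) (active-cong (agree-sym ag) p<l m<M act′))

  -- The chain of codes behind a reachable one, indexed by time. A step compares X, Y and K only
  -- with the code before it; along the whole chain this makes them constant.
  record History (z : ℕ) : Set where
    field
      Z     : ℕ → ℕ
      first : Init (Z 0)
      steps : ∀ r → r < R z → Step (Z r) (Z (suc r))
      last  : Z (R z) ≡ z

  history : ∀ {z} → Reach z → History z
  history {z} (init i) = record { Z = λ _ → z ; first = i ; steps = λ r r< → ⊥-elim (n≮0 (subst (r <_) (proj₁ i) r<)) ; last = refl }
  history {z} (step {z′} _ reach st) = record
    { Z = Z′ ; first = subst Init (sym (old z≤n)) first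
    ; steps = λ r r< → [ (λ r<R → subst₂ Step (sym (old (<⇒≤ r<R))) (sym (old r<R)) (steps r r<R)) ,
                         (λ { refl → subst₂ Step (sym (trans (old ≤-refl) last)) (sym new) st }) ]′
                       (m≤n⇒m<n∨m≡n (≤-pred (subst (r <_) R≡ r<)))
    ; last = trans (cong Z′ R≡) new }
    where
    open History (history reach)
    R≡ : R z ≡ suc (R z′)
    R≡ = proj₁ st
    Z′ : ℕ → ℕ
    Z′ r with r ≤? R z′
    ... | yes _ = Z r
    ... | no _  = z
    old : ∀ {r} → r ≤ R z′ → Z′ r ≡ Z r
    old {r} r≤ with r ≤? R z′
    ... | yes _ = refl
    ... | no r≰ = ⊥-elim (r≰ r≤)
    new : Z′ (suc (R z′)) ≡ z
    new with suc (R z′) ≤? R z′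
    ... | yes le = ⊥-elim (1+n≰n le)
    ... | no _   = refl

  module _ {z : ℕ} (reach : Reach z) (final : Final z) where
    open History (history reach)
    private
      within : ∀ {r} → r < n → r ≤ R z
      within r<n = ≤-pred (subst (_ <_) (sym final) r<n)

      time≡ : ∀ r → r ≤ R z → R (Z r) ≡ r
      time≡ zero    _  = proj₁ first
      time≡ (suc r) r< = trans (proj₁ (steps r r<)) (cong suc (time≡ r (<⇒≤ r<)))

      constants : ∀ r → r ≤ R z → Agree (λ p m → X p m (Z r)) (λ p m → Y p m (Z r)) (λ p m → K p m (Z r))
                                        (λ p m → X p m (Z 0)) (λ p m → Y p m (Z 0)) (λ p m → K p m (Z 0))
      constants zero    _  p _ m _ = refl , refl , refl
      constants (suc r) r< p p<l m m<M =
        let x , y , κ = proj₁ (proj₂ (proj₂ (steps r r<))) p p<l m m<M ; x′ , y′ , κ′ = constants r (<⇒≤ r<) p p<l m m<M in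
        trans (sym x) x′ , trans (sym y) y′ , trans (sym κ) κ′

      validCode : ∀ r → r ≤ R z → ValidCode (Z r)
      validCode zero    _  = proj₁ (proj₂ first)
      validCode (suc r) r< = proj₁ (proj₂ (steps r r<))

    reach-certificate : Certificate
    reach-certificate = record
      { X = λ p m → X p m (Z 0) ; Y = λ p m → Y p m (Z 0) ; K = λ p m → K p m (Z 0) ; V = λ r p m → V p m (Z r)
      ; static = proj₂ (proj₂ first)
      ; valid = λ r r<n → valid-cong (constants r (within r<n)) (time≡ r (within r<n)) (λ _ _ _ _ → refl) (validCode r (within r<n))
      ; move = λ r r<n → move-cong (constants r (<⇒≤ (within r<n))) (time≡ r (<⇒≤ (within r<n))) (λ _ _ _ _ → refl) (λ _ _ _ _ → refl)
          (proj₂ (proj₂ (proj₂ (steps r (within r<n))))) }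

  module _ (cert : Certificate) (0<M : 0 < M) (Z : ℕ → ℕ) where
    open Certificate cert using (static; valid; move) renaming (X to X₀; Y to Y₀; K to K₀; V to V₀)

    certificate-reach :
      (∀ r → r < n → Agree X₀ Y₀ K₀ (λ p m → X p m (Z r)) (λ p m → Y p m (Z r)) (λ p m → K p m (Z r))) →
      (∀ r → r < n → ∀ p → p < l → ∀ m → m < M → V₀ r p m ≡ V p m (Z r)) →
      (∀ r → r < n → r ≡ R (Z r)) → (∀ r → suc r < n → Z r < Z (suc r)) →
      ∀ r → r < n → Reach (Z r)
    certificate-reach ag V≡ R≡ Z< zero r<n = init
      ( sym (R≡ 0 r<n) , valid-cong (ag 0 r<n) (R≡ 0 r<n) (V≡ 0 r<n) (valid 0 r<n) , static-cong (ag 0 r<n) 0<M static)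
    certificate-reach ag V≡ R≡ Z< (suc r) r<n = step (Z< r r<n) (certificate-reach ag V≡ R≡ Z< r (<⇒≤ r<n))
      ( trans (sym (R≡ (suc r) r<n)) (cong suc (R≡ r (<⇒≤ r<n)))
      , valid-cong (ag (suc r) r<n) (R≡ (suc r) r<n) (V≡ (suc r) r<n) (valid (suc r) r<n)
      , (λ p p<l m m<M → let x , y , κ = ag r (<⇒≤ r<n) p p<l m m<M ; x′ , y′ , κ′ = ag (suc r) r<n p p<l m m<M in
          trans (sym x) x′ , trans (sym y) y′ , trans (sym κ) κ′)
      , move-cong (ag r (<⇒≤ r<n)) (R≡ r (<⇒≤ r<n)) (V≡ r (<⇒≤ r<n)) (V≡ (suc r) r<n) (move r r<n))

-- The predicates on codes of configurations

module Formulas (k : ℕ) (levelT edgeT : Term 2) (XT YT KT VT : Term 3) (timeT : Term 1) where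

  X′ Y′ K′ V′ : ∀ {v} → Term v → Term v → Term v → Term v
  X′ p m z = call XT (p ∷ m ∷ z ∷ [])
  Y′ p m z = call YT (p ∷ m ∷ z ∷ [])
  K′ p m z = call KT (p ∷ m ∷ z ∷ [])
  V′ p m z = call VT (p ∷ m ∷ z ∷ [])

  lev′ edge′ dist′ : ∀ {v} → Term v → Term v → Term v
  lev′ i v  = call levelT (i ∷ v ∷ [])
  edge′ u v = call edgeT (u ∷ v ∷ [])
  dist′ a r = (r ∸′ a) ∔ (a ∸′ r)

  s′ t′ c′ time′ : ∀ {v} → Term v → Term v
  s′ = arr 2
  t′ = arr 3
  c′ = arr 4
  time′ z = call timeT (z ∷ [])

  n′ l′ M′ : ∀ {v} → Term v
  n′ = g0
  l′ = g1
  M′ = g4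

  betweenT coneT commonT forwardT junctionT separatedT inRangeT moveT : Term 3
  hullT activeT locatedT noClashT : Term 4
  endsT validT sameT stepT : Term 2
  staticT initT finalT : Term 1
  onPieceT : Term 5

  betweenT = (x0 ≤′ x2 ∧′ x2 ≤′ x1) ∨′ (x1 ≤′ x2 ∧′ x2 ≤′ x0)

  coneT = all (lit k) ((lev′ x1 x4 ∔ lev′ x2 x3 ≤′ lev′ x2 x4 ∔ lev′ x1 x3) ∧′
                       (lev′ x1 x3 ∔ lev′ x2 x3 ≤′ lev′ x1 x4 ∔ lev′ x2 x4))

  hullT = call coneT (x0 ∷ x1 ∷ x3 ∷ []) ∧′ call coneT (x0 ∷ x3 ∷ x2 ∷ [])

  commonT = (x2 ≡′ s′ x0 ∨′ x2 ≡′ t′ x0) ∧′ (x2 ≡′ s′ x1 ∨′ x2 ≡′ t′ x1)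

  forwardT = edge′ x1 x2 ∧′ lev′ x0 x2 ≡′ lit 1 ∔ lev′ x0 x1

  endsT = (X′ x0 (lit 0) x1 ≡′ s′ x0 ∧′ Y′ x0 (M′ ∸′ lit 1) x1 ≡′ t′ x0) ∨′
          (X′ x0 (lit 0) x1 ≡′ t′ x0 ∧′ Y′ x0 (M′ ∸′ lit 1) x1 ≡′ s′ x0)

  junctionT = Y′ x0 x1 x2 ≡′ X′ x0 (lit 1 ∔ x1) x2 ∨′
              call forwardT (c′ x0 ∷ Y′ x0 x1 x2 ∷ X′ x0 (lit 1 ∔ x1) x2 ∷ [])

  -- With arguments p, q and z, the variables under two quantifiers are m′ = `x1`, m = `x3`, p =
  -- `x4`, q = `x5` and z = `x6`. Under the third one all indices grow by two, and v is `x1`.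
  separatedT = all M′ (all M′ (not′ (K′ x4 x3 x6 ≡′ K′ x5 x1 x6) ⇒′ all n′
    (call hullT (c′ x6 ∷ X′ x6 x5 x8 ∷ Y′ x6 x5 x8 ∷ x1 ∷ []) ⇒′
     call hullT (c′ x7 ∷ X′ x7 x3 x8 ∷ Y′ x7 x3 x8 ∷ x1 ∷ []) ⇒′
     call commonT (x6 ∷ x7 ∷ x1 ∷ []))))

  staticT = all l′ (call endsT (x1 ∷ x2 ∷ [])) ∧′
    all l′ (all (M′ ∸′ lit 1) (call junctionT (x3 ∷ x1 ∷ x4 ∷ []))) ∧′
    all l′ (all l′ (not′ (x3 ≡′ x1) ⇒′ call separatedT (x3 ∷ x1 ∷ x4 ∷ [])))

  -- Arguments: time, path, piece, code.
  activeT = call betweenT (lev′ (K′ x1 x2 x3) (X′ x1 x2 x3) ∷ lev′ (K′ x1 x2 x3) (Y′ x1 x2 x3) ∷ x0 ∷ [])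

  -- Arguments: time, path, piece, vertex, code.
  onPieceT = lev′ (K′ x1 x2 x4) x3 ≡′ x0 ∧′
    lev′ (c′ x1) x3 ≡′ lev′ (c′ x1) (X′ x1 x2 x4) ∔ dist′ (lev′ (K′ x1 x2 x4) (X′ x1 x2 x4)) x0 ∧′
    call hullT (c′ x1 ∷ X′ x1 x2 x4 ∷ Y′ x1 x2 x4 ∷ x3 ∷ []) ∧′
    (x0 ≡′ lev′ (K′ x1 x2 x4) (X′ x1 x2 x4) ⇒′ x3 ≡′ X′ x1 x2 x4) ∧′
    (x0 ≡′ lev′ (K′ x1 x2 x4) (Y′ x1 x2 x4) ⇒′ x3 ≡′ Y′ x1 x2 x4)

  inRangeT = X′ x0 x1 x2 <′ n′ ∧′ Y′ x0 x1 x2 <′ n′ ∧′ V′ x0 x1 x2 <′ n′ ∧′ K′ x0 x1 x2 <′ lit k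

  locatedT = call inRangeT (x1 ∷ x2 ∷ x3 ∷ []) ∧′
    (call activeT (x0 ∷ x1 ∷ x2 ∷ x3 ∷ []) ⇒′ call onPieceT (x0 ∷ x1 ∷ x2 ∷ V′ x1 x2 x3 ∷ x3 ∷ []))

  noClashT = all M′ (all M′ (K′ x5 x3 x7 ≡′ K′ x6 x1 x7 ⇒′
    call activeT (x4 ∷ x5 ∷ x3 ∷ x7 ∷ []) ⇒′ call activeT (x4 ∷ x6 ∷ x1 ∷ x7 ∷ []) ⇒′
    V′ x5 x3 x7 ≡′ V′ x6 x1 x7 ⇒′ call commonT (x5 ∷ x6 ∷ V′ x5 x3 x7 ∷ [])))

  validT = all l′ (all M′ (call locatedT (x4 ∷ x3 ∷ x1 ∷ x5 ∷ []))) ∧′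
    all l′ (all l′ (not′ (x3 ≡′ x1) ⇒′ call noClashT (x4 ∷ x3 ∷ x1 ∷ x5 ∷ [])))

  moveT = all l′ (all M′ (call activeT (x4 ∷ x3 ∷ x1 ∷ x5 ∷ []) ⇒′
    call activeT (lit 1 ∔ x4 ∷ x3 ∷ x1 ∷ x5 ∷ []) ⇒′ edge′ (V′ x3 x1 x5) (V′ x3 x1 x6)))

  sameT = all l′ (all M′ (X′ x3 x1 x4 ≡′ X′ x3 x1 x5 ∧′ Y′ x3 x1 x4 ≡′ Y′ x3 x1 x5 ∧′ K′ x3 x1 x4 ≡′ K′ x3 x1 x5))

  initT = time′ x0 ≡′ lit 0 ∧′ call validT (time′ x0 ∷ x0 ∷ []) ∧′ call staticT (x0 ∷ [])

  stepT = time′ x1 ≡′ lit 1 ∔ time′ x0 ∧′ call validT (time′ x1 ∷ x1 ∷ []) ∧′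
    call sameT (x0 ∷ x1 ∷ []) ∧′ call moveT (time′ x0 ∷ x0 ∷ x1 ∷ [])

  finalT = lit 1 ∔ time′ x0 ≡′ n′

  -- The fields of a code enter only through their values, so the formulas are verified without
  -- regard to the extraction of digits.
  module Truths (G : Fin 10 → ℕ) (A : ℕ → ℕ → ℕ)
    (E : ℕ → ℕ → Set) (lev : ℕ → ℕ → ℕ) (s t c : ℕ → ℕ) (X Y K V : ℕ → ℕ → ℕ → ℕ) (R : ℕ → ℕ)
    (n≤ : G zero ≤ G gcap) (l≤ : G (suc zero) ≤ G gcap) (M≤ : G (suc (suc (suc (suc zero)))) ≤ G gcap) (k≤ : k ≤ G gcap)
    (lev≡ : ∀ i v → ⟦ G ⟧ A levelT (i ∷ v ∷ []) ≡ lev i v)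
    (truth-E : ∀ u v → Truth (⟦ G ⟧ A edgeT (u ∷ v ∷ [])) (E u v))
    (s≡ : ∀ p → A 2 p ≡ s p) (t≡ : ∀ p → A 3 p ≡ t p) (c≡ : ∀ p → A 4 p ≡ c p)
    (X≡ : ∀ p m z → ⟦ G ⟧ A XT (p ∷ m ∷ z ∷ []) ≡ X p m z) (Y≡ : ∀ p m z → ⟦ G ⟧ A YT (p ∷ m ∷ z ∷ []) ≡ Y p m z)
    (K≡ : ∀ p m z → ⟦ G ⟧ A KT (p ∷ m ∷ z ∷ []) ≡ K p m z) (V≡ : ∀ p m z → ⟦ G ⟧ A VT (p ∷ m ∷ z ∷ []) ≡ V p m z)
    (R≡ : ∀ z → ⟦ G ⟧ A timeT (z ∷ []) ≡ R z) where

    n l M : ℕ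
    n = G zero
    l = G (suc zero)
    M = G (suc (suc (suc (suc zero))))

    open Codes k n l M E lev s t c X Y K V R

    lev= : ∀ {i v i′ v′} → i ≡ i′ → v ≡ v′ → ⟦ G ⟧ A levelT (i ∷ v ∷ []) ≡ lev i′ v′
    lev= refl refl = lev≡ _ _

    M∸1≤ : M ∸ 1 ≤ G gcap
    M∸1≤ = ≤-trans (m∸n≤m M 1) M≤

    truth-edge : ∀ {u v u′ v′} → u ≡ u′ → v ≡ v′ → Truth (⟦ G ⟧ A edgeT (u ∷ v ∷ [])) (E u′ v′)
    truth-edge refl refl = truth-E _ _

    truth-between : ∀ {a b r a′ b′ r′} → a ≡ a′ → b ≡ b′ → r ≡ r′ → Truth (⟦ G ⟧ A betweenT (a ∷ b ∷ r ∷ [])) (Between a′ b′ r′)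
    truth-between a b r = truth-∨ (truth-∧ (truth-≤ a r) (truth-≤ r b)) (truth-∧ (truth-≤ b r) (truth-≤ r a))

    truth-cone : ∀ {o u v o′ u′ v′} → o ≡ o′ → u ≡ u′ → v ≡ v′ → Truth (⟦ G ⟧ A coneT (o ∷ u ∷ v ∷ [])) (Cone o′ u′ v′)
    truth-cone {o} {u} {v} refl refl refl = truth-∀ k≤ λ _ m _ →
      truth-∧ (truth-≤ (cong₂ _+_ (lev≡ m v) (lev≡ o u)) (cong₂ _+_ (lev≡ o v) (lev≡ m u)))
              (truth-≤ (cong₂ _+_ (lev≡ m u) (lev≡ o u)) (cong₂ _+_ (lev≡ m v) (lev≡ o v)))

    truth-hull : ∀ {o x y v o′ x′ y′ v′} → o ≡ o′ → x ≡ x′ → y ≡ y′ → v ≡ v′ →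
                 Truth (⟦ G ⟧ A hullT (o ∷ x ∷ y ∷ v ∷ [])) (Hull o′ x′ y′ v′)
    truth-hull o x y v = truth-∧ (truth-cone o x v) (truth-cone o v y)

    truth-common : ∀ p q {v v′} → v ≡ v′ → Truth (⟦ G ⟧ A commonT (p ∷ q ∷ v ∷ [])) (Common p q v′)
    truth-common p q v = truth-∧ (truth-∨ (truth-≡ v (s≡ p)) (truth-≡ v (t≡ p))) (truth-∨ (truth-≡ v (s≡ q)) (truth-≡ v (t≡ q)))

    truth-forward : ∀ {o u v o′ u′ v′} → o ≡ o′ → u ≡ u′ → v ≡ v′ → Truth (⟦ G ⟧ A forwardT (o ∷ u ∷ v ∷ [])) (ForwardEdge o′ u′ v′)
    truth-forward o u v = truth-∧ (truth-edge u v) (truth-≡ (lev= o v) (cong suc (lev= o u)))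

    module _ (z : ℕ) where

      Xᶻ Yᶻ Kᶻ Vᶻ : ℕ → ℕ → ℕ
      Xᶻ p m = X p m z
      Yᶻ p m = Y p m z
      Kᶻ p m = K p m z
      Vᶻ p m = V p m z

      truth-ends : ∀ p → Truth (⟦ G ⟧ A endsT (p ∷ z ∷ [])) (Ends Xᶻ Yᶻ Kᶻ p)
      truth-ends p = truth-∨ (truth-∧ (truth-≡ (X≡ p 0 z) (s≡ p)) (truth-≡ (Y≡ p (M ∸ 1) z) (t≡ p)))
                             (truth-∧ (truth-≡ (X≡ p 0 z) (t≡ p)) (truth-≡ (Y≡ p (M ∸ 1) z) (s≡ p)))

      truth-junction : ∀ p m → Truth (⟦ G ⟧ A junctionT (p ∷ m ∷ z ∷ [])) (Junction Xᶻ Yᶻ Kᶻ p m)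
      truth-junction p m = truth-∨ (truth-≡ (Y≡ p m z) (X≡ p (suc m) z)) (truth-forward (c≡ p) (Y≡ p m z) (X≡ p (suc m) z))

      truth-separated : ∀ p q → Truth (⟦ G ⟧ A separatedT (p ∷ q ∷ z ∷ [])) (Separated Xᶻ Yᶻ Kᶻ p q)
      truth-separated p q = truth-∀ M≤ λ _ m _ → truth-∀ M≤ λ _ m′ _ →
        truth-⇒ (truth-¬ (truth-≡ (K≡ p m z) (K≡ q m′ z))) (truth-∀ n≤ λ _ v _ →
          truth-⇒ (truth-hull (c≡ p) (X≡ p m z) (Y≡ p m z) (refl {x = v}))
            (truth-⇒ (truth-hull (c≡ q) (X≡ q m′ z) (Y≡ q m′ z) (refl {x = v})) (truth-common p q (refl {x = v}))))

      truth-static : Truth (⟦ G ⟧ A staticT (z ∷ [])) (Static Xᶻ Yᶻ Kᶻ)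
      truth-static = truth-∧ (truth-∀ l≤ λ _ p _ → truth-ends p)
        (truth-∧ (truth-∀ l≤ λ _ p _ → truth-∀ M∸1≤ λ _ m _ → truth-junction p m)
          (truth-∀ l≤ λ _ p _ → truth-∀ l≤ λ _ q _ → truth-⇒ (truth-¬ (truth-≡ (refl {x = p}) (refl {x = q}))) (truth-separated p q)))

      truth-active : ∀ {r r′} → r ≡ r′ → ∀ p m → Truth (⟦ G ⟧ A activeT (r ∷ p ∷ m ∷ z ∷ [])) (Active Xᶻ Yᶻ Kᶻ r′ p m)
      truth-active r p m = truth-between (lev= (K≡ p m z) (X≡ p m z)) (lev= (K≡ p m z) (Y≡ p m z)) r

      truth-onPiece : ∀ {r r′ v v′} → r ≡ r′ → ∀ p m → v ≡ v′ →
                      Truth (⟦ G ⟧ A onPieceT (r ∷ p ∷ m ∷ v ∷ z ∷ [])) (OnPiece Xᶻ Yᶻ Kᶻ r′ p m v′)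
      truth-onPiece r p m v =
        truth-∧ (truth-≡ (lev= (K≡ p m z) v) r)
          (truth-∧ (truth-≡ (lev= (c≡ p) v) (cong₂ _+_ (lev= (c≡ p) (X≡ p m z))
                     (cong₂ dist (lev= (K≡ p m z) (X≡ p m z)) r)))
            (truth-∧ (truth-hull (c≡ p) (X≡ p m z) (Y≡ p m z) v)
              (truth-∧ (truth-⇒ (truth-≡ r (lev= (K≡ p m z) (X≡ p m z))) (truth-≡ v (X≡ p m z)))
                       (truth-⇒ (truth-≡ r (lev= (K≡ p m z) (Y≡ p m z))) (truth-≡ v (Y≡ p m z))))))

      truth-located : ∀ {r r′} → r ≡ r′ → ∀ p m → Truth (⟦ G ⟧ A locatedT (r ∷ p ∷ m ∷ z ∷ [])) (Located Xᶻ Yᶻ Kᶻ r′ Vᶻ p m)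
      truth-located r p m = truth-∧
        (truth-∧ (below′ (X≡ p m z)) (truth-∧ (below′ (Y≡ p m z)) (truth-∧ (below′ (V≡ p m z)) (truth-≤ (cong suc (K≡ p m z)) refl))))
        (truth-⇒ (truth-active r p m) (truth-onPiece r p m (V≡ p m z)))
        where
        below′ : ∀ {x x′} → x ≡ x′ → Truth (choose (suc x ∸ n) 0 1) (x′ < n)
        below′ eq = truth-≤ (cong suc eq) refl

      truth-noClash : ∀ {r r′} → r ≡ r′ → ∀ p q → Truth (⟦ G ⟧ A noClashT (r ∷ p ∷ q ∷ z ∷ [])) (NoClash Xᶻ Yᶻ Kᶻ r′ Vᶻ p q)
      truth-noClash r p q = truth-∀ M≤ λ _ m _ → truth-∀ M≤ λ _ m′ _ →
        truth-⇒ (truth-≡ (K≡ p m z) (K≡ q m′ z)) (truth-⇒ (truth-active r p m) (truth-⇒ (truth-active r q m′)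
          (truth-⇒ (truth-≡ (V≡ p m z) (V≡ q m′ z)) (truth-common p q (V≡ p m z)))))

      truth-valid : ∀ {r r′} → r ≡ r′ → Truth (⟦ G ⟧ A validT (r ∷ z ∷ [])) (Valid Xᶻ Yᶻ Kᶻ r′ Vᶻ)
      truth-valid r = truth-∧ (truth-∀ l≤ λ _ p _ → truth-∀ M≤ λ _ m _ → truth-located r p m)
        (truth-∀ l≤ λ _ p _ → truth-∀ l≤ λ _ q _ → truth-⇒ (truth-¬ (truth-≡ (refl {x = p}) (refl {x = q}))) (truth-noClash r p q))

      truth-init : Truth (⟦ G ⟧ A initT (z ∷ [])) (Init z)
      truth-init = truth-∧ (truth-≡ (R≡ z) (refl {x = 0})) (truth-∧ (truth-valid (R≡ z)) truth-static)

      truth-final : Truth (⟦ G ⟧ A finalT (z ∷ [])) (Final z)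
      truth-final = truth-≡ (cong suc (R≡ z)) (refl {x = n})

    truth-step : ∀ z′ z → Truth (⟦ G ⟧ A stepT (z′ ∷ z ∷ [])) (Step z′ z)
    truth-step z′ z = truth-∧ (truth-≡ (R≡ z) (cong suc (R≡ z′))) (truth-∧ (truth-valid z (R≡ z)) (truth-∧
      (truth-∀ l≤ λ _ p _ → truth-∀ M≤ λ _ m _ →
        truth-∧ (truth-≡ (X≡ p m z′) (X≡ p m z)) (truth-∧ (truth-≡ (Y≡ p m z′) (Y≡ p m z)) (truth-≡ (K≡ p m z′) (K≡ p m z))))
      (truth-∀ l≤ λ _ p _ → truth-∀ M≤ λ _ m _ → truth-⇒ (truth-active z′ (R≡ z′) p m)
        (truth-⇒ (truth-active z′ (cong suc (R≡ z′)) p m) (truth-edge (V≡ p m z′) (V≡ p m z))))))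

-- Written so that its value is `4 * x` by computation; 4 is the number of fields X, Y, K and V of a
-- piece.
quadT : Term 1
quadT = x0 ∔ (x0 ∔ (x0 ∔ (x0 ∔ lit 0)))

levelT edgeT : Term 2
levelT = arr 1 (call mulT (x0 ∷ g0 ∷ []) ∔ x1)
edgeT  = arr 0 (call mulT (x0 ∷ g0 ∷ []) ∔ x1) ≡′ lit 1

-- Field f of piece m of path p is digit 4 (p M + m) + f. The time comes after all l M pieces, as
-- digit 4 M l, the value of global 5.
fieldT : ℕ → Term 3
fieldT f = call digitT (x2 ∷ call quadT ((call mulT (x0 ∷ g4 ∷ []) ∔ x1) ∷ []) ∔ lit f ∷ [])

timeT : Term 1
timeT = call digitT (x0 ∷ g5 ∷ [])

-- The table of reachable codes.

module Tables (k : ℕ) where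
  open Formulas k levelT edgeT (fieldT 0) (fieldT 1) (fieldT 2) (fieldT 3) timeT public

  entryT answerT : Term 0
  entryT  = call initT (g6 ∷ []) ∨′ ex g6 (arr 5 x1 ∧′ call stepT (x1 ∷ g6 ∷ []))
  answerT = ex g2 (arr 5 x1 ∧′ call finalT (x1 ∷ []))

-- `Truth` again, but in `Set`, where the invariant of `fill` has to live.
Settled : ℕ → Set → Set
Settled x P = (x ≡ 1 × P) ⊎ (x ≡ 0 × ¬ P)

settle : ∀ {x P} → Truth x P → Settled x P
settle (holds p)  = inj₁ (refl , p)
settle (fails ¬p) = inj₂ (refl , ¬p)

settled-truth : ∀ {x P} → Settled x P → Truth x P
settled-truth (inj₁ (refl , p))  = holds p
settled-truth (inj₂ (refl , ¬p)) = fails ¬p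

module Search {k n l : ℕ} (I : Instance k n l) (M K b B : ℕ)
  (M-large : suc (k * (suc (3 * (l * l)) ^ (2 ^ k)) * 2) ≤ M) (K≡ : K ≡ l * M * 4)
  (n≤b : n ≤ b) (k≤b : k ≤ b) (b≤B : b ≤ B) (b^K≤B : b ^ suc K ≤ B) (K≤B : suc K ≤ B) (l≤B : l ≤ B) (M≤B : M ≤ B)
  (0<n : 0 < n) where
  open Tables k
  open CodedInstance I

  A₀ : ℕ → ℕ → ℕ
  A₀ = arrs (encode I)

  globals₀ : Vec ℕ 10
  globals₀ = n ∷ l ∷ B ∷ b ∷ M ∷ K ∷ 0 ∷ 0 ∷ 0 ∷ 0 ∷ []

  0<M : 0 < M
  0<M = ≤-trans (s≤s z≤n) M-large

  field′ : ℕ → ℕ → ℕ → ℕ → ℕ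
  field′ f p m z = ⟦ lookup globals₀ ⟧ A₀ (fieldT f) (p ∷ m ∷ z ∷ [])

  time″ : ℕ → ℕ
  time″ z = ⟦ lookup globals₀ ⟧ A₀ timeT (z ∷ [])

  open Codes k n l M Eᶜ levᶜ sᶜ tᶜ cᶜ (field′ 0) (field′ 1) (field′ 2) (field′ 3) time″

  record SameInput (A : ℕ → ℕ → ℕ) : Set where
    field
      edges  : A 0 ≡ A₀ 0
      levels : A 1 ≡ A₀ 1
      ss     : A 2 ≡ A₀ 2
      ts     : A 3 ≡ A₀ 3
      cs     : A 4 ≡ A₀ 4

  module _ {A : ℕ → ℕ → ℕ} (same : SameInput A) (z₀ : ℕ) where
    private
      G : Fin 10 → ℕ
      G = lookup (globals₀ [ gz ]← z₀)

      address : ∀ u v → ⟦ G ⟧ A mulT (u ∷ n ∷ []) + v ≡ n * u + v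
      address u v = cong (_+ v) (trans (mul-correct G A u n (≤-trans n≤b b≤B)) (*-comm u n))

      truth-E : ∀ u v → Truth (⟦ G ⟧ A edgeT (u ∷ v ∷ [])) (Eᶜ u v)
      truth-E u v = truth-≡ (trans (cong (A 0) (address u v)) (cong (λ f → f (n * u + v)) (SameInput.edges same))) (refl {x = 1})

    module T = Truths G A Eᶜ levᶜ sᶜ tᶜ cᶜ (field′ 0) (field′ 1) (field′ 2) (field′ 3) time″
      (≤-trans n≤b b≤B) l≤B M≤B (≤-trans k≤b b≤B)
      (λ i v → trans (cong (A 1) (address i v)) (cong (λ f → f (n * i + v)) (SameInput.levels same)))
      truth-E
      (λ p → cong (λ f → f p) (SameInput.ss same)) (λ p → cong (λ f → f p) (SameInput.ts same)) (λ p → cong (λ f → f p) (SameInput.cs same))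
      -- The extraction of digits reads neither global 6 nor any array, so the fields have the same
      -- values for every z₀ and A.
      (λ _ _ _ → refl) (λ _ _ _ → refl) (λ _ _ _ → refl) (λ _ _ _ → refl) (λ _ → refl)

  Inv : ℕ → (ℕ → ℕ → ℕ) → Set
  Inv z A = SameInput A × (∀ y → y < z → Settled (A 5 y) (Reach y))

  inv-start : Inv 0 A₀
  inv-start = record { edges = refl ; levels = refl ; ss = refl ; ts = refl ; cs = refl } , λ _ ()

  truth-entry : ∀ {z A} → z < B → Inv z A → Truth (⟦ lookup (globals₀ [ gz ]← z) ⟧ A entryT []) (Reach z)
  truth-entry {z} {A} z<B (same , settled) = truth-map
    [ init , (λ { (y , y<z , r , st) → step y<z r st }) ]′
    (λ { (init i) → inj₁ i ; (step y<z r st) → inj₂ (_ , y<z , r , st) })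
    (truth-∨ (T.truth-init same z z)
      (truth-∃ (<⇒≤ z<B) λ _ y y<z → truth-∧ (settled-truth (settled y y<z)) (T.truth-step same z y z)))

  settle-next : ∀ {z A} v → Truth v (Reach z) → Inv z A → Inv (suc z) (A [ 5 ↦ A 5 [ z ↦ v ] ])
  settle-next {z} {A} v truth (same , settled) =
    record { SameInput same } ,
    λ y y< → [ (λ y<z → subst (λ x → Settled x (Reach y)) (sym (upd-other (A 5) z v (<⇒≢ y<z))) (settled y y<z)) ,
               (λ { refl → subst (λ x → Settled x (Reach z)) (sym (upd-same (A 5) z v)) (settle truth) }) ]′
             (m≤n⇒m<n∨m≡n (≤-pred y<))

  inv-step : ∀ z A → z < B → Inv z A → Inv (suc z) (A [ 5 ↦ A 5 [ z ↦ ⟦ lookup (globals₀ [ gz ]← z) ⟧ A entryT [] ] ])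
  inv-step z A z<B inv = settle-next _ (truth-entry z<B inv) inv

  Found : Set
  Found = ∃ λ z → z < B × Reach z × Final z

  truth-answer : ∀ {A} z₀ → Inv B A → Truth (⟦ lookup (globals₀ [ gz ]← z₀) ⟧ A answerT []) Found
  truth-answer z₀ (same , settled) = truth-∃ ≤-refl λ _ z z<B → truth-∧ (settled-truth (settled z z<B)) (T.truth-final same z₀ z)

  found-solution : Found → HasSolution I
  found-solution (z , _ , reach , final) = Soundness.solution I M 0<M (reach-certificate reach final)

  module _ (cert : Certificate) where
    open Certificate cert using (valid) renaming (X to X₀; Y to Y₀; K to K₀; V to V₀)

    entry : ℕ → Fin 4 → ℕ → ℕ → ℕ
    entry r zero                   p m = X₀ p m
    entry r (suc zero)             p m = Y₀ p m
    entry r (suc (suc zero))       p m = K₀ p m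
    entry r (suc (suc (suc zero))) p m = V₀ r p m

    slot : ℕ → Fin (l * M * 4) → ℕ
    slot r i = uncurry (λ pm f → uncurry (λ p m → entry r f (toℕ p) (toℕ m)) (remQuot {l} M pm)) (remQuot {l * M} 4 i)

    -- The default value of `extend` is the time r. It becomes digit K, as K = l · M · 4 is the
    -- first index beyond the slots.
    digits : ℕ → ℕ → ℕ
    digits r = extend r (slot r)

    codeAt : ℕ → ℕ
    codeAt r = code b (digits r) (suc K)

    digits-slot : ∀ r (p : Fin l) (m : Fin M) f → digits r (4 * (M * toℕ p + toℕ m) + toℕ f) ≡ entry r f (toℕ p) (toℕ m)
    digits-slot r p m f = trans
      (cong (digits r) (sym (trans (toℕ-combine (combine p m) f) (cong (λ x → 4 * x + toℕ f) (toℕ-combine p m)))))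
      (trans (extend-toℕ r (slot r) (combine (combine p m) f))
        (trans (cong (uncurry (λ pm f → uncurry (λ p m → entry r f (toℕ p) (toℕ m)) (remQuot {l} M pm))) (remQuot-combine {k = 4} (combine p m) f))
          (cong (uncurry (λ p m → entry r f (toℕ p) (toℕ m))) (remQuot-combine {k = M} p m))))

    digits-time : ∀ r → digits r K ≡ r
    digits-time r with K <? l * M * 4
    ... | yes K< = ⊥-elim (<⇒≢ K< K≡)
    ... | no _   = refl

    entry<b : ∀ {r} → r < n → ∀ f {p m} → p < l → m < M → entry r f p m < b
    entry<b r<n f p<l m<M = bound f
      where
      range = proj₁ (proj₁ (valid _ r<n) _ p<l _ m<M)
      bound : ∀ f → entry _ f _ _ < b
      bound zero                   = ≤-trans (proj₁ range) n≤b
      bound (suc zero)             = ≤-trans (proj₁ (proj₂ range)) n≤b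
      bound (suc (suc zero))       = ≤-trans (proj₂ (proj₂ (proj₂ range))) k≤b
      bound (suc (suc (suc zero))) = ≤-trans (proj₁ (proj₂ (proj₂ range))) n≤b

    digits<b : ∀ {r} → r < n → ∀ j → digits r j < b
    digits<b {r} r<n j with j <? l * M * 4
    ... | no _   = ≤-trans r<n n≤b
    ... | yes j< = entry<b r<n (proj₂ i) (toℕ<n (proj₁ pm)) (toℕ<n (proj₂ pm))
      where
      i = remQuot {l * M} 4 (fromℕ< j<)
      pm = remQuot {l} M (proj₁ i)

    read : ∀ {r} → r < n → ∀ j → j < suc K → ⟦ lookup globals₀ ⟧ A₀ digitT (codeAt r ∷ j ∷ []) ≡ digits r j
    read r<n = digit-correct (lookup globals₀) A₀ (digits _) (suc K) (λ i _ → digits<b r<n i) b≤B b^K≤B K≤B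

    field-read : ∀ {r} → r < n → ∀ (f : Fin 4) {p m} → p < l → m < M → field′ (toℕ f) p m (codeAt r) ≡ entry r f p m
    field-read {r} r<n f p<l m<M = subst₂ (λ p m → field′ (toℕ f) p m (codeAt r) ≡ entry r f p m)
      (toℕ-fromℕ< p<l) (toℕ-fromℕ< m<M) (go (fromℕ< p<l) (fromℕ< m<M))
      where
      go : ∀ p m → field′ (toℕ f) (toℕ p) (toℕ m) (codeAt r) ≡ entry r f (toℕ p) (toℕ m)
      go p m = trans
        (cong (λ x → ⟦ lookup globals₀ ⟧ A₀ digitT (codeAt r ∷ 4 * (x + toℕ m) + toℕ f ∷ []))
          (trans (mul-correct (lookup globals₀) A₀ (toℕ p) M M≤B) (*-comm (toℕ p) M)))
        (trans (read r<n _ (m<n⇒m<1+n (subst₂ _<_ (trans (toℕ-combine (combine p m) f) (cong (λ x → 4 * x + toℕ f) (toℕ-combine p m)))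
            (sym K≡) (toℕ<n (combine (combine p m) f)))))
          (digits-slot r p m f))

    time-read : ∀ {r} → r < n → r ≡ time″ (codeAt r)
    time-read r<n = sym (trans (read r<n K ≤-refl) (digits-time _))

    certificate-found : Found
    certificate-found with m≤n⇒∃[o]m+o≡n 0<n
    -- The last time is r = n - 1.
    ... | r , refl = codeAt r , ≤-trans (code<b^K b (digits r) (suc K) (λ i _ → digits<b ≤-refl i)) b^K≤B ,
      certificate-reach cert 0<M codeAt
        (λ r r<n p p<l m m<M → sym (field-read r<n zero p<l m<M) , sym (field-read r<n (suc zero) p<l m<M) ,
                               sym (field-read r<n (suc (suc zero)) p<l m<M))
        (λ r r<n p p<l m m<M → sym (field-read r<n (suc (suc (suc zero))) p<l m<M))
        (λ r r<n → time-read r<n)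
        (λ r r<n → code-< b (digits r) (digits (suc r)) K (λ i _ → digits<b (<⇒≤ r<n) i)
          (≤-reflexive (trans (cong suc (digits-time r)) (sym (digits-time (suc r))))))
        r ≤-refl ,
      cong suc (sym (time-read ≤-refl))

  solution-found : HasSolution I → Found
  solution-found solution = certificate-found (Completeness.certificate I M M-large solution)

-- The program and its running time

-- Its form makes it monotone in N, so that every phase of the program, though it runs under a cap
-- of its own, can be charged at the final cap.
bound : ∀ {v} → Term v → ℕ → ℕ
bound t N = proj₁ (polynomial-time t) * suc N ^ proj₁ (polynomial-time t)

polynomial-bound : ∀ {v} (t : Term v) → Polynomial (bound t)
polynomial-bound t = proj₁ (polynomial-time t) , λ _ → ≤-refl

time≤bound : ∀ {v} (t : Term v) {M N} → M ≤ N → time t M ≤ bound t N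
time≤bound t {M} M≤N = ≤-trans (proj₂ (polynomial-time t) M)
  (*-monoʳ-≤ (proj₁ (polynomial-time t)) (^-monoˡ-≤ (proj₁ (polynomial-time t)) (s≤s M≤N)))

set-to : ∀ g t x {B V A σ} → lookup V gcap ≤ B → ⟦ lookup V ⟧ A t [] ≡ x → State V A σ →
         Reaches (set g t) σ (bound t B + 3) (State (V [ g ]← x) A)
set-to g t x cap≤ refl s = weaken (+-monoˡ-≤ 3 (time≤bound t cap≤)) (set-correct g t s)

-- The exponent depends on k alone, so the products can be written out in the program; the second
-- factor of each is l, which the cap admits.
powerT : ℕ → ℕ → Term 0
powerT c zero    = lit c
powerT c (suc e) = call mulT (powerT c e ∷ g1 ∷ [])

power-correct : ∀ G A c e → G (suc zero) ≤ G gcap → ⟦ G ⟧ A (powerT c e) [] ≡ c * G (suc zero) ^ e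
power-correct G A c zero    l≤ = sym (*-identityʳ c)
power-correct G A c (suc e) l≤ = trans (mul-correct G A _ _ l≤)
  (trans (cong (_* G (suc zero)) (power-correct G A c e l≤)) (trans (*-assoc c _ _) (cong (c *_) (*-comm (G (suc zero) ^ e) _))))

sizeT baseT smallCapT capT : ℕ → Term 0
sizeT _     = call quadT (call mulT (g4 ∷ g1 ∷ []) ∷ [])
baseT k     = g0 ∔ lit k
smallCapT _ = lit 1 ∔ (g5 ∔ g3)
capT _      = loop (lit 1) (ite (lit 1 ∔ g5 ∸′ x1) (call mulT (x0 ∷ g3 ∷ [])) x0)

cap-correct : ∀ G A k → G gbase ≤ G gcap → suc (G (suc (suc (suc (suc (suc zero)))))) ≤ G gcap →
              ⟦ G ⟧ A (capT k) [] ≡ G gbase ^ suc (G (suc (suc (suc (suc (suc zero))))))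
cap-correct G A k b≤ K≤ = trans
  (fold-⊓ _ 1 (suc K) (b ^_) refl
    (λ m m< → trans (choose-suc _ _ (m<n⇒0<n∸m m<)) (trans (mul-correct G A (b ^ m) b b≤) (*-comm (b ^ m) b)))
    (λ m K<m → cong (λ c → choose c (⟦ G ⟧ A mulT (b ^ suc K ∷ b ∷ [])) (b ^ suc K)) (m≤n⇒m∸n≡0 K<m))
    (G gcap))
  (cong (b ^_) (m≥n⇒m⊓n≡n K≤))
  where
  b = G gbase
  K = G (suc (suc (suc (suc (suc zero)))))

*-^ : ∀ m a b → (a * b) ^ m ≡ a ^ m * b ^ m
*-^ zero    a b = refl
*-^ (suc m) a b = trans (cong (a * b *_) (*-^ m a b)) ([m*n]*[o*p]≡[m*o]*[n*p] a b (a ^ m) (b ^ m))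

module Machine (k : ℕ) where
  open Tables k

  -- For l ≥ 1 one has 1 + 3 l² ≤ 4 l², so 1 + 2 k (1 + 3 l²)^(2^k) is at most the coefficient times
  -- l^exponent; the summand 1 of the coefficient pays for the leading 1.
  coefficient exponent : ℕ
  coefficient = k * 4 ^ (2 ^ k) * 2 + 1
  exponent    = 2 ^ k + 2 ^ k

  piecesT : Term 0
  piecesT = powerT coefficient exponent

  -- Products need a factor within the cap and powers need enough rounds, so the cap grows in
  -- stages: l suffices to compute M and K, then 1 + K + b to compute b^(K + 1), which exceeds all
  -- codes.
  search : Program
  search = set gcap g1 ⨾ set (suc (suc (suc (suc zero)))) piecesT ⨾ set (suc (suc (suc (suc (suc zero))))) (sizeT k) ⨾
    set gbase (baseT k) ⨾ set gcap (smallCapT k) ⨾ set gcap (capT k) ⨾ fill entryT ⨾ set zero answerT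

  -- For l = 0 and for n = 1 the time allowed is only the constant C. These instances all have
  -- solutions and are accepted without a search.
  program : Program
  program = compile {0} g1 10 [] ⨾ (ifnz reg 10
    then (compile {0} (g0 ∸′ lit 1) 10 [] ⨾ (ifnz reg 10 then search else set zero (lit 1)))
    else set zero (lit 1))

  searchTime : ℕ → ℕ
  searchTime N = 1 + ((bound {0} g1 N + 3) + (1 + ((bound piecesT N + 3) + (1 + ((bound (sizeT k) N + 3) +
    (1 + ((bound (baseT k) N + 3) + (1 + ((bound (smallCapT k) N + 3) + (1 + ((bound (capT k) N + 3) +
    (1 + ((N * (bound entryT N + 13) + 7) + (bound answerT N + 3))))))))))))))

  abstract
    polynomial-searchTime : Polynomial searchTime
    polynomial-searchTime = next (next₃ {0} g1) (next (next₃ piecesT) (next (next₃ (sizeT k)) (next (next₃ (baseT k))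
      (next (next₃ (smallCapT k)) (next (next₃ (capT k)) (next
        (polynomial-+ (polynomial-* polynomial-id (polynomial-+ (polynomial-bound entryT) (polynomial-const 13))) (polynomial-const 7))
        (next₃ answerT)))))))
      where
      next₃ : ∀ {v} (t : Term v) → Polynomial (λ N → bound t N + 3)
      next₃ t = polynomial-+ (polynomial-bound t) (polynomial-const 3)
      next : ∀ {f g} → Polynomial f → Polynomial g → Polynomial (λ N → 1 + (f N + g N))
      next p q = polynomial-+ (polynomial-const 1) (polynomial-+ p q)

  Decided : Set → Memory → Set
  Decided P τ = Σ (Dec P) λ d → regs τ 0 ≡ bit (does d)

  decided : ∀ {v P Q τ} → Truth v Q → regs τ 0 ≡ v → (Q → P) → (P → Q) → Decided P τ
  decided (holds q)  eq f g = yes (f q) , eq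
  decided (fails ¬q) eq f g = no (¬q ∘ g) , eq

  m<b^m : ∀ {b} → 2 ≤ b → ∀ m → m < b ^ m
  m<b^m 2≤b zero    = s≤s z≤n
  m<b^m {b} 2≤b (suc m) = ≤-trans (+-mono-≤ (≤-trans (s≤s z≤n) (m<b^m 2≤b m)) (m<b^m 2≤b m))
    (≤-trans (≤-reflexive (cong (b ^ m +_) (sym (+-identityʳ _)))) (*-monoˡ-≤ (b ^ m) 2≤b))

  start : ∀ {n l} (I : Instance k n l) → State (n ∷ l ∷ 0 ∷ 0 ∷ 0 ∷ 0 ∷ 0 ∷ 0 ∷ 0 ∷ 0 ∷ []) (arrs (encode I)) (encode I)
  start {n} {l} I = state at refl
    where
    at : ∀ g → regs (encode I) (toℕ g) ≡ lookup (n ∷ l ∷ 0 ∷ 0 ∷ 0 ∷ 0 ∷ 0 ∷ 0 ∷ 0 ∷ 0 ∷ []) g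
    at zero = refl
    at (suc zero) = refl
    at (suc (suc g)) = sym (zeros 8 g)
      where
      zeros : ∀ m (g : Fin m) → lookup (Data.Vec.replicate m 0) g ≡ 0
      zeros (suc m) zero    = refl
      zeros (suc m) (suc g) = zeros m g

  module _ {n l : ℕ} (2≤n : 2 ≤ n) (1≤l : 1 ≤ l) where

    N M K b B : ℕ
    N = 2 ^ k
    M = coefficient * l ^ exponent
    K = 4 * (M * l)
    b = n + k
    B = b ^ suc K

    instance
      l-nonZero : NonZero l
      l-nonZero = >-nonZero 1≤l

    1≤l^ : ∀ e → 1 ≤ l ^ e
    1≤l^ e = m^n>0 l e

    M-large : suc (k * (suc (3 * (l * l)) ^ (2 ^ k)) * 2) ≤ M
    M-large = ≤-trans (s≤s (*-monoˡ-≤ 2 (*-monoʳ-≤ k (≤-trans (^-monoˡ-≤ N quadratic) (≤-reflexive power))))) (≤-trans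
      (≤-trans (≤-reflexive (+-comm 1 _)) (+-mono-≤ (≤-reflexive (solve 3 (λ k q x → k :* (q :* x) :* con 2 := k :* q :* con 2 :* x) refl k (4 ^ N) (l ^ (N + N))))
        (≤-trans (1≤l^ (N + N)) (≤-reflexive (sym (*-identityˡ _))))))
      (≤-reflexive (sym (*-distribʳ-+ (l ^ exponent) (k * 4 ^ N * 2) 1))))
      where
      open +-*-Solver
      quadratic : suc (3 * (l * l)) ≤ 4 * (l * l)
      quadratic = +-monoˡ-≤ (3 * (l * l)) (*-mono-≤ 1≤l 1≤l)
      power : (4 * (l * l)) ^ N ≡ 4 ^ N * l ^ (N + N)
      power = trans (*-^ N 4 (l * l)) (cong (4 ^ N *_) (trans (*-^ N l l) (sym (^-distribˡ-+-* l N N))))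

    1≤M : 1 ≤ M
    1≤M = ≤-trans (s≤s z≤n) M-large

    K≡ : K ≡ l * M * 4
    K≡ = trans (*-comm 4 (M * l)) (cong (_* 4) (*-comm M l))

    M*l≤K : M * l ≤ K
    M*l≤K = m≤m+n (M * l) _

    1≤K : 1 ≤ K
    1≤K = ≤-trans (*-mono-≤ 1≤M 1≤l) M*l≤K

    2≤b : 2 ≤ b
    2≤b = ≤-trans 2≤n (m≤m+n n k)

    K≤B : suc K ≤ B
    K≤B = <⇒≤ (m<b^m 2≤b (suc K))

    l≤B : l ≤ B
    l≤B = ≤-trans (≤-trans (m≤n*m l M {{>-nonZero 1≤M}}) M*l≤K) (≤-trans (n≤1+n K) K≤B)

    M≤B : M ≤ B
    M≤B = ≤-trans (≤-trans (m≤m*n M l) M*l≤K) (≤-trans (n≤1+n K) K≤B)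

    smallCap≤B : 1 + (K + b) ≤ B
    -- The chain is 1 + K + b ≤ 2 K + b ≤ b K + b = b (K + 1) ≤ b · b^K.
    smallCap≤B = ≤-trans (≤-trans (+-monoˡ-≤ b (+-monoˡ-≤ K 1≤K)) (≤-trans (+-monoˡ-≤ b (≤-trans
        (≤-reflexive (cong (K +_) (sym (+-identityʳ K)))) (*-monoˡ-≤ K 2≤b))) (≤-reflexive (trans (+-comm (b * K) b) (sym (*-suc b K))))))
      (*-monoʳ-≤ b (m<b^m 2≤b K))

    b≤B : b ≤ B
    b≤B = ≤-trans (m≤n+m b (suc K)) smallCap≤B

    searches : (I : Instance k n l) → ∀ σ → State (n ∷ l ∷ 0 ∷ 0 ∷ 0 ∷ 0 ∷ 0 ∷ 0 ∷ 0 ∷ 0 ∷ []) (arrs (encode I)) σ →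
               Reaches search σ (searchTime B) (Decided (HasSolution I))
    searches I σ s₀ =
      seq (set-to gcap g1 l z≤n refl s₀) λ _ s₁ →
      seq (set-to (suc (suc (suc (suc zero)))) piecesT M l≤B (power-correct _ _ coefficient exponent ≤-refl) s₁) λ _ s₂ →
      seq (set-to (suc (suc (suc (suc (suc zero))))) (sizeT k) K l≤B (cong (4 *_) (mul-correct (lookup V₂) (arrs (encode I)) M l ≤-refl)) s₂) λ _ s₃ →
      seq (set-to gbase (baseT k) b l≤B refl s₃) λ _ s₄ →
      seq (set-to gcap (smallCapT k) (1 + (K + b)) l≤B refl s₄) λ _ s₅ →
      seq (set-to gcap (capT k) B smallCap≤B (cap-correct (lookup V₅) (arrs (encode I)) k (m≤n+m b (suc K)) (s≤s (m≤m+n K b))) s₅) λ _ s₆ →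
      seq (weaken (+-monoˡ-≤ 7 (*-monoʳ-≤ B (+-monoˡ-≤ 13 (time≤bound entryT ≤-refl))))
             (fill-correct entryT Inv globals₀ inv-step inv-start s₆)) λ { τ (A , inv , s₇) → answer τ A inv s₇ }
      where
      open Search I M K b B M-large K≡ (m≤m+n n k) (m≤n+m k n) b≤B ≤-refl K≤B l≤B M≤B (≤-trans (s≤s z≤n) 2≤n)
      V₂ V₅ : Vec ℕ 10
      V₂ = n ∷ l ∷ l ∷ 0 ∷ M ∷ 0 ∷ 0 ∷ 0 ∷ 0 ∷ 0 ∷ []
      V₅ = n ∷ l ∷ 1 + (K + b) ∷ b ∷ M ∷ K ∷ 0 ∷ 0 ∷ 0 ∷ 0 ∷ []
      answer : ∀ τ A → Inv B A → State (globals₀ [ gz ]← B) A τ → Reaches (set zero answerT) τ (bound answerT B + 3) (Decided (HasSolution I))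
      answer τ A inv s with set-to zero answerT (⟦ lookup (globals₀ [ gz ]← B) ⟧ A answerT []) {V = globals₀ [ gz ]← B} ≤-refl refl s
      ... | reaches {end = τ′} run bd (state gl _) = reaches run bd (decided {τ = τ′} (truth-answer B inv) (gl zero) found-solution solution-found)

-- The exponent of the running time.

module Decision (k : ℕ) where
  open Machine k

  -- The search takes at most E (B + 1)^E steps. As a factor, C has to cover E and the 18 steps of
  -- the two tests; in the exponent it has to cover the last summand. The program needs at most 23
  -- steps if it does not search.
  E C : ℕ
  E = proj₁ polynomial-searchTime
  C = 23 + (E + suc k * (6 * coefficient) * E)

  -- The additional 1 is for the factor l in the number 4 M l of digits below the time.
  exponent-bound : 1 ≤ k → suc exponent ≤ 5 ^ k
  exponent-bound (s≤s {n = k} _) = go k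
    where
    open +-*-Solver
    go : ∀ k → suc (2 ^ suc k + 2 ^ suc k) ≤ 5 ^ suc k
    go zero    = ≤-refl
    go (suc k) = ≤-trans (≤-trans (m≤m+n _ (4 + 3 * (2 * 2 ^ suc k)))
      (≤-reflexive (solve 1 (λ x → con 1 :+ (con 2 :* x :+ con 2 :* x) :+ (con 4 :+ con 3 :* (con 2 :* x)) := con 5 :* (con 1 :+ (x :+ x))) refl (2 ^ suc k))))
      (*-monoʳ-≤ 5 (go k))

  module _ {n l : ℕ} (2≤n : 2 ≤ n) (1≤l : 1 ≤ l) (1≤k : 1 ≤ k) where
    private
      b′ K′ M′ B′ X : ℕ
      b′ = b 2≤n 1≤l
      K′ = K 2≤n 1≤l
      M′ = M 2≤n 1≤l
      B′ = B 2≤n 1≤l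
      X  = l ^ (5 ^ k)

      instance
        n-nonZero : NonZero n
        n-nonZero = >-nonZero (≤-trans (s≤s z≤n) 2≤n)

    -- As n ≥ 2, the factor 1 + k in n + k ≤ n (1 + k) is at most n^k. So the base of the codes
    -- costs only a constant factor in the exponent.
    b≤n^ : b′ ≤ n ^ suc k
    b≤n^ = ≤-trans (+-monoʳ-≤ n (m≤n*m k n)) (≤-trans (≤-reflexive (sym (*-suc n k))) (*-monoʳ-≤ n (m<b^m 2≤n k)))

    1+B≤ : suc B′ ≤ b′ ^ (2 + K′)
    1+B≤ = ≤-trans (+-monoˡ-≤ B′ (≤-trans (s≤s z≤n) (K≤B 2≤n 1≤l)))
      (≤-trans (≤-reflexive (cong (B′ +_) (sym (+-identityʳ B′)))) (*-monoˡ-≤ B′ (2≤b 2≤n 1≤l)))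

    M*l≤ : M′ * l ≤ coefficient * X
    M*l≤ = ≤-trans (≤-reflexive (trans (*-assoc coefficient (l ^ exponent) l) (cong (coefficient *_) (*-comm (l ^ exponent) l))))
      (*-monoʳ-≤ coefficient (^-monoʳ-≤ l {{>-nonZero 1≤l}} (exponent-bound 1≤k)))

    2+K≤ : 2 + K′ ≤ 6 * (coefficient * X)
    2+K≤ = ≤-trans (≤-trans (+-monoˡ-≤ K′ (*-monoʳ-≤ 2 (*-mono-≤ (1≤M 2≤n 1≤l) 1≤l))) (≤-reflexive (sym (*-distribʳ-+ (M′ * l) 2 4))))
      (*-monoʳ-≤ 6 M*l≤)

    exponents : suc k * ((2 + K′) * E) ≤ C * X
    exponents = ≤-trans (*-monoʳ-≤ (suc k) (*-monoˡ-≤ E 2+K≤))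
      (≤-trans (≤-reflexive (solve 4 (λ k c x e → k :* (con 6 :* (c :* x) :* e) := k :* (con 6 :* c) :* e :* x) refl (suc k) coefficient X E))
        (*-monoˡ-≤ X (≤-trans (m≤n+m _ E) (m≤n+m _ 23))))
      where open +-*-Solver

    time-bound : 18 + searchTime B′ ≤ C * n ^ (C * X)
    time-bound = ≤-trans (+-mono-≤ (m≤m*n 18 P {{>-nonZero 1≤P}}) (≤-trans (proj₂ polynomial-searchTime B′) (*-monoʳ-≤ E powers)))
      (≤-trans (≤-reflexive (sym (*-distribʳ-+ P 18 E)))
        (*-monoˡ-≤ P (+-mono-≤ (m≤m+n 18 5) (m≤m+n E _))))
      where
      P : ℕ
      P = n ^ (C * X)
      1≤P : 1 ≤ P
      1≤P = m^n>0 n (C * X)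
      powers : suc B′ ^ E ≤ P
      powers = ≤-trans (^-monoˡ-≤ E (≤-trans 1+B≤ (^-monoˡ-≤ (2 + K′) b≤n^)))
        (≤-trans (≤-reflexive (trans (cong (_^ E) (^-*-assoc n (suc k) (2 + K′)))
          (trans (^-*-assoc n (suc k * (2 + K′)) E) (cong (n ^_) (*-assoc (suc k) (2 + K′) E)))))
          (^-monoʳ-≤ n exponents))

  accept : ∀ {P V A σ} → P → State V A σ → Reaches (set zero (lit 1)) σ 5 (Decided P)
  accept {V = V} p s with set-correct zero (lit 1) s
  ... | reaches run bd (state gl _) = reaches run bd (yes p , trans (gl zero) (lookup∘update zero V 1))

  no-pairs : ∀ {n} (I : Instance k n 0) → HasSolution I
  no-pairs I = (λ ()) , (λ ()) , λ ()

  one-vertex : ∀ {l} (I : Instance k 1 l) → HasSolution I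
  one-vertex I = (λ _ → P) , (λ i → (λ ()) , inj₁ (unique _ _ , unique _ _)) ,
    λ _ _ _ v → (λ i _ → proj₁ (proj₂ i) (unique _ _)) , (λ i _ → proj₁ (proj₂ i) (unique _ _))
    where
    unique : ∀ (x y : Fin 1) → x ≡ y
    unique zero zero = refl
    P : Path (Instance.graph I)
    P = record { length = 0 ; vertex = λ _ → zero ; distinct = λ _ → unique _ _ ; edges = λ () }

  within : ∀ {P σ T N} → T ≤ N → Reaches program σ T (Decided P) → DecidesWithin program σ P N
  within T≤N (reaches run bd post) = _ , _ , run , ≤-trans bd T≤N , post

  small : ∀ {m} → m ≤ 23 → ∀ {x} → x ≡ 1 → m ≤ C * x
  small m≤ refl = ≤-trans m≤ (≤-trans (m≤m+n 23 _) (≤-reflexive (sym (*-identityʳ C))))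

  decides : ∀ n l (I : Instance k n l) → DecidesWithin program (encode I) (HasSolution I) (C * n ^ (C * l ^ (5 ^ k)))
  decides n zero I = within (small (m≤m+n 10 13) (cong (n ^_) (trans (cong (C *_) (0^ (5 ^ k) (m^n>0 5 k))) (*-zeroʳ C))))
    (if-correct g1 (start I) (λ 0≢0 → ⊥-elim (0≢0 refl)) (λ _ τ s → accept (no-pairs I) s))
    where
    0^ : ∀ m → 1 ≤ m → 0 ^ m ≡ 0
    0^ (suc m) _ = refl
  decides zero (suc l) I with () ← Instance.s I zero
  decides 1 (suc l) I = within (small ≤-refl (^-zeroˡ (C * suc l ^ (5 ^ k))))
    (if-correct g1 (start I)
      (λ _ _ s → if-correct (g0 ∸′ lit 1) s (λ 0≢0 → ⊥-elim (0≢0 refl)) (λ _ _ s → accept (one-vertex I) s))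
      (λ ()))
  -- The colour of the first pair shows that k ≥ 1, as `exponent-bound` requires.
  decides (suc (suc n)) (suc l) I = within (time-bound 2≤n 1≤l (≤-trans (s≤s z≤n) (toℕ<n (Instance.c I zero))))
    (if-correct g1 (start I)
      (λ _ _ s → if-correct (g0 ∸′ lit 1) s (λ _ τ s → searches 2≤n 1≤l I τ s) (λ ()))
      (λ ()))
    where
    2≤n : 2 ≤ suc (suc n)
    2≤n = s≤s (s≤s z≤n)
    1≤l : 1 ≤ suc l
    1≤l = s≤s z≤n

theorem4 : (k : ℕ) → ∃ λ (p : Program) → ∃ λ (C : ℕ) →
    (n l : ℕ) (I : Instance k n l) →
    DecidesWithin p (encode I) (HasSolution I) (C * n ^ (C * l ^ (5 ^ k)))
theorem4 k = Machine.program k , Decision.C k , Decision.decides k
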